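{- Let $k\ge 3$ and $r\ge 1$, and let $n_1,\dots,n_r\ge 2$ be integers. For each $1\le i\le r$ let $\mathcal{F}^1_i,\dots,\mathcal{F}^k_i$ be pairwise almost orthogonal symmetric chain decompositions of $Q_{n_i}$. Suppose that the collection $\{\mathcal{F}^j_i\}_{j=1}^k$ is good for every $i$ with $n_i$ even, and that, among the indices $i$ with $n_i$ odd, either the collections $\{\mathcal{F}^j_i\}_{j=1}^k$ are good for all of them or they are good for at least two of them. Then there exist $k$ pairwise almost orthogonal symmetric chain decompositions $\mathcal{H}^1,\dots,\mathcal{H}^k$ of $Q_{n_1+\cdots+n_r}$ such that for each $j$, every chain of $\mathcal{H}^j$ is contained in a cuboid $A_1\times\cdots\times A_r$ with $A_i\in\mathcal{F}^j_i$ for all $i$ (i.e. $\mathcal{H}^j$ is obtained by decomposing each such cuboid into symmetric chains).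
   Context: $Q_n$ denotes the Boolean lattice of subsets of $[n]=\{1,\dots,n\}$ under inclusion. We identify $Q_{n_1}\times\cdots\times Q_{n_r}$ (product order) with $Q_{n_1+\cdots+n_r}$ by splitting $[n_1+\cdots+n_r]$ into consecutive blocks of sizes $n_1,\dots,n_r$. A symmetric chain in $Q_n$ consists of exactly one subset of each size $j,j+1,\dots,n-j$ for some $j$; a symmetric chain decomposition (SCD) is a partition of $Q_n$ into symmetric chains. Two SCDs $\mathcal{F},\mathcal{G}$ of $Q_n$ are almost orthogonal if for all chains $A\in\mathcal{F}$, $B\in\mathcal{G}$, $|A\cap B|\le1$, except when $A$ and $B$ both contain $\varnothing$ and $[n]$, in which case $|A\cap B|=2$. A collection $\{\mathcal{F}^j\}$ of pairwise almost orthogonal SCDs of $Q_n$ is good if either $n$ is even and the $1$-element chains occurring in the different $\mathcal{F}^j$ are pairwise distinct (no $1$-element chain belongs to two different $\mathcal{F}^j$), or $n$ is odd and the graph whose vertex set is the union of all $2$-element chains of all $\mathcal{F}^j$ and whose edges are these $2$-element chains admits an orientation of its edges in which every vertex has out-degree at most $1$. -}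

module Defs where

open import Data.Nat using (ℕ; zero; suc; _+_; _∸_; _≤_; _%_)
open import Data.Bool using (Bool)
import Data.Bool.Properties as BoolP
open import Data.Fin using (Fin; zero; suc)
open import Data.Fin.Subset using (Subset; _⊆_; ∣_∣; ⊥; ⊤)
open import Data.Vec using (Vec; []; _∷_; lookup; take; drop)
open import Data.Vec.Properties using (≡-dec)
open import Data.List using (List; length; map; upTo; concat; filter)
open import Data.List.Membership.Propositional using (_∈_)
open import Data.List.Relation.Unary.Linked using (Linked)
open import Data.List.Relation.Unary.Unique.Propositional using (Unique)
open import Data.Product using (Σ; ∃; _×_)
open import Relation.Binary.PropositionalEquality using (_≡_; _≢_)
open import Relation.Binary.Definitions using (DecidableEquality)
open import Relation.Nullary using (¬_)

_≟ˢ_ : ∀ {n} → DecidableEquality (Subset n)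
_≟ˢ_ = ≡-dec BoolP._≟_


-- A chain is represented as a list of subsets (listed bottom-up).
Chain : ℕ → Set
Chain n = List (Subset n)

IsSymmetricChain : (n : ℕ) → Chain n → Set
IsSymmetricChain n C =
  Σ ℕ λ j → (j + j ≤ n)
          × (map ∣_∣ C ≡ map (j +_) (upTo (suc (n ∸ (j + j)))))
          × Linked _⊆_ C

IsSCD : (n : ℕ) → List (Chain n) → Set
IsSCD n F =
  (∀ C → C ∈ F → IsSymmetricChain n C)
  × Unique (concat F)
  × (∀ (X : Subset n) → X ∈ concat F)

inter : ∀ {n} → Chain n → Chain n → Chain n
inter {n} A B = filter (λ x → x ∈? B) A
  where open import Data.List.Membership.DecPropositional (_≟ˢ_ {n}) using (_∈?_)

Full : ∀ {n} → Chain n → Set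
Full C = (⊥ ∈ C) × (⊤ ∈ C)

AlmostOrthogonal : (n : ℕ) → List (Chain n) → List (Chain n) → Set
AlmostOrthogonal n F G =
  ∀ A B → A ∈ F → B ∈ G →
    ((Full A × Full B) → length (inter A B) ≡ 2)
    × (¬ (Full A × Full B) → length (inter A B) ≤ 1)

PairwiseAlmostOrthogonal : (n k : ℕ) → (Fin k → List (Chain n)) → Set
PairwiseAlmostOrthogonal n k F =
  ∀ j j' → j ≢ j' → AlmostOrthogonal n (F j) (F j')

Even : ℕ → Set
Even n = n % 2 ≡ 0

Odd : ℕ → Set
Odd n = n % 2 ≡ 1

GoodEven : (n k : ℕ) → (Fin k → List (Chain n)) → Set
GoodEven n k F =
  ∀ j j' → j ≢ j' → ∀ C → C ∈ F j → C ∈ F j' → ¬ (length C ≡ 1)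

-- n odd: the graph whose edges are the 2-element chains of all F^j admits an
-- orientation with out-degree ≤ 1: a choice of tail o C ∈ C for every edge C,
-- such that distinct edges have distinct tails.
GoodOdd : (n k : ℕ) → (Fin k → List (Chain n)) → Set
GoodOdd n k F =
  Σ (Chain n → Subset n) λ o →
    (∀ j C → C ∈ F j → length C ≡ 2 → o C ∈ C)
    × (∀ j j' C C' → C ∈ F j → C' ∈ F j' → length C ≡ 2 → length C' ≡ 2 →
         o C ≡ o C' → C ≡ C')

Good : (n k : ℕ) → (Fin k → List (Chain n)) → Set
Good n k F = (Even n → GoodEven n k F) × (Odd n → GoodOdd n k F)

-- Q_{n_1} × ... × Q_{n_r} identified with Q_{n_1+...+n_r} by consecutive blocks.
total : ∀ {r} → Vec ℕ r → ℕ
total [] = 0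
total (n ∷ ns) = n + total ns

block : ∀ {r} (ns : Vec ℕ r) → Subset (total ns) → (i : Fin r) → Subset (lookup ns i)
block (n ∷ ns) x zero = take n x
block (n ∷ ns) x (suc i) = block ns (drop n x) i

{-# OPTIONS --safe #-}
module Submission where

-- Chains from different families meet in at most one point unless both are full, when they meet in ∅ and
-- the top. So if chains of two cuboids from different families share points p ⊂ q, then q arises from p by
-- switching some full factors from bottom to top. It suffices to decompose each cuboid, independently of
-- the others, into symmetric chains containing as few such switches as possible. Since k ≥ 3 forces
-- nᵢ ≥ 4, full factors are long. For two long chains C, B in which only (bottom, top) is a switch,
-- the grid C × B splits into a main chain with the same property, a second chain without switches and
-- a rectangle X × Y of chains without switches. A product of chains without switches can be decomposed
-- arbitrarily, so the rectangle is kept as a product until it has absorbed the remaining full factors.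
-- This removes all switches when some non-full factor has at least three elements, and, with a finer
-- splitting of the grid, also when there are two full factors and a 2-element factor. Otherwise goodness
-- rules out a common switch: if the non-full factors are singletons they would be 1-element chains common
-- to both families, and if there is one full factor, then its switch is placed at the tail of the
-- 2-element chain chosen in a good factor that depends only on the position of the full factor.

open import Defs
import Algebra.Solver.CommutativeMonoid as CMSolver
open import Data.Bool using (true; false)
open import Data.Empty using (⊥; ⊥-elim)
open import Data.Fin using (Fin; zero; suc; #_)
import Data.Fin.Properties as Finₚ
open import Data.Fin.Subset using (Subset; _⊆_; ∣_∣; inside; outside) renaming (⊥ to ∅; ⊤ to 𝟏)
import Data.Fin.Subset as Subset
import Data.Fin.Subset.Properties as Subsetₚ
open import Data.List using (List; []; _∷_; [_]; _++_; _∷ʳ_; map; concat; concatMap; foldr; length; upTo; applyUpTo; allFin; cartesianProductWith)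
import Data.List.Properties as Listₚ
open import Data.List.Membership.Propositional using (_∈_; find; lose; mapWith∈)
open import Data.List.Membership.Propositional.Properties using (∈-++⁺ˡ; ∈-++⁺ʳ; ∈-++⁻; ∈-∃++; ∈-allFin; ∈-applyUpTo⁻; ∈-upTo⁺; ∈-upTo⁻; ∈-map⁺; ∈-map⁻; ∈-concat⁻′; ∈-filter⁺; ∈-filter⁻; ∈-cartesianProductWith⁺; ∈-cartesianProductWith⁻; map-mapWith∈; mapWith∈-id)
open import Data.List.Relation.Binary.Permutation.Propositional using (_↭_; prep; swap; ↭-refl; ↭-sym; ↭-trans; ↭-reflexive; ↭⇒↭ₛ)
open import Data.List.Relation.Binary.Permutation.Propositional.Properties using (++-commutativeMonoid; ∈-resp-↭; All-resp-↭; shift; map⁺; ++⁺; ++⁺ˡ; ++⁺ʳ)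
import Data.List.Relation.Binary.Permutation.Setoid.Properties as Permₛ
open import Data.List.Relation.Unary.All as All using (All; []; _∷_)
import Data.List.Relation.Unary.All.Properties as Allₚ
open import Data.List.Relation.Unary.AllPairs as AllPairs using (AllPairs; []; _∷_)
import Data.List.Relation.Unary.AllPairs.Properties as AllPairsₚ
open import Data.List.Relation.Unary.Any as Any using (here; there)
open import Data.List.Relation.Unary.Linked using (Linked; [-]; _∷_)
import Data.List.Relation.Unary.Linked.Properties as Linkedₚ
open import Data.List.Relation.Unary.Unique.Propositional using (Unique)
import Data.List.Relation.Unary.Unique.Propositional.Properties as Uniqueₚ
open import Data.Nat using (ℕ; zero; suc; _+_; _*_; _∸_; _%_; _≤_; _<_; z≤n; s≤s)
open import Data.Nat.DivMod using ([m+kn]%n≡m%n)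
open import Data.Nat.ListAction using () renaming (sum to ∑)
open import Data.Nat.ListAction.Properties using (sum-↭; sum-++)
open import Data.Nat.Properties as ℕₚ using (≤-refl; ≤-trans; ≤-reflexive; +-comm; +-assoc; +-suc; +-mono-≤; +-monoʳ-≤; +-monoˡ-≤; +-identityʳ; n≤1+n; <⇒≢; <-irrefl; <-≤-trans; ≤-<-trans; <⇒≤; m≤m+n; m≤n+m; +-cancelˡ-≡)
open import Data.Nat.Tactic.RingSolver using (solve-∀)
open import Algebra.Properties.CommutativeSemigroup ℕₚ.+-commutativeSemigroup using (interchange)
open import Data.Product using (Σ; Σ-syntax; _×_; _,_; proj₁; proj₂)
open import Data.Sum using (_⊎_; inj₁; inj₂)
open import Data.Unit using (⊤; tt)
open import Data.Vec using (Vec; []; _∷_; here; there; lookup; zipWith; replicate; _[_]≔_; sum; take; drop) renaming (_++_ to _⧺_)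
import Data.Vec.Properties as Vecₚ
open import Function using (_∘_; flip; id)
open import Relation.Binary.PropositionalEquality using (_≡_; _≢_; refl; sym; trans; cong; cong₂; subst; subst₂; setoid; resp₂; module ≡-Reasoning)
open import Relation.Nullary using (¬_; Dec; yes; no)

-- Some switches are unavoidable, and this shapes the case split. The longest chain of a cuboid
-- joins its bottom to its top, which is a switch when all non-full factors are single points. For
-- one full factor C and a 2-element factor only, the longest chain must leave the lower copy of C
-- at an end of C, since otherwise the points left over form no chain. So one copy of C keeps its
-- switch, but either copy may be chosen. A second full factor D removes it: if one point is put
-- below the upper copy of C, the switch starts one level above the bottom, and the longest chain of
-- the product with D can miss its start. Lengths: a rectangle side loses two points at a corner and
-- three in the finer splitting, and the next corner needs three points. A full factor has at least
-- five, and at least six with a point of the 2-element factor added, which is just enough. All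
-- splitting is done on vectors of positions: each factor lies on its own axis and a product is a
-- list of sums, so partial products of any shape are treated alike.

module BagSolver {A : Set} = CMSolver (++-commutativeMonoid {A = A})

-- Permutations and Cartesian products of lists.

AllPairs-resp-↭ : {A : Set} {R : A → A → Set} → (∀ {x y} → R x y → R y x) →
  ∀ {xs ys} → xs ↭ ys → AllPairs R xs → AllPairs R ys
AllPairs-resp-↭ {A} {R} R-sym p = Permₛ.AllPairs-resp-↭ (setoid A) R-sym (resp₂ R) (↭⇒↭ₛ p)

module _ {A B C : Set} (f : A → B → C) where

  private
    _⊗_ = cartesianProductWith f

  ⊗-++ʳ : ∀ xs ys zs → xs ⊗ (ys ++ zs) ↭ (xs ⊗ ys) ++ (xs ⊗ zs)
  ⊗-++ʳ [] ys zs = ↭-refl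
  ⊗-++ʳ (x ∷ xs) ys zs = ↭-trans
    (++⁺ (↭-reflexive (Listₚ.map-++ (f x) ys zs)) (⊗-++ʳ xs ys zs))
    (prove 4 ((var (# 0) ∙ var (# 1)) ∙ (var (# 2) ∙ var (# 3)))
             ((var (# 0) ∙ var (# 2)) ∙ (var (# 1) ∙ var (# 3)))
             (map (f x) ys ∷ map (f x) zs ∷ (xs ⊗ ys) ∷ (xs ⊗ zs) ∷ []))
    where open BagSolver renaming (_⊕_ to _∙_)

  ⊗-congˡ : ∀ {xs xs′} ys → xs ↭ xs′ → xs ⊗ ys ↭ xs′ ⊗ ys
  ⊗-congˡ ys _↭_.refl = ↭-refl
  ⊗-congˡ ys (prep x p) = ++⁺ˡ (map (f x) ys) (⊗-congˡ ys p)
  ⊗-congˡ ys (swap {xs} {xs′} x x′ p) = ↭-trans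
    (++⁺ˡ (map (f x) ys) (++⁺ˡ (map (f x′) ys) (⊗-congˡ ys p)))
    (prove 3 (var (# 0) ∙ (var (# 1) ∙ var (# 2)))
             (var (# 1) ∙ (var (# 0) ∙ var (# 2)))
             (map (f x) ys ∷ map (f x′) ys ∷ (xs′ ⊗ ys) ∷ []))
    where open BagSolver renaming (_⊕_ to _∙_)
  ⊗-congˡ ys (_↭_.trans p q) = ↭-trans (⊗-congˡ ys p) (⊗-congˡ ys q)

  ⊗-congʳ : ∀ xs {ys ys′} → ys ↭ ys′ → xs ⊗ ys ↭ xs ⊗ ys′
  ⊗-congʳ [] p = ↭-refl
  ⊗-congʳ (x ∷ xs) p = ++⁺ (map⁺ (f x) p) (⊗-congʳ xs p)

  ⊗-[-]ʳ : ∀ xs y → xs ⊗ [ y ] ≡ map (λ x → f x y) xs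
  ⊗-[-]ʳ [] y = refl
  ⊗-[-]ʳ (x ∷ xs) y = cong (f x y ∷_) (⊗-[-]ʳ xs y)

  ⊗-∷ʳ : ∀ xs ys y → xs ⊗ (ys ∷ʳ y) ↭ (xs ⊗ ys) ++ map (λ x → f x y) xs
  ⊗-∷ʳ xs ys y = ↭-trans (⊗-++ʳ xs ys [ y ]) (++⁺ˡ (xs ⊗ ys) (↭-reflexive (⊗-[-]ʳ xs y)))

⊗-flip : {A B C : Set} (f : A → B → C) → ∀ xs ys →
  cartesianProductWith f xs ys ↭ cartesianProductWith (flip f) ys xs
⊗-flip f [] ys = ↭-reflexive (sym (Listₚ.cartesianProductWith-zeroʳ (flip f) ys))
⊗-flip f (x ∷ xs) ys = ↭-trans
  (++⁺ (↭-reflexive (sym (⊗-[-]ʳ (flip f) ys x))) (⊗-flip f xs ys))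
  (↭-sym (⊗-++ʳ (flip f) ys [ x ] xs))

cartesianProductWith-cong : {A B C : Set} {f g : A → B → C} → (∀ x y → f x y ≡ g x y) →
  ∀ xs ys → cartesianProductWith f xs ys ≡ cartesianProductWith g xs ys
cartesianProductWith-cong f≗g [] ys = refl
cartesianProductWith-cong f≗g (x ∷ xs) ys =
  cong₂ _++_ (Listₚ.map-cong (f≗g x) ys) (cartesianProductWith-cong f≗g xs ys)

split-↭ : {A : Set} {P : A → Set} → (∀ x → Dec (P x)) → (xs : List A) →
  Σ[ ys ∈ List A ] Σ[ zs ∈ List A ] (xs ↭ ys ++ zs × All P ys × All (¬_ ∘ P) zs)
split-↭ P? [] = [] , [] , ↭-refl , [] , []
split-↭ P? (x ∷ xs) with P? x | split-↭ P? xs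
... | yes px | ys , zs , p , all , none = x ∷ ys , zs , prep x p , px ∷ all , none
... | no ¬px | ys , zs , p , all , none =
  ys , x ∷ zs , ↭-trans (prep x p) (↭-sym (shift x ys zs)) , all , ¬px ∷ none

rank : ∀ {r} → Vec ℕ r → ℕ
rank = sum

rank-zipWith : ∀ {r} (u v : Vec ℕ r) → rank (zipWith _+_ u v) ≡ rank u + rank v
rank-zipWith [] [] = refl
rank-zipWith (a ∷ u) (b ∷ v) rewrite rank-zipWith u v = interchange a b (rank u) (rank v)

rank-𝟎 : ∀ r → rank (replicate r 0) ≡ 0
rank-𝟎 zero = refl
rank-𝟎 (suc r) = rank-𝟎 r

rank-single : ∀ {r} (i : Fin r) y → rank (replicate r 0 [ i ]≔ y) ≡ y
rank-single {suc r} zero y = trans (cong (y +_) (rank-𝟎 r)) (+-identityʳ y)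
rank-single (suc i) y = rank-single i y

unique-prefix : {A : Set} (xs : List A) {ys : List A} → Unique (xs ++ ys) → Unique xs
unique-prefix [] _ = []
unique-prefix (x ∷ xs) (x∉ ∷ uniq) = Allₚ.++⁻ˡ xs x∉ ∷ unique-prefix xs uniq

applyUpTo-cong : ∀ {f g : ℕ → ℕ} → (∀ k → f k ≡ g k) → ∀ n → applyUpTo f n ≡ applyUpTo g n
applyUpTo-cong eq zero = refl
applyUpTo-cong eq (suc n) = cong₂ _∷_ (eq 0) (applyUpTo-cong (eq ∘ suc) n)

-- Position vectors and saturated chains.

module Levels (r : ℕ) where

  infixl 7 _⊕_
  infixr 6 _⊛_
  infix 4 _≼_ _⋖_

  V : Set
  V = Vec ℕ r

  𝟎 : V
  𝟎 = replicate r 0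

  _⊕_ : V → V → V
  _⊕_ = zipWith _+_

  ⊕-comm : ∀ u v → u ⊕ v ≡ v ⊕ u
  ⊕-comm = Vecₚ.zipWith-comm +-comm

  ⊕-assoc : ∀ u v w → (u ⊕ v) ⊕ w ≡ u ⊕ (v ⊕ w)
  ⊕-assoc = Vecₚ.zipWith-assoc +-assoc

  ⊕-identityˡ : ∀ u → 𝟎 ⊕ u ≡ u
  ⊕-identityˡ = Vecₚ.zipWith-identityˡ (λ _ → refl)

  ⊕-identityʳ : ∀ u → u ⊕ 𝟎 ≡ u
  ⊕-identityʳ = Vecₚ.zipWith-identityʳ +-identityʳ

  lookup-⊕ : ∀ i u v → lookup (u ⊕ v) i ≡ lookup u i + lookup v i
  lookup-⊕ i u v = Vecₚ.lookup-zipWith _+_ i u v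

  -- Stands for the product of two factors: when these use disjoint coordinates, a sum determines
  -- both summands.
  _⊛_ : List V → List V → List V
  _⊛_ = cartesianProductWith _⊕_

  ⊛-comm : ∀ L M → L ⊛ M ↭ M ⊛ L
  ⊛-comm L M = ↭-trans (⊗-flip _⊕_ L M)
    (↭-reflexive (cartesianProductWith-cong (λ u v → ⊕-comm v u) M L))

  map-⊛ : ∀ u M N → map (u ⊕_) M ⊛ N ≡ map (u ⊕_) (M ⊛ N)
  map-⊛ u [] N = refl
  map-⊛ u (m ∷ M) N = trans
    (cong₂ _++_ (trans (Listₚ.map-cong (⊕-assoc u m) N) (Listₚ.map-∘ N)) (map-⊛ u M N))
    (sym (Listₚ.map-++ (u ⊕_) (map (m ⊕_) N) (M ⊛ N)))

  ⊛-assoc : ∀ L M N → (L ⊛ M) ⊛ N ≡ L ⊛ (M ⊛ N)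
  ⊛-assoc [] M N = refl
  ⊛-assoc (u ∷ L) M N = trans
    (Listₚ.cartesianProductWith-distribʳ-++ _⊕_ (map (u ⊕_) M) (L ⊛ M) N)
    (cong₂ _++_ (map-⊛ u M N) (⊛-assoc L M N))

  ⊛-identityˡ : ∀ M → [ 𝟎 ] ⊛ M ≡ M
  ⊛-identityˡ M = trans (Listₚ.++-identityʳ _) (trans (Listₚ.map-cong ⊕-identityˡ M) (Listₚ.map-id M))

  ⊛-identityʳ : ∀ M → M ⊛ [ 𝟎 ] ≡ M
  ⊛-identityʳ M = trans (⊗-[-]ʳ _⊕_ M 𝟎) (trans (Listₚ.map-cong ⊕-identityʳ M) (Listₚ.map-id M))

  rank-⊕ : ∀ u v → rank (u ⊕ v) ≡ rank u + rank v
  rank-⊕ = rank-zipWith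

  _≼_ : V → V → Set
  u ≼ v = ∀ i → lookup u i ≤ lookup v i

  -- The covering relation of `ℕ`-vectors. Leaving the rising coordinate unnamed makes translation
  -- invariance immediate.
  record _⋖_ (u v : V) : Set where
    constructor step
    field
      ⋖⇒≼  : u ≼ v
      rank-⋖ : rank v ≡ suc (rank u)

  open _⋖_ public

  ⊕-⋖ʳ : ∀ x {u v} → u ⋖ v → x ⊕ u ⋖ x ⊕ v
  ⊕-⋖ʳ x {u} {v} (step u≼v eq) = step
    (λ i → subst₂ _≤_ (sym (lookup-⊕ i x u)) (sym (lookup-⊕ i x v)) (+-monoʳ-≤ (lookup x i) (u≼v i)))
    (trans (rank-⊕ x v) (trans (cong (rank x +_) eq) (trans (+-suc _ _) (cong suc (sym (rank-⊕ x u))))))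

  ⊕-⋖ˡ : ∀ x {u v} → u ⋖ v → u ⊕ x ⋖ v ⊕ x
  ⊕-⋖ˡ x {u} {v} s = subst₂ _⋖_ (⊕-comm x u) (⊕-comm x v) (⊕-⋖ʳ x s)

  data Path : V → V → List V → Set where
    end : ∀ v → Path v v (v ∷ [])
    _∷_ : ∀ {u v w l} → u ⋖ v → Path v w l → Path u w (u ∷ l)

  infixr 5 _▹⟨_⟩_
  _▹⟨_⟩_ : ∀ {u v v′ w l l′} → Path u v l → v ⋖ v′ → Path v′ w l′ → Path u w (l ++ l′)
  end _ ▹⟨ s ⟩ q = s ∷ q
  (t ∷ p) ▹⟨ s ⟩ q = t ∷ (p ▹⟨ s ⟩ q)

  Path-map : ∀ {f : V → V} → (∀ {u v} → u ⋖ v → f u ⋖ f v) → ∀ {u w l} →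
    Path u w l → Path (f u) (f w) (map f l)
  Path-map f⋖ (end v) = end _
  Path-map f⋖ (s ∷ p) = f⋖ s ∷ Path-map f⋖ p

  shiftʳ : ∀ x {u w l} → Path u w l → Path (x ⊕ u) (x ⊕ w) (map (x ⊕_) l)
  shiftʳ x = Path-map (⊕-⋖ʳ x)

  shiftˡ : ∀ x {u w l} → Path u w l → Path (u ⊕ x) (w ⊕ x) (map (_⊕ x) l)
  shiftˡ x = Path-map (⊕-⋖ˡ x)

  bot≤ : ∀ {u w l} → Path u w l → All (λ x → rank u ≤ rank x) l
  bot≤ (end v) = ≤-refl ∷ []
  bot≤ (s ∷ p) = ≤-refl ∷ All.map (≤-trans (≤-trans (n≤1+n _) (≤-reflexive (sym (rank-⋖ s))))) (bot≤ p)

  bot≤top : ∀ {u w l} → Path u w l → rank u ≤ rank w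
  bot≤top (end v) = ≤-refl
  bot≤top (s ∷ p) = ≤-trans (≤-trans (n≤1+n _) (≤-reflexive (sym (rank-⋖ s)))) (bot≤top p)

  ≤top : ∀ {u w l} → Path u w l → All (λ x → rank x ≤ rank w) l
  ≤top (end v) = ≤-refl ∷ []
  ≤top p@(s ∷ q) = bot≤top p ∷ ≤top q

  bot∈ : ∀ {u w l} → Path u w l → u ∈ l
  bot∈ (end v) = here refl
  bot∈ (s ∷ p) = here refl

  top∈ : ∀ {u w l} → Path u w l → w ∈ l
  top∈ (end v) = here refl
  top∈ (s ∷ p) = there (top∈ p)

  uncons : ∀ {u w l} → Path u w l → rank u < rank w →
    Σ[ v ∈ V ] Σ[ l′ ∈ List V ] (l ≡ u ∷ l′ × u ⋖ v × Path v w l′)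
  uncons (end v) lt = ⊥-elim (<-irrefl refl lt)
  uncons (s ∷ p) lt = _ , _ , refl , s , p

  unsnoc : ∀ {u w l} → Path u w l → rank u < rank w →
    Σ[ v ∈ V ] Σ[ l′ ∈ List V ] (l ≡ l′ ∷ʳ w × Path u v l′ × v ⋖ w)
  unsnoc (end v) lt = ⊥-elim (<-irrefl refl lt)
  unsnoc (s ∷ end w) lt = _ , _ , refl , end _ , s
  unsnoc (s ∷ p@(t ∷ q)) lt with unsnoc p (<-≤-trans (≤-reflexive (sym (rank-⋖ t))) (bot≤top q))
  ... | v , l′ , eq , p′ , s′ = v , _ , cong (_ ∷_) eq , s ∷ p′ , s′

  path-ranks : ∀ {u w l} → Path u w l →
    Σ[ d ∈ ℕ ] (rank w ≡ rank u + d × map rank l ≡ applyUpTo (rank u +_) (suc d))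
  path-ranks (end v) = 0 , sym (+-identityʳ _) , cong [_] (sym (+-identityʳ _))
  path-ranks {u} (s ∷ p) with path-ranks p
  ... | d , top≡ , ranks = suc d
    , trans top≡ (trans (cong (_+ d) (rank-⋖ s)) (sym (+-suc (rank u) d)))
    , cong₂ _∷_ (sym (+-identityʳ _))
        (trans ranks (applyUpTo-cong (λ k → trans (cong (_+ k) (rank-⋖ s)) (sym (+-suc (rank u) k))) (suc d)))

  record Saturated : Set where
    constructor saturated
    field
      {bot top} : V
      {points} : List V
      path : Path bot top points

  open Saturated public

  -- Twice the mid-rank: a saturated chain is symmetric in a poset of height m iff its mid is m.
  mid : Saturated → ℕ
  mid C = rank (bot C) + rank (top C)

  Long : ℕ → Saturated → Set
  Long n C = n + rank (bot C) ≤ rank (top C)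

  ⋖⇒< : {u v : V} → u ⋖ v → rank u < rank v
  ⋖⇒< s = ≤-reflexive (sym (rank-⋖ s))

  ⋖-lowerˡ : ∀ {n m} {u v : V} → u ⋖ v → suc n + rank u ≤ m → n + rank v ≤ m
  ⋖-lowerˡ {n} {m} s le = subst (_≤ m) (trans (sym (+-suc n _)) (cong (n +_) (sym (rank-⋖ s)))) le

  ⋖-lowerʳ : ∀ {n} {u v : V} → u ⋖ v → suc n ≤ rank v → n ≤ rank u
  ⋖-lowerʳ s le with subst (_ ≤_) (rank-⋖ s) le
  ... | s≤s le′ = le′

  rank-<⇒≢ : {u v : V} → rank u < rank v → u ≢ v
  rank-<⇒≢ lt refl = <-irrefl refl lt

  rank->⇒≢ : {u v : V} → rank v < rank u → u ≢ v
  rank->⇒≢ lt refl = <-irrefl refl lt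

  mid-⊕ : ∀ (a b x y : V) → rank (a ⊕ x) + rank (b ⊕ y) ≡ rank a + rank b + (rank x + rank y)
  mid-⊕ a b x y rewrite rank-⊕ a x | rank-⊕ b y = interchange (rank a) (rank x) (rank b) (rank y)

  -- Raising the bottom of one side and lowering the top of the other keeps the sum of the mids.
  -- This is why chains of inner rectangles are symmetric in the whole grid.
  mid-slideˡ : ∀ {u u′ w y v z : V} → u ⋖ u′ → v ⋖ z →
    rank u′ + rank w + (rank y + rank v) ≡ rank u + rank w + (rank y + rank z)
  mid-slideˡ {u} {u′} {w} {y} {v} {z} s t rewrite rank-⋖ s | rank-⋖ t =
    lem (rank u) (rank w) (rank y) (rank v)
    where
    lem : ∀ u w y v → suc u + w + (y + v) ≡ u + w + (y + suc v)
    lem = solve-∀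

  mid-slideʳ : ∀ {u w k y y′ z : V} → k ⋖ w → y ⋖ y′ →
    rank u + rank k + (rank y′ + rank z) ≡ rank u + rank w + (rank y + rank z)
  mid-slideʳ {u} {w} {k} {y} {y′} {z} s t rewrite rank-⋖ s | rank-⋖ t =
    lem (rank u) (rank k) (rank y) (rank z)
    where
    lem : ∀ u k y z → u + k + (suc y + z) ≡ u + suc k + (y + z)
    lem = solve-∀

  -- Splitting the grid of two chains.

  bag : List (Saturated) → List V
  bag = concat ∘ map points

  -- The classical decomposition of a product of two chains: a hook follows the row of the bottom
  -- `u` up to `z` and then the column of `z`. What remains is a grid with one bottom and one top
  -- removed.
  hooks : ∀ {u w l y z m} → Path u w l → Path y z m →
    Σ[ Hs ∈ List Saturated ]
      (bag Hs ↭ l ⊛ m × All (λ H → mid H ≡ rank u + rank w + (rank y + rank z)) Hs)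
  hooks {u} {y = y} {z} (end u) q = [ saturated (shiftʳ u q) ] , ↭-refl , mid-⊕ u u y z ∷ []
  hooks {u} {w} {l} {y} p@(_ ∷ _) (end y) =
    [ saturated (shiftˡ y p) ]
    , ↭-reflexive (trans (Listₚ.++-identityʳ _) (sym (⊗-[-]ʳ _⊕_ l y)))
    , mid-⊕ u w y y ∷ []
  hooks {u} {w} {y = y} {z} {m} (_∷_ {l = l} s p) (t ∷ q)
    with unsnoc (t ∷ q) (<-≤-trans (⋖⇒< t) (bot≤top q))
  ... | v , m′ , eq , q′ , t′ with hooks p q′
  ...   | Hs , perm , mids =
    saturated (shiftʳ u (t ∷ q) ▹⟨ ⊕-⋖ˡ z s ⟩ shiftˡ z p) ∷ Hs
    , ↭-trans (prove 3 ((var (# 0) ∙ var (# 1)) ∙ var (# 2))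
                       (var (# 0) ∙ (var (# 2) ∙ var (# 1)))
                       (map (u ⊕_) m ∷ map (_⊕ z) l ∷ bag Hs ∷ []))
        (++⁺ˡ (map (u ⊕_) m) (↭-trans (++⁺ʳ (map (_⊕ z) l) perm)
          (↭-trans (↭-sym (⊗-∷ʳ _⊕_ l m′ z)) (↭-reflexive (cong (l ⊛_) (sym eq))))))
    , mid-⊕ u w y z ∷ All.map (λ e → trans e (mid-slideˡ {w = w} {y = y} s t′)) mids
    where open BagSolver renaming (_⊕_ to _∙_)

  ∈-init : ∀ {L K : List (V)} {w x} → L ≡ K ∷ʳ w → x ∈ K → x ∈ L
  ∈-init refl = ∈-++⁺ˡ

  -- Keeps the two coordinates of a point; `Q` records where in the grid a piece runs, which decides
  -- the switches that fit into it.
  Cell : List V → List V → (V → V → Set) → V → Set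
  Cell L M Q p = Σ[ x ∈ V ] Σ[ y ∈ V ] (p ≡ x ⊕ y × x ∈ L × y ∈ M × Q x y)

  cell : ∀ {L M Q x y} → x ∈ L → y ∈ M → Q x y → Cell L M Q (x ⊕ y)
  cell x∈ y∈ q = _ , _ , refl , x∈ , y∈ , q

  row : ∀ {L M Q x m} → x ∈ L → (∀ {y} → y ∈ m → y ∈ M × Q x y) → All (Cell L M Q) (map (x ⊕_) m)
  row x∈ f = Allₚ.map⁺ (All.tabulate λ y∈ → cell x∈ (proj₁ (f y∈)) (proj₂ (f y∈)))

  column : ∀ {L M Q y l} → y ∈ M → (∀ {x} → x ∈ l → x ∈ L × Q x y) → All (Cell L M Q) (map (_⊕ y) l)
  column y∈ f = Allₚ.map⁺ (All.tabulate λ x∈ → cell (proj₁ (f x∈)) y∈ (proj₂ (f x∈)))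

  -- For C = c₀ < c₁ < X and B = Y < y₁ < y₂, with c₀, y₀ the bottoms and cₙ, y₂ the tops, the grid C × B
  -- is split into main = (c₀,y₀), (c₁,y₀), …, (c₁,y₁), (X,y₁), (cₙ,y₂), edge = (c₀, B − y₀), (C − c₀ − cₙ, y₂)
  -- and the rectangle X × Y, so that no piece other than main meets two corners of the grid.
  record Corner (C B : Saturated) : Set where
    field
      main edge left right : Saturated
      cover     : points main ++ points edge ++ points left ⊛ points right ↭ points C ⊛ points B
      mid-main  : mid main ≡ mid C + mid B
      mid-edge  : mid edge ≡ mid C + mid B
      mid-core  : mid left + mid right ≡ mid C + mid B
      bot-main  : bot main ≡ bot C ⊕ bot B
      top-main  : top main ≡ top C ⊕ top B
      long-main : Long 2 main
      long-edge : Long 2 edge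
      long-left  : ∀ n → Long (2 + n) C → Long n left
      long-right : ∀ n → Long (2 + n) B → Long n right
      left⊆  : ∀ {x} → x ∈ points left → x ∈ points C × x ≢ bot C
      right⊆ : ∀ {y} → y ∈ points right → y ∈ points B × y ≢ top B
      main-cells : All (Cell (points C) (points B) λ x y →
        (x ≡ bot C → y ≡ bot B) × (x ≡ top C → y ≢ bot B) × (y ≡ top B → x ≡ top C)) (points main)
      edge-cells : All (Cell (points C) (points B) λ x y → x ≢ top C × y ≢ bot B) (points edge)

  corner : ∀ C B → Long 2 C → Long 2 B → Corner C B
  corner (saturated {c₀} {cₙ} {L} p) (saturated {y₀} {y₂} {M} q) longC longB
    with uncons p (≤-trans (n≤1+n _) longC) | uncons q (≤-trans (n≤1+n _) longB)
       | unsnoc q (≤-trans (n≤1+n _) longB)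
  ... | c₁ , L₁ , refl , s₀₁ , p₁ | y₀′ , B⁺ , eqB⁺ , t₀ , q⁺ | y₁ , B′ , eqB′ , q′ , t₂
    with uncons p₁ (⋖-lowerˡ {n = 1} s₀₁ longC) | unsnoc p₁ (⋖-lowerˡ {n = 1} s₀₁ longC)
       | unsnoc q′ (⋖-lowerʳ t₂ longB)
  ... | c₂ , X , refl , s₁₂ , pX | k , K , eqK , pK , sₙ | z , Y , eqY , qY , t₁ = record
    { main = saturated (⊕-⋖ˡ y₀ s₀₁ ∷ (shiftʳ c₁ q′ ▹⟨ ⊕-⋖ˡ y₁ s₁₂ ⟩ shiftˡ y₁ pX ▹⟨ ⊕-⋖ʳ cₙ t₂ ⟩ end (cₙ ⊕ y₂)))
    ; edge = saturated (shiftʳ c₀ q⁺ ▹⟨ ⊕-⋖ˡ y₂ s₀₁ ⟩ shiftˡ y₂ pK)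
    ; left = saturated pX
    ; right = saturated qY
    ; cover = cover
    ; mid-main = mid-⊕ c₀ cₙ y₀ y₂
    ; mid-edge = trans (mid-⊕ c₀ k y₀′ y₂) (mid-slideʳ {u = c₀} {z = y₂} sₙ t₀)
    -- Each side of `X × Y` has lost two points, at opposite ends: two slides.
    ; mid-core = trans (mid-slideˡ {w = cₙ} {y = y₀} s₁₂ t₁) (mid-slideˡ {w = cₙ} {y = y₀} s₀₁ t₂)
    ; bot-main = refl
    ; top-main = refl
    ; long-main = subst₂ _≤_ (cong (2 +_) (sym (rank-⊕ c₀ y₀))) (sym (rank-⊕ cₙ y₂))
        (+-mono-≤ longC (bot≤top q))
    ; long-edge = long-edge
    ; long-left = λ n le → ⋖-lowerˡ s₁₂ (⋖-lowerˡ s₀₁ le)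
    ; long-right = λ n le → ⋖-lowerʳ t₁ (⋖-lowerʳ t₂ le)
    ; left⊆ = λ x∈ → there (there x∈) , X≢c₀ x∈
    ; right⊆ = λ y∈ → B′⊆ (∈-init eqY y∈) , B′≢y₂ (∈-init eqY y∈)
    ; main-cells =
        cell (here refl) (bot∈ q) ((λ _ → refl) , ⊥-elim ∘ c₀≢cₙ , ⊥-elim ∘ y₀≢y₂)
        ∷ Allₚ.++⁺ (row (there (here refl)) λ y∈ →
              B′⊆ y∈ , ⊥-elim ∘ rank->⇒≢ (⋖⇒< s₀₁) , ⊥-elim ∘ c₁≢cₙ , ⊥-elim ∘ B′≢y₂ y∈)
          (Allₚ.++⁺ (column (B′⊆ (top∈ q′)) λ x∈ →
              there (there x∈) , ⊥-elim ∘ X≢c₀ x∈ , (λ _ → rank->⇒≢ y₀<y₁) , ⊥-elim ∘ rank-<⇒≢ (⋖⇒< t₂))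
          (cell (top∈ p) (top∈ q) (⊥-elim ∘ c₀≢cₙ ∘ sym , (λ _ → y₀≢y₂ ∘ sym) , λ _ → refl) ∷ []))
    ; edge-cells = Allₚ.++⁺
        (row (here refl) λ y∈ → B⁺⊆ y∈ , c₀≢cₙ
           , rank->⇒≢ (<-≤-trans (⋖⇒< t₀) (All.lookup (bot≤ q⁺) y∈)))
        (column (top∈ q) λ x∈ → there (K⊆ x∈)
           , rank-<⇒≢ (≤-<-trans (All.lookup (≤top pK) x∈) (⋖⇒< sₙ))
           , y₀≢y₂ ∘ sym)
    }
    where
    y₀<y₁ : rank y₀ < rank y₁
    y₀<y₁ = ⋖-lowerʳ t₂ longB
    c₀≢cₙ : c₀ ≢ cₙ
    c₀≢cₙ = rank-<⇒≢ (≤-trans (n≤1+n _) longC)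
    c₁≢cₙ : c₁ ≢ cₙ
    c₁≢cₙ = rank-<⇒≢ (⋖-lowerˡ {n = 1} s₀₁ longC)
    y₀≢y₂ : y₀ ≢ y₂
    y₀≢y₂ = rank-<⇒≢ (≤-trans (n≤1+n _) longB)
    B⁺⊆ : ∀ {y} → y ∈ B⁺ → y ∈ M
    B⁺⊆ y∈ = subst (_ ∈_) (sym eqB⁺) (there y∈)
    B′⊆ : ∀ {y} → y ∈ B′ → y ∈ M
    B′⊆ y∈ = ∈-init eqB′ y∈
    K⊆ : ∀ {x} → x ∈ K → x ∈ c₁ ∷ X
    K⊆ x∈ = ∈-init eqK x∈
    B′≢y₂ : ∀ {y} → y ∈ B′ → y ≢ y₂
    B′≢y₂ y∈ = rank-<⇒≢ (≤-<-trans (All.lookup (≤top q′) y∈) (⋖⇒< t₂))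
    X≢c₀ : ∀ {x} → x ∈ X → x ≢ c₀
    X≢c₀ x∈ = rank->⇒≢ (<-≤-trans (≤-trans (⋖⇒< s₀₁) (<⇒≤ (⋖⇒< s₁₂))) (All.lookup (bot≤ pX) x∈))

    long-edge : 2 + rank (c₀ ⊕ y₀′) ≤ rank (k ⊕ y₂)
    long-edge rewrite rank-⊕ c₀ y₀′ | rank-⊕ k y₂ | rank-⋖ t₀ = subst (_≤ rank k + rank y₂) (lem (rank c₀) (rank y₀))
      (+-mono-≤ (⋖-lowerʳ sₙ longC) longB)
      where
      lem : ∀ c y → suc c + suc (suc y) ≡ suc (suc (c + suc y))
      lem = solve-∀

    open BagSolver renaming (_⊕_ to _∙_)

    cover : ((c₀ ⊕ y₀) ∷ (map (c₁ ⊕_) B′ ++ map (_⊕ y₁) X ++ [ cₙ ⊕ y₂ ]))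
      ++ (map (c₀ ⊕_) B⁺ ++ map (_⊕ y₂) K) ++ X ⊛ Y ↭ (c₀ ∷ c₁ ∷ X) ⊛ M
    -- Regrouped by rows: `c₀` is complete at once, and the column of `y₂` over `c₁ ∷ X` completes
    -- the row of `c₁` and the rows of `X`.
    cover = ↭-trans
      (prove 7 ((var (# 0) ∙ (var (# 1) ∙ (var (# 2) ∙ var (# 3)))) ∙ ((var (# 4) ∙ var (# 5)) ∙ var (# 6)))
               ((var (# 0) ∙ var (# 4)) ∙ ((var (# 1) ∙ (var (# 5) ∙ var (# 3))) ∙ (var (# 6) ∙ var (# 2))))
         ([ c₀ ⊕ y₀ ] ∷ map (c₁ ⊕_) B′ ∷ map (_⊕ y₁) X ∷ [ cₙ ⊕ y₂ ] ∷ map (c₀ ⊕_) B⁺ ∷ map (_⊕ y₂) K ∷ X ⊛ Y ∷ []))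
      (↭-trans (++⁺ (↭-reflexive (cong (map (c₀ ⊕_)) (sym eqB⁺)))
        (↭-trans (++⁺ (++⁺ˡ (map (c₁ ⊕_) B′) (↭-reflexive
                        (trans (sym (Listₚ.map-++ (_⊕ y₂) K [ cₙ ])) (cong (map (_⊕ y₂)) (sym eqK)))))
                      (↭-trans (↭-sym (⊗-∷ʳ _⊕_ X Y y₁)) (↭-reflexive (cong (X ⊛_) (sym eqY)))))
        (↭-trans (prove 4 ((var (# 0) ∙ (var (# 1) ∙ var (# 2))) ∙ var (# 3)) ((var (# 0) ∙ var (# 1)) ∙ (var (# 3) ∙ var (# 2)))
                    (map (c₁ ⊕_) B′ ∷ [ c₁ ⊕ y₂ ] ∷ map (_⊕ y₂) X ∷ X ⊛ B′ ∷ []))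
          (++⁺ (↭-reflexive (trans (sym (Listₚ.map-++ (c₁ ⊕_) B′ [ y₂ ])) (cong (map (c₁ ⊕_)) (sym eqB′))))
               (↭-trans (↭-sym (⊗-∷ʳ _⊕_ X B′ y₂)) (↭-reflexive (cong (X ⊛_) (sym eqB′))))))))
        ↭-refl)

  -- For C = c₀ < c₁ < c₂ < X and B = Y < u < v < w the grid C × B is split into the rectangle X × Y and
  --   first  = (c₀,b₀), (c₁,b₀), (c₂,b₀), …, (c₂,u), (X,u), (cₙ,v), (cₙ,w)
  --   second = (c₀,b₁), (c₁,b₁), …, (c₁,v), (c₂,v), …, (d,v), (d,w)      where d is the pivot, below cₙ
  --   third  = (c₀,b₂), …, (c₀,w), (c₁,w), …, (d′,w)                    where d′ is below d.
  record Zigzag (C : Saturated) {b₀ b₁ w M} (t₀ : b₀ ⋖ b₁) (q : Path b₁ w M) : Set where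
    private
      B : Saturated
      B = saturated (t₀ ∷ q)
    field
      first second third left right : Saturated
      pivot : V
      cover : points first ++ points second ++ points third ++ points left ⊛ points right
              ↭ points C ⊛ points B
      mid-first  : mid first ≡ mid C + mid B
      mid-second : mid second ≡ mid C + mid B
      mid-third  : mid third ≡ mid C + mid B
      mid-core   : mid left + mid right ≡ mid C + mid B
      long-first  : Long 2 first
      long-second : Long 2 second
      long-third  : Long 2 third
      long-right  : ∀ n → Long (3 + n) B → Long n right
      left⊆  : ∀ {x} → x ∈ points left → x ∈ points C × x ≢ bot C
      right⊆ : ∀ {y} → y ∈ points right → y ∈ points B × y ≢ top B
      first-cells : All (Cell (points C) (points B) λ x y →
        (x ≡ bot C → y ≡ b₀) × (x ≡ top C → y ≢ b₀ × y ≢ b₁) × (y ≡ w → x ≡ top C)) (points first)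
      second-cells : All (Cell (points C) (points B) λ x y →
        x ≢ top C × (y ≡ b₁ → x ≢ pivot) × (y ≡ w → x ≡ pivot)) (points second)
      third-cells : All (Cell (points C) (points B) λ x y → x ≢ top C × y ≢ b₁) (points third)

  zigzag : ∀ C {b₀ b₁ w M} (t₀ : b₀ ⋖ b₁) (q : Path b₁ w M) →
    Long 4 C → Long 4 (saturated (t₀ ∷ q)) → Zigzag C t₀ q
  zigzag (saturated {c₀} {e} {L} p) {b₀} {b₁} {w} {M} t₀ q longC longB
    with uncons p (≤-trans (m≤n+m _ 3) longC)
       | uncons q (⋖-lowerˡ {n = 1} t₀ (≤-trans (m≤n+m _ 2) longB))
       | unsnoc q (⋖-lowerˡ {n = 1} t₀ (≤-trans (m≤n+m _ 2) longB))
  ... | c₁ , L₁ , refl , s₀₁ , p₁ | b₂ , B₂ , eqB₂ , t₁ , q₂ | v , Bᵥ , eqBᵥ , qᵥ , t-vw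
    with uncons p₁ (⋖-lowerˡ {n = 1} s₀₁ (≤-trans (m≤n+m _ 2) longC))
       | unsnoc (t₀ ∷ qᵥ) (≤-trans (m≤n+m _ 2) (⋖-lowerʳ t-vw longB))
  ... | c₂ , L₂ , refl , s₁₂ , p₂ | u , Bᵤ , eqBᵤ , qᵤ , t-uv
    with uncons p₂ (⋖-lowerˡ {n = 1} s₁₂ (⋖-lowerˡ {n = 2} s₀₁ (≤-trans (m≤n+m _ 1) longC)))
       | unsnoc p₂ (⋖-lowerˡ {n = 1} s₁₂ (⋖-lowerˡ {n = 2} s₀₁ (≤-trans (m≤n+m _ 1) longC)))
       | unsnoc qᵤ (≤-trans (m≤n+m _ 1) (⋖-lowerʳ t-uv (⋖-lowerʳ t-vw longB)))
  ... | c₃ , X , refl , s₂₃ , pX | d , K₁ , eqK₁ , pK₁ , s-de | y , Y , eqY , qY , t-yu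
    with unsnoc (s₁₂ ∷ pK₁) (⋖-lowerˡ {n = 1} s₀₁ (≤-trans (m≤n+m _ 1) (⋖-lowerʳ s-de longC)))
  ... | z , K₂ , eqK₂ , pK₂ , s-zd = record
    { first = saturated (⊕-⋖ˡ b₀ s₀₁ ∷ ⊕-⋖ˡ b₀ s₁₂ ∷ (shiftʳ c₂ qᵤ ▹⟨ ⊕-⋖ˡ u s₂₃ ⟩ shiftˡ u pX
                           ▹⟨ ⊕-⋖ʳ e t-uv ⟩ (⊕-⋖ʳ e t-vw ∷ end (e ⊕ w))))
    ; second = saturated (⊕-⋖ˡ b₁ s₀₁ ∷ (shiftʳ c₁ qᵥ ▹⟨ ⊕-⋖ˡ v s₁₂ ⟩ shiftˡ v pK₁
                           ▹⟨ ⊕-⋖ʳ d t-vw ⟩ end (d ⊕ w)))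
    ; third = saturated (shiftʳ c₀ q₂ ▹⟨ ⊕-⋖ˡ w s₀₁ ⟩ shiftˡ w pK₂)
    ; left = saturated pX
    ; right = saturated qY
    ; pivot = d
    ; cover = cover
    ; mid-first = mid-⊕ c₀ e b₀ w
    ; mid-second = trans (mid-⊕ c₀ d b₁ w) (mid-slideʳ {u = c₀} {z = w} s-de t₀)
    ; mid-third = trans (mid-⊕ c₀ z b₂ w) (trans (mid-slideʳ {u = c₀} {z = w} s-zd t₁)
                                                   (mid-slideʳ {u = c₀} {z = w} s-de t₀))
    ; mid-core = trans (mid-slideˡ {w = e} {y = b₀} s₂₃ t-yu) (trans (mid-slideˡ {w = e} {y = b₀} s₁₂ t-uv)
                   (mid-slideˡ {w = e} {y = b₀} s₀₁ t-vw))
    ; long-first = subst₂ _≤_ (cong (2 +_) (sym (rank-⊕ c₀ b₀))) (sym (rank-⊕ e w))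
        (+-mono-≤ (≤-trans (m≤n+m _ 2) longC) (≤-trans (m≤n+m _ 4) longB))
    ; long-second = long-second
    ; long-third = long-third
    ; long-right = λ n le → ⋖-lowerʳ t-yu (⋖-lowerʳ t-uv (⋖-lowerʳ t-vw le))
    ; left⊆ = λ x∈ → there (there (there x∈)) , X≢c₀ x∈
    ; right⊆ = λ y∈ → Bᵤ⊆ (Y⊆ y∈) , Bᵤ≢w (Y⊆ y∈)
    ; first-cells =
        cell (here refl) (here refl) ((λ _ → refl) , ⊥-elim ∘ rank-<⇒≢ c₀<e , ⊥-elim ∘ b₀≢w)
        ∷ cell (there (here refl)) (here refl)
            (⊥-elim ∘ rank->⇒≢ (⋖⇒< s₀₁) , ⊥-elim ∘ rank-<⇒≢ c₁<e , ⊥-elim ∘ b₀≢w)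
        ∷ Allₚ.++⁺ (row (there (there (here refl))) λ y∈ → Bᵤ⊆ y∈
              , ⊥-elim ∘ rank->⇒≢ c₀<c₂ , ⊥-elim ∘ rank-<⇒≢ c₂<e , ⊥-elim ∘ Bᵤ≢w y∈)
          (Allₚ.++⁺ (column (Bᵤ⊆ (top∈ qᵤ)) λ x∈ → there (there (there x∈))
              , ⊥-elim ∘ X≢c₀ x∈ , (λ _ → rank->⇒≢ b₀<u , rank->⇒≢ b₁<u) , ⊥-elim ∘ rank-<⇒≢ u<w)
          (cell e∈ (Bᵥ⊆ (top∈ qᵥ))
             (⊥-elim ∘ rank->⇒≢ c₀<e , (λ _ → rank->⇒≢ (≤-trans b₀<u (<⇒≤ (⋖⇒< t-uv)))
                                              , rank->⇒≢ (≤-trans b₁<u (<⇒≤ (⋖⇒< t-uv)))) , (λ _ → refl))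
          ∷ cell e∈ w∈
             (⊥-elim ∘ rank->⇒≢ c₀<e , (λ _ → b₀≢w ∘ sym , b₁≢w ∘ sym) , λ _ → refl) ∷ []))
    ; second-cells =
        cell (here refl) (there (bot∈ q)) (rank-<⇒≢ c₀<e , (λ _ → rank-<⇒≢ c₀<d) , ⊥-elim ∘ b₁≢w)
        ∷ Allₚ.++⁺ (row (there (here refl)) λ y∈ → Bᵥ⊆ y∈
              , rank-<⇒≢ c₁<e , (λ _ → rank-<⇒≢ c₁<d)
              , ⊥-elim ∘ rank-<⇒≢ (≤-<-trans (All.lookup (≤top qᵥ) y∈) (⋖⇒< t-vw)))
          (Allₚ.++⁺ (column (Bᵥ⊆ (top∈ qᵥ)) λ x∈ → K₁⊆ x∈
              , rank-<⇒≢ (≤-<-trans (All.lookup (≤top pK₁) x∈) (⋖⇒< s-de))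
              , ⊥-elim ∘ rank->⇒≢ (≤-trans b₁<u (<⇒≤ (⋖⇒< t-uv))) , ⊥-elim ∘ rank-<⇒≢ (⋖⇒< t-vw))
          (cell (K₁⊆ (top∈ pK₁)) w∈ (rank-<⇒≢ (⋖⇒< s-de) , ⊥-elim ∘ b₁≢w ∘ sym , λ _ → refl) ∷ []))
    ; third-cells = Allₚ.++⁺
        (row (here refl) λ y∈ → there (subst (_ ∈_) (sym eqB₂) (there y∈))
           , rank-<⇒≢ c₀<e , rank->⇒≢ (<-≤-trans (⋖⇒< t₁) (All.lookup (bot≤ q₂) y∈)))
        (column w∈ λ x∈ → K₂⊆ x∈
           , rank-<⇒≢ (≤-<-trans (All.lookup (≤top pK₂) x∈) (≤-trans (⋖⇒< s-zd) (<⇒≤ (⋖⇒< s-de))))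
           , b₁≢w ∘ sym)
    }
    where
    c₀<e : rank c₀ < rank e
    c₀<e = ≤-trans (m≤n+m _ 3) longC
    c₁<e : rank c₁ < rank e
    c₁<e = ⋖-lowerˡ {n = 1} s₀₁ (≤-trans (m≤n+m _ 2) longC)
    c₂<e : rank c₂ < rank e
    c₂<e = ⋖-lowerˡ {n = 1} s₁₂ (⋖-lowerˡ {n = 2} s₀₁ (≤-trans (m≤n+m _ 1) longC))
    c₀<c₂ : rank c₀ < rank c₂
    c₀<c₂ = ≤-trans (⋖⇒< s₀₁) (<⇒≤ (⋖⇒< s₁₂))
    c₀<d : rank c₀ < rank d
    c₀<d = ≤-trans (m≤n+m _ 2) (⋖-lowerʳ s-de longC)
    c₁<d : rank c₁ < rank d
    c₁<d = ⋖-lowerˡ {n = 1} s₀₁ (≤-trans (m≤n+m _ 1) (⋖-lowerʳ s-de longC))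
    b₀<u : rank b₀ < rank u
    b₀<u = ≤-trans (m≤n+m _ 1) (⋖-lowerʳ t-uv (⋖-lowerʳ t-vw longB))
    b₁<u : rank b₁ < rank u
    b₁<u = ⋖-lowerˡ {n = 1} t₀ (⋖-lowerʳ t-uv (⋖-lowerʳ t-vw longB))
    u<w : rank u < rank w
    u<w = ≤-trans (⋖⇒< t-uv) (<⇒≤ (⋖⇒< t-vw))
    b₀≢w : b₀ ≢ w
    b₀≢w = rank-<⇒≢ (≤-trans b₀<u (<⇒≤ u<w))
    b₁≢w : b₁ ≢ w
    b₁≢w = rank-<⇒≢ (≤-trans b₁<u (<⇒≤ u<w))
    e∈ : e ∈ c₀ ∷ c₁ ∷ c₂ ∷ X
    e∈ = there (there (there (top∈ pX)))
    w∈ : w ∈ b₀ ∷ M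
    w∈ = there (top∈ q)
    Bᵥ⊆ : ∀ {y} → y ∈ Bᵥ → y ∈ b₀ ∷ M
    Bᵥ⊆ y∈ = there (∈-init eqBᵥ y∈)
    b₀Bᵥ≡ : b₀ ∷ M ≡ (b₀ ∷ Bᵥ) ∷ʳ w
    b₀Bᵥ≡ = cong (b₀ ∷_) eqBᵥ
    Bᵤ⊆′ : ∀ {y} → y ∈ Bᵤ → y ∈ b₀ ∷ Bᵥ
    Bᵤ⊆′ y∈ = ∈-init eqBᵤ y∈
    Bᵤ⊆ : ∀ {y} → y ∈ Bᵤ → y ∈ b₀ ∷ M
    Bᵤ⊆ y∈ = ∈-init b₀Bᵥ≡ (Bᵤ⊆′ y∈)
    Y⊆ : ∀ {y} → y ∈ Y → y ∈ Bᵤ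
    Y⊆ y∈ = ∈-init eqY y∈
    K₁⊆ : ∀ {x} → x ∈ K₁ → x ∈ c₀ ∷ c₁ ∷ c₂ ∷ X
    K₁⊆ x∈ = there (there (∈-init eqK₁ x∈))
    K₂⊆ : ∀ {x} → x ∈ K₂ → x ∈ c₀ ∷ c₁ ∷ c₂ ∷ X
    K₂⊆ x∈ with ∈-init eqK₂ x∈
    ... | here eq = there (here eq)
    ... | there x∈K₁ = K₁⊆ x∈K₁
    Bᵤ≢w : ∀ {y} → y ∈ Bᵤ → y ≢ w
    Bᵤ≢w y∈ = rank-<⇒≢ (≤-<-trans (All.lookup (≤top qᵤ) y∈) u<w)
    X≢c₀ : ∀ {x} → x ∈ X → x ≢ c₀
    X≢c₀ x∈ = rank->⇒≢ (<-≤-trans (≤-trans c₀<c₂ (<⇒≤ (⋖⇒< s₂₃))) (All.lookup (bot≤ pX) x∈))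

    long-second : 2 + rank (c₀ ⊕ b₁) ≤ rank (d ⊕ w)
    long-second rewrite rank-⊕ c₀ b₁ | rank-⊕ d w | rank-⋖ t₀ =
      subst (_≤ rank d + rank w) (lem (rank c₀) (rank b₀))
        (+-mono-≤ (⋖-lowerʳ s-de longC) (≤-trans (m≤n+m _ 4) longB))
      where
      lem : ∀ c y → 3 + c + y ≡ suc (suc (c + suc y))
      lem = solve-∀

    long-third : 2 + rank (c₀ ⊕ b₂) ≤ rank (z ⊕ w)
    long-third rewrite rank-⊕ c₀ b₂ | rank-⊕ z w | rank-⋖ t₁ | rank-⋖ t₀ =
      subst (_≤ rank z + rank w) (lem (rank c₀) (rank b₀))
        (+-mono-≤ (⋖-lowerʳ s-zd (⋖-lowerʳ s-de longC)) (≤-trans (m≤n+m _ 2) longB))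
      where
      lem : ∀ c y → 2 + c + (2 + y) ≡ suc (suc (c + suc (suc y)))
      lem = solve-∀

    open BagSolver renaming (_⊕_ to _∙_)

    column-v : map (_⊕ v) K₁ ++ [ e ⊕ v ] ≡ [ c₂ ⊕ v ] ++ map (_⊕ v) X
    column-v = trans (sym (Listₚ.map-++ (_⊕ v) K₁ [ e ])) (cong (map (_⊕ v)) (sym eqK₁))

    column-w : (map (_⊕ w) K₂ ++ [ d ⊕ w ]) ++ [ e ⊕ w ] ≡ [ c₁ ⊕ w ] ++ [ c₂ ⊕ w ] ++ map (_⊕ w) X
    column-w = trans (cong (_++ [ e ⊕ w ])
        (trans (sym (Listₚ.map-++ (_⊕ w) K₂ [ d ])) (cong (map (_⊕ w)) (sym eqK₂))))
      (cong (c₁ ⊕ w ∷_) (trans (sym (Listₚ.map-++ (_⊕ w) K₁ [ e ])) (cong (map (_⊕ w)) (sym eqK₁))))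

    row-c₁ : ([ c₁ ⊕ b₀ ] ++ map (c₁ ⊕_) Bᵥ) ++ [ c₁ ⊕ w ] ≡ map (c₁ ⊕_) (b₀ ∷ M)
    row-c₁ = trans (sym (Listₚ.map-++ (c₁ ⊕_) (b₀ ∷ Bᵥ) [ w ])) (cong (map (c₁ ⊕_)) (sym b₀Bᵥ≡))

    row-c₂ : (map (c₂ ⊕_) Bᵤ ++ [ c₂ ⊕ v ]) ++ [ c₂ ⊕ w ] ≡ map (c₂ ⊕_) (b₀ ∷ M)
    row-c₂ = trans (cong (_++ [ c₂ ⊕ w ])
        (trans (sym (Listₚ.map-++ (c₂ ⊕_) Bᵤ [ v ])) (cong (map (c₂ ⊕_)) (sym eqBᵤ))))
      (trans (sym (Listₚ.map-++ (c₂ ⊕_) (b₀ ∷ Bᵥ) [ w ])) (cong (map (c₂ ⊕_)) (sym b₀Bᵥ≡)))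

    core : ((X ⊛ Y ++ map (_⊕ u) X) ++ map (_⊕ v) X) ++ map (_⊕ w) X ↭ X ⊛ (b₀ ∷ M)
    core = ↭-trans (++⁺ʳ _ (↭-trans (++⁺ʳ _ (↭-trans (↭-sym (⊗-∷ʳ _⊕_ X Y u))
             (↭-reflexive (cong (X ⊛_) (sym eqY)))))
             (↭-trans (↭-sym (⊗-∷ʳ _⊕_ X Bᵤ v)) (↭-reflexive (cong (X ⊛_) (sym eqBᵤ))))))
             (↭-trans (↭-sym (⊗-∷ʳ _⊕_ X (b₀ ∷ Bᵥ) w)) (↭-reflexive (cong (X ⊛_) (sym b₀Bᵥ≡))))

    cover : ((c₀ ⊕ b₀) ∷ (c₁ ⊕ b₀) ∷ (map (c₂ ⊕_) Bᵤ ++ map (_⊕ u) X ++ (e ⊕ v) ∷ [ e ⊕ w ]))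
      ++ ((c₀ ⊕ b₁) ∷ (map (c₁ ⊕_) Bᵥ ++ map (_⊕ v) K₁ ++ [ d ⊕ w ]))
      ++ (map (c₀ ⊕_) B₂ ++ map (_⊕ w) K₂) ++ X ⊛ Y ↭ (c₀ ∷ c₁ ∷ c₂ ∷ X) ⊛ (b₀ ∷ M)
    -- The columns of `v` and `w` are reassembled first, since their points are scattered over
    -- several chains; afterwards the rows can be read off.
    cover = ↭-trans
      (prove 13
        ((var (# 0) ∙ (var (# 1) ∙ (var (# 2) ∙ (var (# 3) ∙ (var (# 4) ∙ var (# 5))))))
          ∙ ((var (# 6) ∙ (var (# 7) ∙ (var (# 8) ∙ var (# 9))))
          ∙ ((var (# 10) ∙ var (# 11)) ∙ var (# 12))))
        ((var (# 8) ∙ var (# 4)) ∙ (((var (# 11) ∙ var (# 9)) ∙ var (# 5))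
          ∙ ((var (# 0) ∙ (var (# 6) ∙ var (# 10))) ∙ ((var (# 1) ∙ var (# 7))
          ∙ (var (# 2) ∙ (var (# 12) ∙ var (# 3)))))))
        ([ c₀ ⊕ b₀ ] ∷ [ c₁ ⊕ b₀ ] ∷ map (c₂ ⊕_) Bᵤ ∷ map (_⊕ u) X ∷ [ e ⊕ v ] ∷ [ e ⊕ w ]
          ∷ [ c₀ ⊕ b₁ ] ∷ map (c₁ ⊕_) Bᵥ ∷ map (_⊕ v) K₁ ∷ [ d ⊕ w ]
          ∷ map (c₀ ⊕_) B₂ ∷ map (_⊕ w) K₂ ∷ X ⊛ Y ∷ []))
      (↭-trans (++⁺ (↭-reflexive column-v) (++⁺ʳ _ (↭-reflexive column-w)))
      (↭-trans (prove 10
        ((var (# 0) ∙ var (# 1)) ∙ ((var (# 2) ∙ (var (# 3) ∙ var (# 4)))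
          ∙ (var (# 5) ∙ (var (# 6) ∙ (var (# 7) ∙ (var (# 8) ∙ var (# 9)))))))
        (var (# 5) ∙ ((var (# 6) ∙ var (# 2)) ∙ (((var (# 7) ∙ var (# 0)) ∙ var (# 3))
          ∙ (((var (# 8) ∙ var (# 9)) ∙ var (# 1)) ∙ var (# 4)))))
        ([ c₂ ⊕ v ] ∷ map (_⊕ v) X ∷ [ c₁ ⊕ w ] ∷ [ c₂ ⊕ w ] ∷ map (_⊕ w) X
          ∷ ((c₀ ⊕ b₀) ∷ (c₀ ⊕ b₁) ∷ map (c₀ ⊕_) B₂) ∷ ((c₁ ⊕ b₀) ∷ map (c₁ ⊕_) Bᵥ) ∷ map (c₂ ⊕_) Bᵤ
          ∷ X ⊛ Y ∷ map (_⊕ u) X ∷ []))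
      (++⁺ (↭-reflexive (cong (λ m → map (c₀ ⊕_) (b₀ ∷ m)) (sym eqB₂)))
        (++⁺ (↭-reflexive row-c₁) (++⁺ (↭-reflexive row-c₂) core)))))

  -- Switches of marked (full) factors; `ℓ i` is the top position in factor `i`.

  module Cuboid (ℓ : Fin r → ℕ) (Marked : Fin r → Set) where

    -- The possible pairs p ⊆ q in the intersection of two cuboids from different families:
    -- they agree except that some full factors are switched from bottom to top.
    Switch : V → V → Set
    Switch p q = ∀ i → lookup p i ≡ lookup q i ⊎ (Marked i × lookup p i ≡ 0 × lookup q i ≡ ℓ i)

    Only : (V → V → Set) → List V → Set
    Only E L = ∀ p q → p ∈ L → q ∈ L → Switch p q → p ≡ q ⊎ E p q

    Never : V → V → Set
    Never _ _ = ⊥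

    Clean : List V → Set
    Clean = Only Never

    -- `P` lets one notion cover clean chains (`P` empty) and chains whose end-to-end switch may
    -- remain (`P` trivial), so that a corner can be analysed once for both.
    Ends : Set → Saturated → Set
    Ends P C = Only (λ p q → p ≡ bot C × q ≡ top C × P) (points C)

    Only-map : ∀ {E F L} → (∀ {p q} → E p q → F p q) → Only E L → Only F L
    Only-map f only p q p∈ q∈ sw with only p q p∈ q∈ sw
    ... | inj₁ p≡q = inj₁ p≡q
    ... | inj₂ e = inj₂ (f e)

    Clean⇒Ends : ∀ C → Clean (points C) → Ends ⊥ C
    Clean⇒Ends C = Only-map {F = λ p q → p ≡ bot C × q ≡ top C × ⊥} ⊥-elim

    Off : Fin r → List V → Set
    Off i L = ∀ {v} → v ∈ L → lookup v i ≡ 0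

    -- Disjointness of supports, stated per coordinate so that it passes to sublists and sums
    -- without naming the supports.
    Independent : List V → List V → Set
    Independent L M = ∀ i → Off i L ⊎ Off i M

    Independent-sym : ∀ {L M} → Independent L M → Independent M L
    Independent-sym ind i with ind i
    ... | inj₁ off = inj₂ off
    ... | inj₂ off = inj₁ off

    Independent-⊆ : ∀ {L L′ M} → (∀ {v} → v ∈ L′ → v ∈ L) → Independent L M → Independent L′ M
    Independent-⊆ sub ind i with ind i
    ... | inj₁ off = inj₁ (off ∘ sub)
    ... | inj₂ off = inj₂ off

    Independent-⊛ : ∀ {L M N D} → (∀ {v} → v ∈ N → v ∈ L ⊛ M) →
      Independent L D → Independent M D → Independent N D
    Independent-⊛ {L} {M} sub indL indM i with indL i | indM i
    ... | inj₂ off | _ = inj₂ off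
    ... | inj₁ _ | inj₂ off = inj₂ off
    ... | inj₁ offL | inj₁ offM = inj₁ off
      where
      off : ∀ {v} → v ∈ _ → lookup v i ≡ 0
      off v∈ with ∈-cartesianProductWith⁻ _⊕_ L M (sub v∈)
      ... | x , y , x∈ , y∈ , refl = trans (lookup-⊕ i x y) (cong₂ _+_ (offL x∈) (offM y∈))

    -- Each coordinate vanishes on one of the two lists, so there the sum shows just the other
    -- summand.
    switch-⊕ : ∀ {L M x x′ y y′} → Independent L M → x ∈ L → x′ ∈ L → y ∈ M → y′ ∈ M →
      Switch (x ⊕ y) (x′ ⊕ y′) → Switch x x′ × Switch y y′
    switch-⊕ {L} {M} {x} {x′} {y} {y′} ind x∈ x′∈ y∈ y′∈ sw = (λ i → proj₁ (at i)) , λ i → proj₂ (at i)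
      where
      at : ∀ i → (lookup x i ≡ lookup x′ i ⊎ (Marked i × lookup x i ≡ 0 × lookup x′ i ≡ ℓ i))
               × (lookup y i ≡ lookup y′ i ⊎ (Marked i × lookup y i ≡ 0 × lookup y′ i ≡ ℓ i))
      at i with sw i
      ... | sw-i rewrite lookup-⊕ i x y | lookup-⊕ i x′ y′ with ind i
      ...   | inj₁ off rewrite off x∈ | off x′∈ = inj₁ refl , sw-i
      ...   | inj₂ off rewrite off y∈ | off y′∈ | +-identityʳ (lookup x i) | +-identityʳ (lookup x′ i) =
        sw-i , inj₁ refl

    -- A switch in the grid moves the first component, the second or both. The three hypotheses
    -- treat these cases, and `Q` serves to exclude those in which the piece lacks one of the two
    -- points.
    only-cells : ∀ {E F G L M N} {Q : V → V → Set} → Only E L → Only F M → Independent L M →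
      (∀ {x x′ y} → E x x′ → y ∈ M → Q x y → Q x′ y → G (x ⊕ y) (x′ ⊕ y)) →
      (∀ {x y y′} → F y y′ → x ∈ L → Q x y → Q x y′ → G (x ⊕ y) (x ⊕ y′)) →
      (∀ {x x′ y y′} → E x x′ → F y y′ → Q x y → Q x′ y′ → G (x ⊕ y) (x′ ⊕ y′)) →
      All (Cell L M Q) N → Only G N
    only-cells onlyL onlyM ind h₁ h₂ h₃ cells _ _ p∈ q∈ sw with All.lookup cells p∈ | All.lookup cells q∈
    ... | x , y , refl , x∈ , y∈ , Qxy | x′ , y′ , refl , x′∈ , y′∈ , Qx′y′
      with switch-⊕ ind x∈ x′∈ y∈ y′∈ sw
    ... | swx , swy with onlyL _ _ x∈ x′∈ swx | onlyM _ _ y∈ y′∈ swy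
    ... | inj₁ refl | inj₁ refl = inj₁ refl
    ... | inj₂ e    | inj₁ refl = inj₂ (h₁ e y∈ Qxy Qx′y′)
    ... | inj₁ refl | inj₂ f    = inj₂ (h₂ f x∈ Qxy Qx′y′)
    ... | inj₂ e    | inj₂ f    = inj₂ (h₃ e f Qxy Qx′y′)

    Ind : Saturated → Saturated → Set
    Ind C D = Independent (points C) (points D)

    Ind-sym : ∀ {C D} → Ind C D → Ind D C
    Ind-sym {C} {D} = Independent-sym {points C} {points D}

    -- The only possible switch starts at the bottom, which `N` avoids.
    ends-left : ∀ C {P N} → Ends P C → (∀ {x} → x ∈ N → x ∈ points C × x ≢ bot C) → Clean N
    ends-left _ ends sub p q p∈ q∈ sw with ends p q (proj₁ (sub p∈)) (proj₁ (sub q∈)) sw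
    ... | inj₁ p≡q = inj₁ p≡q
    ... | inj₂ (p≡bot , _) = ⊥-elim (proj₂ (sub p∈) p≡bot)

    ends-right : ∀ B {E N} → Only E (points B) → (∀ {p q} → E p q → q ≡ top B) →
      (∀ {x} → x ∈ N → x ∈ points B × x ≢ top B) → Clean N
    ends-right _ only E⇒top sub p q p∈ q∈ sw with only p q (proj₁ (sub p∈)) (proj₁ (sub q∈)) sw
    ... | inj₁ p≡q = inj₁ p≡q
    ... | inj₂ e = ⊥-elim (proj₂ (sub q∈) (E⇒top e))

    module _ {C B : Saturated} {P P′ : Set} (k : Corner C B) (ind : Ind C B)
             (endsC : Ends P C) (endsB : Ends P′ B) where
      open Corner k

      -- A switch in `C` alone would have to end at `(top C, bot B)` and one in `B` alone would have
      -- to start there, but the chain avoids this corner. Only the simultaneous switch is left, so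
      -- one clean factor already makes the chain clean.
      corner-main : Ends (P × P′) main
      corner-main = only-cells endsC endsB ind
        (λ { (refl , refl , _) _ (f , _) (_ , g , _) → ⊥-elim (g refl (f refl)) })
        (λ { (refl , refl , _) _ (_ , g , _) (_ , _ , h) → ⊥-elim (g (h refl) refl) })
        (λ { (refl , refl , a) (refl , refl , b) _ _ → sym bot-main , sym top-main , a , b })
        main-cells

      -- The edge avoids the end of any switch in `C` and the start of any switch in `B`.
      corner-edge : Clean (points edge)
      corner-edge = only-cells endsC endsB ind
        (λ { (refl , refl , _) _ _ (f , _) → f refl })
        (λ { (refl , refl , _) _ (_ , g) _ → g refl })
        (λ { (refl , refl , _) _ _ (f , _) → f refl })
        edge-cells

    module _ {C : Saturated} {P : Set} {b₀ b₁ w M} {t₀ : b₀ ⋖ b₁} {q : Path b₁ w M} (k : Zigzag C t₀ q)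
             (ind : Independent (points C) (b₀ ∷ M)) (endsC : Ends P C)
             (onlyB : Only (λ x y → x ≡ b₁ × y ≡ w) (b₀ ∷ M)) where
      open Zigzag k

      -- A simultaneous switch would start at `(bot C, b₁)`, but the chain leaves the row of `bot C`
      -- at `b₀`. Here it counts that the switch of `B` starts above its bottom.
      zigzag-first : Clean (points first)
      zigzag-first = only-cells endsC onlyB ind
        (λ { (refl , refl , _) _ (f , _) (_ , g , _) → proj₁ (g refl) (f refl) })
        (λ { (refl , refl) _ (_ , g , _) (_ , _ , h) → proj₂ (g (h refl)) refl })
        (λ { (refl , refl , _) (refl , refl) (f , _) _ → rank->⇒≢ (⋖⇒< t₀) (f refl) })
        first-cells

      -- The chain reaches `w` only at the pivot and does not meet `b₁` there, so `B` cannot switch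
      -- alone; a switch moving `C` would end at its top, which is avoided.
      zigzag-second : Clean (points second)
      zigzag-second = only-cells endsC onlyB ind
        (λ { (refl , refl , _) _ _ (f , _) → f refl })
        (λ { (refl , refl) _ (_ , g , _) (_ , _ , h) → g refl (h refl) })
        (λ { (refl , refl , _) _ _ (f , _) → f refl })
        second-cells

      zigzag-third : Clean (points third)
      zigzag-third = only-cells endsC onlyB ind
        (λ { (refl , refl , _) _ _ (f , _) → f refl })
        (λ { (refl , refl) _ (_ , g) _ → g refl })
        (λ { (refl , refl , _) _ _ (f , _) → f refl })
        third-cells

    -- Decomposing products of several chains.

    mids : List Saturated → ℕ
    mids = ∑ ∘ map mid

    Π : List Saturated → List V
    Π = foldr (λ C L → points C ⊛ L) [ 𝟎 ]

    Π-++ : ∀ Cs Ds → Π (Cs ++ Ds) ≡ Π Cs ⊛ Π Ds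
    Π-++ [] Ds = sym (⊛-identityˡ (Π Ds))
    Π-++ (C ∷ Cs) Ds = trans (cong (points C ⊛_) (Π-++ Cs Ds)) (sym (⊛-assoc (points C) (Π Cs) (Π Ds)))

    Π-↭ : ∀ {Cs Ds} → Cs ↭ Ds → Π Cs ↭ Π Ds
    Π-↭ _↭_.refl = ↭-refl
    Π-↭ (prep C p) = ⊗-congʳ _⊕_ (points C) (Π-↭ p)
    Π-↭ (swap {Cs} {Ds} C D p) = ↭-trans (⊗-congʳ _⊕_ (points C) (⊗-congʳ _⊕_ (points D) (Π-↭ p)))
      (↭-trans (↭-reflexive (sym (⊛-assoc (points C) (points D) (Π Ds))))
      (↭-trans (⊗-congˡ _⊕_ (Π Ds) (⊛-comm (points C) (points D)))
               (↭-reflexive (⊛-assoc (points D) (points C) (Π Ds)))))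
    Π-↭ (_↭_.trans p q) = ↭-trans (Π-↭ p) (Π-↭ q)

    mids-++ : ∀ Cs Ds → mids (Cs ++ Ds) ≡ mids Cs + mids Ds
    mids-++ Cs Ds = trans (cong ∑ (Listₚ.map-++ mid Cs Ds)) (sum-++ (map mid Cs) (map mid Ds))

    -- `Φ` is what is guaranteed of every switch that survives; `Never` asks that none does.
    record Decomposition (Φ : V → V → Set) (Cs : List Saturated) : Set where
      field
        chains    : List Saturated
        partition : bag chains ↭ Π Cs
        symmetric : All (λ F → mid F ≡ mids Cs) chains
        only      : All (Only Φ ∘ points) chains

    open Decomposition

    decomposition-↭ : ∀ {Φ Cs Ds} → Cs ↭ Ds → Decomposition Φ Cs → Decomposition Φ Ds
    decomposition-↭ p d = record
      { chains = chains d
      ; partition = ↭-trans (partition d) (Π-↭ p)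
      ; symmetric = All.map (λ e → trans e (sum-↭ (map⁺ mid p))) (symmetric d)
      ; only = only d
      }

    decomposition-map : ∀ {Φ Ψ Cs} → (∀ {p q} → Φ p q → Ψ p q) → Decomposition Φ Cs → Decomposition Ψ Cs
    decomposition-map {Φ} {Ψ} f d = record
      { chains = chains d
      ; partition = partition d
      ; symmetric = symmetric d
      ; only = All.map (Only-map f) (only d)
      }

    bag-++ : ∀ (Fs Gs : List Saturated) → bag (Fs ++ Gs) ≡ bag Fs ++ bag Gs
    bag-++ Fs Gs = trans (cong concat (Listₚ.map-++ points Fs Gs))
      (sym (Listₚ.concat-++ (map points Fs) (map points Gs)))

    -- Each member of `Ks` is itself a list of factors, so a rectangle can stay a product and be cut
    -- only together with the factors `R` still to come.
    refine : ∀ {Φ} Cs Ks R → concat (map Π Ks) ↭ Π Cs → All (λ K → mids K ≡ mids Cs) Ks →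
      All (λ K → Decomposition Φ (K ++ R)) Ks → Decomposition Φ (Cs ++ R)
    refine {Φ} Cs Ks R cover mids≡ ds = record
      { chains = proj₁ all
      ; partition = ↭-trans (proj₁ (proj₂ all)) (↭-trans (⊗-congˡ _⊕_ (Π R) cover)
          (↭-reflexive (sym (Π-++ Cs R))))
      ; symmetric = proj₁ (proj₂ (proj₂ all))
      ; only = proj₂ (proj₂ (proj₂ all))
      }
      where
      collect : ∀ {Ks} → All (λ K → mids K ≡ mids Cs) Ks → All (λ K → Decomposition Φ (K ++ R)) Ks →
        Σ[ Fs ∈ List Saturated ] (bag Fs ↭ concat (map Π Ks) ⊛ Π R
          × All (λ F → mid F ≡ mids (Cs ++ R)) Fs × All (Only Φ ∘ points) Fs)
      collect [] [] = [] , ↭-refl , [] , []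
      collect {K ∷ Ks} (e ∷ es) (d ∷ ds) with collect es ds
      ... | Fs , perm , sym-Fs , only-Fs = chains d ++ Fs
        , ↭-trans (↭-reflexive (bag-++ (chains d) Fs)) (↭-trans (++⁺ (↭-trans (partition d)
            (↭-reflexive (Π-++ K R))) perm)
            (↭-reflexive (sym (Listₚ.cartesianProductWith-distribʳ-++ _⊕_ (Π K) (concat (map Π Ks)) (Π R)))))
        , Allₚ.++⁺ (All.map (λ e′ → trans e′ (trans (mids-++ K R)
            (trans (cong (_+ mids R) e) (sym (mids-++ Cs R))))) (symmetric d)) sym-Fs
        , Allₚ.++⁺ (only d) only-Fs
      all = collect mids≡ ds

    -- Describes how a surviving switch carries its guarantee along when a further factor
    -- contributes a constant summand.
    Stable : (V → V → Set) → Saturated → Set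
    Stable Φ Z = ∀ p q z → z ∈ points Z → Φ p q → Φ (p ⊕ z) (q ⊕ z)

    never-stable : ∀ {Z} → Stable Never Z
    never-stable _ _ _ _ ()

    ∈-bag : ∀ {Hs : List Saturated} {H} → H ∈ Hs → ∀ {v} → v ∈ points H → v ∈ bag Hs
    ∈-bag (here refl) v∈ = ∈-++⁺ˡ v∈
    ∈-bag {H′ ∷ _} (there H∈) v∈ = ∈-++⁺ʳ (points H′) (∈-bag H∈ v∈)

    -- A switch of the product is constant in every clean factor, hence a translate of a switch of
    -- `C`. This holds for any way of cutting, so plain hooks will do.
    hook-product : ∀ {Φ C} Zs → Only Φ (points C) → All (λ Z → Clean (points Z) × Stable Φ Z) Zs →
      AllPairs Ind (C ∷ Zs) → Decomposition Φ (C ∷ Zs)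
    hook-product {Φ} {C} [] onlyC [] _ = record
      { chains = [ C ]
      ; partition = ↭-reflexive (trans (Listₚ.++-identityʳ _) (sym (⊛-identityʳ (points C))))
      ; symmetric = sym (+-identityʳ _) ∷ []
      ; only = onlyC ∷ []
      }
    hook-product {Φ} {C} (Z ∷ Zs) onlyC ((cleanZ , stableZ) ∷ cleanZs) ((C#Z ∷ C#Zs) ∷ Z#Zs ∷ #Zs)
      with hooks (path C) (path Z)
    ... | Hs , perm , mids-Hs = refine (C ∷ Z ∷ []) (map [_] Hs) Zs
        (↭-trans (↭-reflexive (cong concat (trans (sym (Listₚ.map-∘ Hs))
          (Listₚ.map-cong (λ H → ⊛-identityʳ (points H)) Hs))))
          (↭-trans perm (↭-reflexive (cong (points C ⊛_) (sym (⊛-identityʳ (points Z)))))))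
        (Allₚ.map⁺ (All.map (λ {H} e → trans (+-identityʳ (mid H)) (trans e
          (cong (mid C +_) (sym (+-identityʳ (mid Z)))))) mids-Hs))
        (Allₚ.map⁺ (All.tabulate λ {H} H∈ → hook-product Zs (only-hook H∈) cleanZs
          (All.zipWith (λ {D} (C#D , Z#D) → Independent-⊛ {D = points D} (sub H∈) C#D Z#D) (C#Zs , Z#Zs) ∷ #Zs)))
      where
      sub : ∀ {H} → H ∈ Hs → ∀ {v} → v ∈ points H → v ∈ points C ⊛ points Z
      sub H∈ v∈ = ∈-resp-↭ perm (∈-bag H∈ v∈)
      only-hook : ∀ {H} → H ∈ Hs → Only Φ (points H)
      only-hook H∈ = only-cells {Q = λ _ _ → ⊤} onlyC cleanZ C#Z (λ e z∈ _ _ → stableZ _ _ _ z∈ e) (λ ()) (λ _ ())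
        (All.tabulate λ v∈ → let x , y , x∈ , y∈ , eq = ∈-cartesianProductWith⁻ _⊕_ (points C) (points Z) (sub H∈ v∈)
                             in x , y , eq , x∈ , y∈ , tt)

    Big : Saturated → Set
    Big t = Ends ⊤ t × Long 4 t

    module _ {C B : Saturated} (k : Corner C B) where
      open Corner k

      main⊆ : ∀ {v} → v ∈ points main → v ∈ points C ⊛ points B
      main⊆ v∈ = ∈-resp-↭ cover (∈-++⁺ˡ v∈)

      edge⊆ : ∀ {v} → v ∈ points edge → v ∈ points C ⊛ points B
      edge⊆ v∈ = ∈-resp-↭ cover (∈-++⁺ʳ (points main) (∈-++⁺ˡ v∈))

      module _ {R : List Saturated} (ind : AllPairs Ind (C ∷ B ∷ R)) where
        private
          C#B = All.head (AllPairs.head ind)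
          C#R = All.tail (AllPairs.head ind)
          B#R = AllPairs.head (AllPairs.tail ind)
          #R  = AllPairs.tail (AllPairs.tail ind)

        corner-product# : ∀ {N} → (∀ {v} → v ∈ points N → v ∈ points C ⊛ points B) → AllPairs Ind (N ∷ R)
        corner-product# sub =
          All.zipWith (λ {D} (C#D , B#D) → Independent-⊛ {D = points D} sub C#D B#D) (C#R , B#R) ∷ #R

        corner-core# : AllPairs Ind (right ∷ left ∷ R)
        corner-core# =
          (Ind-sym {left} {right} (Independent-⊆ (proj₁ ∘ left⊆)
            (Ind-sym {right} {C} (Independent-⊆ (proj₁ ∘ right⊆) (Ind-sym {C} {B} C#B))))
          ∷ All.map (λ {D} B#D → Independent-⊆ {M = points D} (proj₁ ∘ right⊆) B#D) B#R)
          ∷ All.map (λ {D} C#D → Independent-⊆ {M = points D} (proj₁ ∘ left⊆) C#D) C#R ∷ #R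

      corner-refine : ∀ {Φ R} → Decomposition Φ (main ∷ R) → Decomposition Φ (edge ∷ R) →
        Decomposition Φ (right ∷ left ∷ R) → Decomposition Φ (C ∷ B ∷ R)
      corner-refine {R = R} d₁ d₂ d₃ = refine (C ∷ B ∷ []) ([ main ] ∷ [ edge ] ∷ (right ∷ left ∷ []) ∷ []) R
        (↭-trans (++⁺ (↭-reflexive (⊛-identityʳ (points main))) (++⁺ (↭-reflexive (⊛-identityʳ (points edge)))
          (↭-trans (↭-reflexive (trans (Listₚ.++-identityʳ _) (cong (points right ⊛_) (⊛-identityʳ (points left)))))
            (⊛-comm (points right) (points left)))))
          (↭-trans cover (↭-reflexive (cong (points C ⊛_) (sym (⊛-identityʳ (points B)))))))
        (trans (+-identityʳ (mid main)) (trans mid-main C+B)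
          ∷ trans (+-identityʳ (mid edge)) (trans mid-edge C+B)
          ∷ trans (cong (mid right +_) (+-identityʳ (mid left)))
              (trans (+-comm (mid right) (mid left)) (trans mid-core C+B)) ∷ [])
        (d₁ ∷ d₂ ∷ d₃ ∷ [])
        where
        C+B : mid C + mid B ≡ mids (C ∷ B ∷ [])
        C+B = cong (mid C +_) (sym (+-identityʳ (mid B)))

    Long-mono : ∀ {m n C} → m ≤ n → Long n C → Long m C
    Long-mono m≤n = ≤-trans (+-monoˡ-≤ _ m≤n)

    -- The clean head `C` absorbs the full factors one at a time. Each corner offers three clean
    -- heads for the recursion: the main chain, the edge, and the rectangle side taken from `t`,
    -- which keeps at least three of its five or more points. The other side may be short and waits
    -- in `Zs`.
    grow-clean : ∀ C ts Zs → Clean (points C) → Long 2 C → All Big ts → All (Clean ∘ points) Zs →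
      AllPairs Ind (C ∷ ts ++ Zs) → Decomposition Never (C ∷ ts ++ Zs)
    grow-clean C [] Zs cleanC longC [] cleanZs ind =
      hook-product Zs cleanC (All.map (λ {Z} cleanZ → cleanZ , never-stable {Z}) cleanZs) ind
    grow-clean C (t ∷ ts) Zs cleanC longC ((endsT , longT) ∷ bigs) cleanZs ind =
      corner-refine k
        (grow-clean main ts Zs (Only-map (λ ()) (corner-main k C#t endsC endsT)) long-main bigs cleanZs
          (corner-product# k ind (main⊆ k)))
        (grow-clean edge ts Zs (corner-edge k C#t endsC endsT) long-edge bigs cleanZs
          (corner-product# k ind (edge⊆ k)))
        (decomposition-↭ (prep right (shift left ts Zs))
          (grow-clean right ts (left ∷ Zs) (ends-right t endsT (proj₁ ∘ proj₂) right⊆) (long-right 2 longT) bigs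
            (ends-left C endsC left⊆ ∷ cleanZs)
            (AllPairs-resp-↭ (λ {D} {E} → Ind-sym {D} {E}) (prep right (↭-sym (shift left ts Zs)))
              (corner-core# k ind))))
      where
      k = corner C t longC (Long-mono {C = t} (m≤n+m 2 2) longT)
      open Corner k
      C#t = All.head (AllPairs.head ind)
      endsC = Clean⇒Ends C cleanC

    -- The two ends of the simultaneous switch of all listed factors.
    bots tops : List Saturated → V
    bots = foldr (λ C v → bot C ⊕ v) 𝟎
    tops = foldr (λ C v → top C ⊕ v) 𝟎

    -- Only the succession of main chains can keep a switch, namely the simultaneous one of all full
    -- factors. Every edge or rectangle branch has a clean head and is left to `grow-clean`.
    grow-ends : ∀ {Φ} C ts Zs → Ends ⊤ C → Long 2 C → All Big ts →
      All (λ Z → Clean (points Z) × Stable Φ Z) Zs →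
      AllPairs Ind (C ∷ ts ++ Zs) → Φ (bots (C ∷ ts)) (tops (C ∷ ts)) → Decomposition Φ (C ∷ ts ++ Zs)
    grow-ends {Φ} C [] Zs endsC longC [] cleanZs ind φ =
      hook-product Zs (Only-map (λ { (refl , refl , _) → subst₂ Φ (⊕-identityʳ _) (⊕-identityʳ _) φ }) endsC)
        cleanZs ind
    grow-ends {Φ} C (t ∷ ts) Zs endsC longC ((endsT , longT) ∷ bigs) cleanZs ind φ =
      corner-refine k
        (grow-ends main ts Zs (Only-map (λ (e , f , _) → e , f , tt) (corner-main k C#t endsC endsT))
          long-main bigs cleanZs (corner-product# k ind (main⊆ k))
          (subst₂ Φ (trans (sym (⊕-assoc _ _ _)) (cong (_⊕ bots ts) (sym bot-main)))
                    (trans (sym (⊕-assoc _ _ _)) (cong (_⊕ tops ts) (sym top-main))) φ))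
        (decomposition-map {Φ = Never} ⊥-elim
          (grow-clean edge ts Zs (corner-edge k C#t endsC endsT) long-edge bigs (All.map proj₁ cleanZs)
            (corner-product# k ind (edge⊆ k))))
        (decomposition-map {Φ = Never} ⊥-elim (decomposition-↭ (prep right (shift left ts Zs))
          (grow-clean right ts (left ∷ Zs) (ends-right t endsT (proj₁ ∘ proj₂) right⊆) (long-right 2 longT) bigs
            (ends-left C endsC left⊆ ∷ All.map proj₁ cleanZs)
            (AllPairs-resp-↭ (λ {D} {E} → Ind-sym {D} {E}) (prep right (↭-sym (shift left ts Zs)))
              (corner-core# k ind)))))
      where
      k = corner C t longC (Long-mono {C = t} (m≤n+m 2 2) longT)
      open Corner k
      C#t = All.head (AllPairs.head ind)

    -- The sides of the rectangle exchange roles: `B` may have just three points, so its side can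
    -- shrink to one, whereas the side from the full factor `C` keeps at least three and becomes the
    -- head.
    absorb-clean : ∀ C B ts Zs → Ends ⊤ C → Long 4 C → Clean (points B) → Long 2 B → All Big ts →
      All (Clean ∘ points) Zs → AllPairs Ind (C ∷ B ∷ ts ++ Zs) → Decomposition Never (C ∷ B ∷ ts ++ Zs)
    absorb-clean C B ts Zs endsC longC cleanB longB bigs cleanZs ind =
      corner-refine k
        (grow-clean main ts Zs (Only-map (λ ()) (corner-main k C#B endsC endsB)) long-main bigs cleanZs
          (corner-product# k ind (main⊆ k)))
        (grow-clean edge ts Zs (corner-edge k C#B endsC endsB) long-edge bigs cleanZs
          (corner-product# k ind (edge⊆ k)))
        (decomposition-↭ (↭-trans (prep left (shift right ts Zs)) (swap left right ↭-refl))
          (grow-clean left ts (right ∷ Zs) (ends-left C endsC left⊆) (long-left 2 longC) bigs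
            (ends-right B endsB (proj₁ ∘ proj₂) right⊆ ∷ cleanZs)
            (AllPairs-resp-↭ (λ {D} {E} → Ind-sym {D} {E})
              (↭-trans (swap right left ↭-refl) (prep left (↭-sym (shift right ts Zs))))
              (corner-core# k ind))))
      where
      k = corner C B (Long-mono {C = C} (m≤n+m 2 2) longC) longB
      open Corner k
      C#B = All.head (AllPairs.head ind)
      endsB = Clean⇒Ends B cleanB

    -- For a 2-element chain `B`. One switch of `C` may survive, at a level `v` that can be
    -- prescribed: `strip-top` places it at the upper level and `strip-bot` at the lower.
    record Strip (C B : Saturated) (v : V) (long : Saturated) : Set where
      field
        other      : Saturated
        cover      : points long ++ points other ↭ points C ⊛ points B
        mid-long   : mid long ≡ mid C + mid B
        mid-other  : mid other ≡ mid C + mid B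
        long-other : ∀ n → Long (suc n) C → Long n other
        only-long  : Only (λ p q → p ≡ bot C ⊕ v × q ≡ top C ⊕ v) (points long)
        clean-other : Clean (points other)

    module _ (C : Saturated) (endsC : Ends ⊤ C) (longC : Long 1 C) {y₀ y₁ : V} (s : y₀ ⋖ y₁)
             (cleanB : Clean (y₀ ∷ y₁ ∷ [])) (ind : Independent (points C) (y₀ ∷ y₁ ∷ [])) where
      private
        B = saturated (s ∷ end y₁)
        c₀≢cₙ : bot C ≢ top C
        c₀≢cₙ = rank-<⇒≢ longC
        columns : map (_⊕ y₀) (points C) ++ map (_⊕ y₁) (points C) ↭ points C ⊛ (y₀ ∷ y₁ ∷ [])
        columns = ↭-trans (++⁺ʳ _ (↭-reflexive (sym (⊗-[-]ʳ _⊕_ (points C) y₀))))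
          (↭-sym (⊗-∷ʳ _⊕_ (points C) [ y₀ ] y₁))

      -- The long chain enters the copy of `C` at `y₁` from below its bottom. What is left at `y₀`
      -- has lost `bot C` and with it the start of the switch.
      strip-top : Strip C B y₁ (saturated (⊕-⋖ʳ (bot C) s ∷ shiftˡ y₁ (path C)))
      strip-top with uncons (path C) longC
      ... | c₁ , L , eq , s₀₁ , p = record
        { other = saturated (shiftˡ y₀ p)
        ; cover = ↭-trans (prove 3 ((var (# 0) ∙ var (# 1)) ∙ var (# 2)) ((var (# 0) ∙ var (# 2)) ∙ var (# 1))
            ([ bot C ⊕ y₀ ] ∷ map (_⊕ y₁) (points C) ∷ map (_⊕ y₀) L ∷ []))
            (↭-trans (++⁺ʳ _ (↭-reflexive (cong (map (_⊕ y₀)) (sym eq)))) columns)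
        ; mid-long = mid-⊕ (bot C) (top C) y₀ y₁
        ; mid-other = trans (mid-⊕ c₁ (top C) y₀ y₀) (mid-slideˡ {w = top C} {y = y₀} s₀₁ s)
        ; long-other = λ n le → subst₂ _≤_ (trans (+-assoc n _ _) (cong (n +_) (sym (rank-⊕ c₁ y₀))))
            (sym (rank-⊕ (top C) y₀)) (+-monoˡ-≤ (rank y₀) (⋖-lowerˡ {n = n} s₀₁ le))
        ; only-long = only-cells {Q = λ x y → y ≡ y₀ → x ≡ bot C} endsC cleanB ind
            (λ { (refl , refl , _) (here refl) _ f → ⊥-elim (c₀≢cₙ (sym (f refl)))
               ; (refl , refl , _) (there (here refl)) _ _ → refl , refl })
            (λ ()) (λ _ ())
            (cell (bot∈ (path C)) (here refl) (λ _ → refl)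
              ∷ column (there (here refl)) (λ x∈ → x∈ , ⊥-elim ∘ rank->⇒≢ (⋖⇒< s)))
        ; clean-other = only-cells {Q = λ x y → x ≢ bot C} endsC cleanB ind
            (λ { (refl , _) _ f _ → f refl }) (λ ()) (λ _ ())
            (column (here refl) λ x∈ → subst (_ ∈_) (sym eq) (there x∈)
              , rank->⇒≢ (<-≤-trans (⋖⇒< s₀₁) (All.lookup (bot≤ p) x∈)))
        }
        where open BagSolver renaming (_⊕_ to _∙_)

      strip-bot : Strip C B y₀ (saturated (shiftˡ y₀ (path C) ▹⟨ ⊕-⋖ʳ (top C) s ⟩ end (top C ⊕ y₁)))
      strip-bot with unsnoc (path C) longC
      ... | k , K , eq , p , sₙ = record
        { other = saturated (shiftˡ y₁ p)
        ; cover = ↭-trans (prove 3 ((var (# 0) ∙ var (# 1)) ∙ var (# 2)) (var (# 0) ∙ (var (# 2) ∙ var (# 1)))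
            (map (_⊕ y₀) (points C) ∷ [ top C ⊕ y₁ ] ∷ map (_⊕ y₁) K ∷ []))
            (↭-trans (++⁺ˡ _ (↭-reflexive (trans (sym (Listₚ.map-++ (_⊕ y₁) K [ top C ]))
              (cong (map (_⊕ y₁)) (sym eq))))) columns)
        ; mid-long = mid-⊕ (bot C) (top C) y₀ y₁
        ; mid-other = trans (mid-⊕ (bot C) k y₁ y₁) (mid-slideʳ {u = bot C} {z = y₁} sₙ s)
        ; long-other = λ n le → subst₂ _≤_ (trans (+-assoc n _ _) (cong (n +_) (sym (rank-⊕ (bot C) y₁))))
            (sym (rank-⊕ k y₁)) (+-monoˡ-≤ (rank y₁) (⋖-lowerʳ {n = n + rank (bot C)} sₙ le))
        ; only-long = only-cells {Q = λ x y → y ≡ y₁ → x ≡ top C} endsC cleanB ind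
            (λ { (refl , refl , _) (there (here refl)) f _ → ⊥-elim (c₀≢cₙ (f refl))
               ; (refl , refl , _) (here refl) _ _ → refl , refl })
            (λ ()) (λ _ ())
            (Allₚ.++⁺ (column (here refl) (λ x∈ → x∈ , ⊥-elim ∘ rank-<⇒≢ (⋖⇒< s)))
              (cell (top∈ (path C)) (there (here refl)) (λ _ → refl) ∷ []))
        ; clean-other = only-cells {Q = λ x y → x ≢ top C} endsC cleanB ind
            (λ { (_ , refl , _) _ _ f → f refl }) (λ ()) (λ _ ())
            (column (there (here refl)) λ x∈ → ∈-init eq x∈
              , rank-<⇒≢ (≤-<-trans (All.lookup (≤top p) x∈) (⋖⇒< sₙ)))
        }
        where open BagSolver renaming (_⊕_ to _∙_)

    module _ {C B v U} (k : Strip C B v U) where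
      open Strip k

      strip-refine : ∀ {Φ R} → Decomposition Φ (U ∷ R) → Decomposition Φ (other ∷ R) →
        Decomposition Φ (C ∷ B ∷ R)
      strip-refine {R = R} d₁ d₂ = refine (C ∷ B ∷ []) ([ U ] ∷ [ other ] ∷ []) R
        (↭-trans (++⁺ (↭-reflexive (⊛-identityʳ (points U)))
          (↭-reflexive (trans (Listₚ.++-identityʳ _) (⊛-identityʳ (points other)))))
          (↭-trans cover (↭-reflexive (cong (points C ⊛_) (sym (⊛-identityʳ (points B)))))))
        (trans (+-identityʳ (mid U)) (trans mid-long C+B)
          ∷ trans (+-identityʳ (mid other)) (trans mid-other C+B) ∷ [])
        (d₁ ∷ d₂ ∷ [])
        where
        C+B : mid C + mid B ≡ mids (C ∷ B ∷ [])
        C+B = cong (mid C +_) (sym (+-identityʳ (mid B)))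

      strip⊆ : ∀ {w} → w ∈ points U ++ points other → w ∈ points C ⊛ points B
      strip⊆ = ∈-resp-↭ cover

      strip# : ∀ {R N} → AllPairs Ind (C ∷ B ∷ R) → (∀ {w} → w ∈ points N → w ∈ points U ++ points other) →
        AllPairs Ind (N ∷ R)
      strip# ((_ ∷ C#R) ∷ B#R ∷ #R) sub = All.zipWith
        (λ {D} (C#D , B#D) → Independent-⊛ {D = points D} (strip⊆ ∘ sub) C#D B#D) (C#R , B#R) ∷ #R

      strip-product : ∀ {Φ Zs} → Φ (bot C ⊕ v) (top C ⊕ v) → All (λ Z → Clean (points Z) × Stable Φ Z) Zs →
        AllPairs Ind (C ∷ B ∷ Zs) → Decomposition Φ (C ∷ B ∷ Zs)
      strip-product φ cleanZs ind = strip-refine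
        (hook-product _ (Only-map (λ { (refl , refl) → φ }) only-long) cleanZs (strip# ind ∈-++⁺ˡ))
        (hook-product _ (Only-map ⊥-elim clean-other) cleanZs (strip# ind (∈-++⁺ʳ (points U))))

    zigzag-clean : ∀ C {y₀ y₁} (s : y₀ ⋖ y₁) D ts Zs → Ends ⊤ C → Long 4 C → Clean (y₀ ∷ y₁ ∷ []) →
      All Big (D ∷ ts) → All (Clean ∘ points) Zs → AllPairs Ind (C ∷ saturated (s ∷ end y₁) ∷ D ∷ ts ++ Zs) →
      Decomposition Never (C ∷ saturated (s ∷ end y₁) ∷ D ∷ ts ++ Zs)
    zigzag-clean C {y₀} {y₁} s D ts Zs endsC longC cleanB (bigD@(endsD , longD) ∷ bigs) cleanZs
      ind@((C#B ∷ _) ∷ _) = strip-refine k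
        (decomposition-↭ (swap D U ↭-refl) (refine (D ∷ U ∷ [])
          ([ first ] ∷ [ second ] ∷ [ third ] ∷ (right ∷ left ∷ []) ∷ []) (ts ++ Zs)
          (↭-trans (++⁺ (↭-reflexive (⊛-identityʳ (points first))) (++⁺ (↭-reflexive (⊛-identityʳ (points second)))
            (++⁺ (↭-reflexive (⊛-identityʳ (points third)))
            (↭-trans (↭-reflexive (trans (Listₚ.++-identityʳ _) (cong (points right ⊛_) (⊛-identityʳ (points left)))))
              (⊛-comm (points right) (points left))))))
            (↭-trans cover (↭-reflexive (cong (points D ⊛_) (sym (⊛-identityʳ (points U)))))))
          (trans (+-identityʳ (mid first)) (trans mid-first D+U)
            ∷ trans (+-identityʳ (mid second)) (trans mid-second D+U)
            ∷ trans (+-identityʳ (mid third)) (trans mid-third D+U)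
            ∷ trans (cong (mid right +_) (+-identityʳ (mid left)))
                (trans (+-comm (mid right) (mid left)) (trans mid-core D+U)) ∷ [])
          ( grow-clean first ts Zs (zigzag-first z D#U endsD (Strip.only-long k)) long-first bigs cleanZs
              (product# (λ v∈ → ∈-++⁺ˡ v∈))
          ∷ grow-clean second ts Zs (zigzag-second z D#U endsD (Strip.only-long k)) long-second bigs cleanZs
              (product# (λ v∈ → ∈-++⁺ʳ (points first) (∈-++⁺ˡ v∈)))
          ∷ grow-clean third ts Zs (zigzag-third z D#U endsD (Strip.only-long k)) long-third bigs cleanZs
              (product# (λ v∈ → ∈-++⁺ʳ (points first) (∈-++⁺ʳ (points second) (∈-++⁺ˡ v∈))))
          ∷ decomposition-↭ (prep right (shift left ts Zs))
            (grow-clean right ts (left ∷ Zs) (ends-right U (Strip.only-long k) proj₂ right⊆) (long-right 2 longU) bigs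
              (ends-left D endsD left⊆ ∷ cleanZs)
              (AllPairs-resp-↭ (λ {D} {E} → Ind-sym {D} {E}) (prep right (↭-sym (shift left ts Zs)))
                core#))
          ∷ [])))
        (grow-clean (Strip.other k) (D ∷ ts) Zs (Strip.clean-other k)
          (Strip.long-other k 2 (Long-mono {C = C} (m≤n+m 3 1) longC)) (bigD ∷ bigs) cleanZs
          (strip# k ind (∈-++⁺ʳ (points U))))
      where
      -- The upper level makes the switch of `U` start at its second point, as the zigzag requires.
      k = strip-top C endsC (Long-mono {C = C} (m≤n+m 1 3) longC) s cleanB C#B
      U = saturated (⊕-⋖ʳ (bot C) s ∷ shiftˡ y₁ (path C))
      -- One more than a full factor guarantees: the zigzag takes three points off the side `right`,
      -- and three must remain for the next corner.
      longU : Long 5 U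
      longU = subst₂ _≤_
        (trans (cong (4 + rank (bot C) +_) (rank-⋖ s)) (trans (+-suc (4 + rank (bot C)) (rank y₀))
          (cong (5 +_) (sym (rank-⊕ (bot C) y₀)))))
        (sym (rank-⊕ (top C) y₁)) (+-monoˡ-≤ (rank y₁) longC)
      z = zigzag D (⊕-⋖ʳ (bot C) s) (shiftˡ y₁ (path C)) longD (Long-mono {C = U} (m≤n+m 4 1) longU)
      open Zigzag z
      D+U : mid D + mid U ≡ mids (D ∷ U ∷ [])
      D+U = cong (mid D +_) (sym (+-identityʳ (mid U)))
      U# : AllPairs Ind (U ∷ D ∷ ts ++ Zs)
      U# = strip# k ind ∈-++⁺ˡ
      U#D = All.head (AllPairs.head U#)
      U#R = All.tail (AllPairs.head U#)
      D#R = AllPairs.head (AllPairs.tail U#)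
      #R  = AllPairs.tail (AllPairs.tail U#)
      D#U : Ind D U
      D#U = Ind-sym {U} {D} U#D
      product# : ∀ {N} → (∀ {v} → v ∈ points N →
        v ∈ points first ++ points second ++ points third ++ points left ⊛ points right) → AllPairs Ind (N ∷ ts ++ Zs)
      product# sub = All.zipWith (λ {E} (D#E , U#E) →
        Independent-⊛ {D = points E} (∈-resp-↭ cover ∘ sub) D#E U#E) (D#R , U#R) ∷ #R
      core# : AllPairs Ind (right ∷ left ∷ ts ++ Zs)
      core# =
        (Ind-sym {left} {right} (Independent-⊆ (proj₁ ∘ left⊆)
          (Ind-sym {right} {D} (Independent-⊆ (proj₁ ∘ right⊆) U#D)))
        ∷ All.map (λ {E} U#E → Independent-⊆ {M = points E} (proj₁ ∘ right⊆) U#E) U#R)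
        ∷ All.map (λ {E} D#E → Independent-⊆ {M = points E} (proj₁ ∘ left⊆) D#E) D#R ∷ #R

    -- Factors as coordinate axes, and the case analysis for one cuboid.

    single : Fin r → ℕ → V
    single i y = 𝟎 [ i ]≔ y

    lookup-𝟎 : ∀ i → lookup 𝟎 i ≡ 0
    lookup-𝟎 i = Vecₚ.lookup-replicate i 0

    lookup-single : ∀ i y → lookup (single i y) i ≡ y
    lookup-single i y = Vecₚ.lookup∘update i 𝟎 y

    lookup-single′ : ∀ {i j} y → j ≢ i → lookup (single i y) j ≡ 0
    lookup-single′ {i} {j} y j≢i = trans (Vecₚ.lookup∘update′ j≢i 𝟎 y) (lookup-𝟎 j)

    single-⋖ : ∀ i y → single i y ⋖ single i (suc y)
    single-⋖ i y = step mono (trans (rank-single i (suc y)) (cong suc (sym (rank-single i y))))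
      where
      mono : single i y ≼ single i (suc y)
      mono j with j Finₚ.≟ i
      ... | yes refl = subst₂ _≤_ (sym (lookup-single i y)) (sym (lookup-single i (suc y))) (n≤1+n y)
      ... | no j≢i = ≤-reflexive (trans (lookup-single′ y j≢i) (sym (lookup-single′ (suc y) j≢i)))

    Path-applyUpTo : ∀ (f : ℕ → V) n → (∀ y → f y ⋖ f (suc y)) → Path (f 0) (f n) (applyUpTo f (suc n))
    Path-applyUpTo f zero s = end (f 0)
    Path-applyUpTo f (suc n) s = s 0 ∷ Path-applyUpTo (f ∘ suc) n (s ∘ suc)

    -- The length is a free parameter so that `ℓ t ≡ 1` can be substituted and the line becomes a
    -- literal path of one step.
    segment : Fin r → ℕ → Saturated
    segment i n = saturated (Path-applyUpTo (single i) n (single-⋖ i))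

    line : Fin r → Saturated
    line i = segment i (ℓ i)

    lines : List (Fin r) → List Saturated
    lines = map line

    ∈-line⁻ : ∀ {i v} → v ∈ points (line i) → Σ[ y ∈ ℕ ] v ≡ single i y
    ∈-line⁻ {i} v∈ = let y , _ , eq = ∈-applyUpTo⁻ (single i) v∈ in y , eq

    line-off : ∀ {i j} → j ≢ i → Off j (points (line i))
    line-off {i} j≢i v∈ with ∈-line⁻ {i} v∈
    ... | y , refl = lookup-single′ y j≢i

    line-ends : ∀ i → Ends ⊤ (line i)
    line-ends i p q p∈ q∈ sw with ∈-line⁻ {i} p∈ | ∈-line⁻ {i} q∈ | sw i
    ... | y , refl | z , refl | inj₁ eq =
      inj₁ (cong (single i) (trans (sym (lookup-single i y)) (trans eq (lookup-single i z))))
    ... | y , refl | z , refl | inj₂ (_ , y≡0 , z≡ℓ) =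
      inj₂ (cong (single i) (trans (sym (lookup-single i y)) y≡0)
          , cong (single i) (trans (sym (lookup-single i z)) z≡ℓ) , tt)

    line-clean : ∀ {i} → ¬ Marked i → Clean (points (line i))
    line-clean {i} ¬m p q p∈ q∈ sw with ∈-line⁻ {i} p∈ | ∈-line⁻ {i} q∈ | sw i
    ... | y , refl | z , refl | inj₁ eq =
      inj₁ (cong (single i) (trans (sym (lookup-single i y)) (trans eq (lookup-single i z))))
    ... | y , refl | z , refl | inj₂ (m , _) = ⊥-elim (¬m m)

    line-long : ∀ {i n} → n ≤ ℓ i → Long n (line i)
    line-long {i} {n} n≤ℓ = subst₂ _≤_ (sym (trans (cong (n +_) (rank-single i 0)) (+-identityʳ n)))
      (sym (rank-single i (ℓ i))) n≤ℓ

    lines# : ∀ {is} → Unique is → AllPairs Ind (lines is)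
    lines# = AllPairsₚ.map⁺ ∘ AllPairs.map independent
      where
      independent : ∀ {i j} → i ≢ j → Ind (line i) (line j)
      independent {i} {j} i≢j c with c Finₚ.≟ i
      ... | yes refl = inj₂ (line-off i≢j)
      ... | no c≢i = inj₁ (line-off c≢i)

    lines-++ : ∀ is js → lines (is ++ js) ≡ lines is ++ lines js
    lines-++ = Listₚ.map-++ line

    lookup-bots : ∀ is i → lookup (bots (lines is)) i ≡ 0
    lookup-bots [] i = lookup-𝟎 i
    lookup-bots (j ∷ is) i = trans (lookup-⊕ i (single j 0) _) (cong₂ _+_ lookup-0 (lookup-bots is i))
      where
      lookup-0 : lookup (single j 0) i ≡ 0
      lookup-0 with i Finₚ.≟ j
      ... | yes refl = lookup-single j 0
      ... | no i≢j = lookup-single′ 0 i≢j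

    lookup-tops∉ : ∀ {is i} → All (i ≢_) is → lookup (tops (lines is)) i ≡ 0
    lookup-tops∉ {i = i} [] = lookup-𝟎 i
    lookup-tops∉ {j ∷ is} {i} (i≢j ∷ i∉) =
      trans (lookup-⊕ i (single j (ℓ j)) _) (cong₂ _+_ (lookup-single′ (ℓ j) i≢j) (lookup-tops∉ i∉))

    lookup-tops : ∀ {is i} → Unique is → i ∈ is → lookup (tops (lines is)) i ≡ ℓ i
    lookup-tops {i ∷ is} (i∉ ∷ _) (here refl) = trans (lookup-⊕ i (single i (ℓ i)) _)
      (trans (cong₂ _+_ (lookup-single i (ℓ i)) (lookup-tops∉ i∉)) (+-identityʳ (ℓ i)))
    lookup-tops {j ∷ is} {i} (j∉ ∷ uniq) (there i∈) = trans (lookup-⊕ i (single j (ℓ j)) _)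
      (cong₂ _+_ (lookup-single′ (ℓ j) (All.lookup j∉ i∈ ∘ sym)) (lookup-tops uniq i∈))

    -- `partner s` is the factor that settles where the switch of a lone full factor `s` goes, and
    -- `value s` is the position in that factor at which it is put.
    module Decompose (Marked? : ∀ i → Dec (Marked i)) (long-marked : ∀ i → Marked i → 4 ≤ ℓ i)
             (partner : Fin r → Fin r) (value : Fin r → ℕ) (value≤1 : ∀ s → value s ≤ 1)
             (partner-ok : ∀ s t → t ≢ s → ℓ t ≡ 1 → (∀ i → i ≢ s → ℓ i ≤ 1) →
               partner s ≢ s × ℓ (partner s) ≡ 1) where

      -- The switches that cannot be avoided. If two cuboids from different families share such a switch,
      -- then `full` yields a common 1-element chain and `lone` two 2-element chains with the same tail.
      data Exceptional (p q : V) : Set where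
        full : (∀ i → ¬ Marked i → ℓ i ≡ 0) → (∀ i → Marked i → lookup p i ≡ 0 × lookup q i ≡ ℓ i) →
          Exceptional p q
        lone : ∀ s → Marked s → (∀ i → Marked i → i ≡ s) → partner s ≢ s → ℓ (partner s) ≡ 1 →
          lookup p (partner s) ≡ value s → Exceptional p q

      bigs : ∀ {is} → All Marked is → All Big (lines is)
      bigs = Allₚ.map⁺ ∘ All.map λ {i} m → line-ends i , line-long (long-marked i m)

      cleans : ∀ {is} → All (¬_ ∘ Marked) is → All (Clean ∘ points) (lines is)
      cleans = Allₚ.map⁺ ∘ All.map line-clean

      rearrange : ∀ {Φ is is′} → is ↭ is′ → Decomposition Φ (lines is′) → Decomposition Φ (lines is)
      rearrange p = decomposition-↭ (map⁺ line (↭-sym p))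

      unique-↭ : ∀ {is js : List (Fin r)} → is ↭ js → Unique is → Unique js
      unique-↭ = AllPairs-resp-↭ (λ x≢y → x≢y ∘ sym)

      extract : ∀ {t : Fin r} {ts} → t ∈ ts → Σ[ ts′ ∈ List (Fin r) ] (ts ↭ t ∷ ts′)
      extract t∈ with ∈-∃++ t∈
      ... | ys , zs , refl = ys ++ zs , shift _ ys zs

      -- The surviving switch takes every marked coordinate from zero to its top, and adding points
      -- of the unmarked axes leaves those coordinates alone.
      all-full : ∀ s ss Ts → All Marked (s ∷ ss) → All (¬_ ∘ Marked) Ts → Unique (s ∷ ss ++ Ts) →
        (∀ i → i ∈ s ∷ ss ++ Ts) → All (λ t → ℓ t ≡ 0) Ts → Decomposition Exceptional (lines (s ∷ ss ++ Ts))
      all-full s ss Ts (ms ∷ mss) ¬Ts uniq every zeros = decomposition-map (full unmarked)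
        (subst (λ L → Decomposition Switched (line s ∷ L)) (sym (lines-++ ss Ts))
          (grow-ends (line s) (lines ss) (lines Ts) (line-ends s)
            (line-long (≤-trans (m≤n+m 2 2) (long-marked s ms))) (bigs mss)
            (Allₚ.map⁺ (All.map (λ ¬m → line-clean ¬m , stable ¬m) ¬Ts))
            (subst (λ L → AllPairs Ind (line s ∷ L)) (lines-++ ss Ts) (lines# uniq))
            (λ i m → lookup-bots (s ∷ ss) i , lookup-tops (unique-prefix (s ∷ ss) uniq) (marked∈ i m))))
        where
        Switched : V → V → Set
        Switched p q = ∀ i → Marked i → lookup p i ≡ 0 × lookup q i ≡ ℓ i
        unmarked : ∀ i → ¬ Marked i → ℓ i ≡ 0
        unmarked i ¬m with ∈-++⁻ (s ∷ ss) (every i)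
        ... | inj₁ i∈ = ⊥-elim (¬m (All.lookup (ms ∷ mss) i∈))
        ... | inj₂ i∈ = All.lookup zeros i∈
        marked∈ : ∀ i → Marked i → i ∈ s ∷ ss
        marked∈ i m with ∈-++⁻ (s ∷ ss) (every i)
        ... | inj₁ i∈ = i∈
        ... | inj₂ i∈ = ⊥-elim (All.lookup ¬Ts i∈ m)
        stable : ∀ {t} → ¬ Marked t → Stable Switched (line t)
        stable {t} ¬m p q z z∈ φ i m = let p≡ , q≡ = φ i m in
          trans (lookup-⊕ i p z) (trans (cong₂ _+_ p≡ z≡0) refl)
          , trans (lookup-⊕ i q z) (trans (cong₂ _+_ q≡ z≡0) (+-identityʳ _))
          where
          z≡0 : lookup z i ≡ 0
          z≡0 = line-off {t} (λ { refl → ¬m m }) z∈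

      two-marked : ∀ s s′ ss Ts t → All Marked (s ∷ s′ ∷ ss) → All (¬_ ∘ Marked) Ts →
        Unique (s ∷ s′ ∷ ss ++ Ts) → t ∈ Ts → ℓ t ≡ 1 → Decomposition Never (lines (s ∷ s′ ∷ ss ++ Ts))
      two-marked s s′ ss Ts t (ms ∷ ms′ ∷ mss) ¬Ts uniq t∈ ℓt≡1 with extract t∈
      ... | Ts′ , p with All-resp-↭ p ¬Ts
      ... | ¬t ∷ ¬Ts′ = rearrange perm
        (subst (λ L → Decomposition Never (line s ∷ line t ∷ line s′ ∷ L)) (sym (lines-++ ss Ts′))
          (subst Goal (sym ℓt≡1) (zigzag-clean (line s) (single-⋖ t 0) (line s′) (lines ss) (lines Ts′)
            (line-ends s) (line-long (long-marked s ms))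
            (subst (λ n → Clean (points (segment t n))) ℓt≡1 (line-clean ¬t))
            (bigs (ms′ ∷ mss)) (cleans ¬Ts′)
            (subst (λ n → AllPairs Ind (line s ∷ segment t n ∷ line s′ ∷ lines ss ++ lines Ts′)) ℓt≡1
              (subst (λ L → AllPairs Ind (line s ∷ line t ∷ line s′ ∷ L)) (lines-++ ss Ts′)
                (lines# (unique-↭ perm uniq)))))))
        where
        perm : s ∷ s′ ∷ ss ++ Ts ↭ s ∷ t ∷ s′ ∷ ss ++ Ts′
        perm = prep s (↭-trans (++⁺ˡ (s′ ∷ ss) p) (shift t (s′ ∷ ss) Ts′))
        Goal : ℕ → Set
        Goal n = Decomposition Never (line s ∷ segment t n ∷ line s′ ∷ lines ss ++ lines Ts′)

      -- The strip is taken along the prescribed partner, not along `t`: by `partner-ok`, `t` only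
      -- serves to show that the partner has exactly two positions in this cuboid.
      one-marked : ∀ s Ts t → Marked s → All (¬_ ∘ Marked) Ts → Unique (s ∷ Ts) → (∀ i → i ∈ s ∷ Ts) →
        All (λ t → ℓ t ≤ 1) Ts → t ∈ Ts → ℓ t ≡ 1 → Decomposition Exceptional (lines (s ∷ Ts))
      one-marked s Ts t ms ¬Ts uniq every short t∈ ℓt≡1
        with partner-ok s t (All.lookup (AllPairs.head uniq) t∈ ∘ sym) ℓt≡1
               (λ i i≢s → All.lookup short (others i i≢s))
        where
        others : ∀ i → i ≢ s → i ∈ Ts
        others i i≢s with every i
        ... | here i≡s = ⊥-elim (i≢s i≡s)
        ... | there i∈ = i∈
      ... | c≢s , ℓc≡1 with every (partner s)
      ...   | here c≡s = ⊥-elim (c≢s c≡s)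
      ...   | there c∈ with extract c∈
      ...     | Ts′ , p with All-resp-↭ p ¬Ts | unique-↭ (prep s p) uniq
      ...       | ¬c ∷ ¬Ts′ | uniq′@(_ ∷ c∉ ∷ _) =
        decomposition-map (lone s ms marked≡ c≢s ℓc≡1)
          (rearrange (prep s p) (subst Goal (sym ℓc≡1) (strips (value s) (value≤1 s))))
        where
        c = partner s
        Goal : ℕ → Set
        Goal n = Decomposition (λ p _ → lookup p c ≡ value s) (line s ∷ segment c n ∷ lines Ts′)
        marked≡ : ∀ i → Marked i → i ≡ s
        marked≡ i m with every i
        ... | here i≡s = i≡s
        ... | there i∈ = ⊥-elim (All.lookup ¬Ts i∈ m)
        at-c : ∀ y → lookup (single s 0 ⊕ single c y) c ≡ y
        at-c y = trans (lookup-⊕ c (single s 0) (single c y))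
          (cong₂ _+_ (lookup-single′ 0 c≢s) (lookup-single c y))
        stable : ∀ {t v} → c ≢ t → Stable (λ p _ → lookup p c ≡ v) (line t)
        stable {t} c≢t p _ z z∈ e =
          trans (lookup-⊕ c p z) (trans (cong₂ _+_ e (line-off {t} c≢t z∈)) (+-identityʳ _))
        ind : AllPairs Ind (line s ∷ segment c 1 ∷ lines Ts′)
        ind = subst (λ n → AllPairs Ind (line s ∷ segment c n ∷ lines Ts′)) ℓc≡1 (lines# uniq′)
        clean-c : Clean (points (segment c 1))
        clean-c = subst (λ n → Clean (points (segment c n))) ℓc≡1 (line-clean ¬c)
        longS : Long 1 (line s)
        longS = line-long (≤-trans (m≤n+m 1 3) (long-marked s ms))
        rest : ∀ {v} → All (λ Z → Clean (points Z) × Stable (λ p _ → lookup p c ≡ v) Z) (lines Ts′)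
        rest = Allₚ.map⁺ (All.zipWith (λ (¬m , c≢t) → line-clean ¬m , stable c≢t) (¬Ts′ , c∉))
        strips : ∀ v → v ≤ 1 → Decomposition (λ p _ → lookup p c ≡ v) (line s ∷ segment c 1 ∷ lines Ts′)
        strips zero _ = strip-product
          (strip-bot (line s) (line-ends s) longS (single-⋖ c 0) clean-c (All.head (AllPairs.head ind)))
          (at-c 0) rest ind
        strips (suc zero) _ = strip-product
          (strip-top (line s) (line-ends s) longS (single-⋖ c 0) clean-c (All.head (AllPairs.head ind)))
          (at-c 1) rest ind
        strips (suc (suc _)) (s≤s ())

      some-long : ∀ s ss Ts t → All Marked (s ∷ ss) → All (¬_ ∘ Marked) Ts → Unique (s ∷ ss ++ Ts) →
        t ∈ Ts → 2 ≤ ℓ t → Decomposition Never (lines (s ∷ ss ++ Ts))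
      some-long s ss Ts t (ms ∷ mss) ¬Ts uniq t∈ 2≤ℓ with extract t∈
      ... | Ts′ , p with All-resp-↭ p ¬Ts
      ... | ¬t ∷ ¬Ts′ = rearrange perm
        (subst (λ L → Decomposition Never (line s ∷ line t ∷ L)) (sym (lines-++ ss Ts′))
          (absorb-clean (line s) (line t) (lines ss) (lines Ts′) (line-ends s)
            (line-long (long-marked s ms)) (line-clean ¬t) (line-long 2≤ℓ) (bigs mss) (cleans ¬Ts′)
            (subst (λ L → AllPairs Ind (line s ∷ line t ∷ L)) (lines-++ ss Ts′)
              (lines# (unique-↭ perm uniq)))))
        where
        perm : s ∷ ss ++ Ts ↭ s ∷ t ∷ ss ++ Ts′
        perm = prep s (↭-trans (++⁺ˡ ss p) (shift t ss Ts′))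

      cuboid : Decomposition Exceptional (lines (allFin r))
      cuboid with split-↭ Marked? (allFin r)
      ... | Ss , Ts , p , mSs , ¬Ts = rearrange p
        (cases Ss Ts mSs ¬Ts (unique-↭ p (Uniqueₚ.allFin⁺ r)) (λ i → ∈-resp-↭ p (∈-allFin i)))
        where
        cases : ∀ Ss Ts → All Marked Ss → All (¬_ ∘ Marked) Ts → Unique (Ss ++ Ts) → (∀ i → i ∈ Ss ++ Ts) →
          Decomposition Exceptional (lines (Ss ++ Ts))
        -- Here `r` is zero and the cuboid is a single point.
        cases [] [] _ _ _ _ = record
          { chains = [ saturated (end 𝟎) ]
          ; partition = ↭-refl
          ; symmetric = cong₂ _+_ (rank-𝟎 r) (rank-𝟎 r) ∷ []
          ; only = (λ { _ _ (here refl) (here refl) _ → inj₁ refl }) ∷ []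
          }
        -- Without full factors there is nothing to switch, and hooks suffice.
        cases [] (t ∷ Ts) _ (¬t ∷ ¬Ts) uniq _ = decomposition-map {Φ = Never} ⊥-elim
          (hook-product (lines Ts) (line-clean ¬t)
            (All.map (λ {Z} cleanZ → cleanZ , never-stable {Z}) (cleans ¬Ts)) (lines# uniq))
        cases (s ∷ ss) Ts mSs ¬Ts uniq every with Any.any? (λ t → 2 ℕₚ.≤? ℓ t) Ts
        ... | yes any with find any
        ...   | t , t∈ , 2≤ℓ = decomposition-map {Φ = Never} ⊥-elim (some-long s ss Ts t mSs ¬Ts uniq t∈ 2≤ℓ)
        cases (s ∷ ss) Ts mSs ¬Ts uniq every | no none with Any.any? (λ t → ℓ t ℕₚ.≟ 1) Ts
        ...   | no none′ = all-full s ss Ts mSs ¬Ts uniq every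
          (All.tabulate λ {t} t∈ → is-zero (ℓ t) (λ le → none (lose t∈ le)) (λ eq → none′ (lose t∈ eq)))
          where
          is-zero : ∀ n → ¬ 2 ≤ n → n ≢ 1 → n ≡ 0
          is-zero zero _ _ = refl
          is-zero (suc zero) _ n≢1 = ⊥-elim (n≢1 refl)
          is-zero (suc (suc n)) 2≰ _ = ⊥-elim (2≰ (s≤s (s≤s z≤n)))
        ...   | yes any = with-pair ss (find any) mSs uniq every
          where
          with-pair : ∀ ss → (Σ[ t ∈ Fin r ] (t ∈ Ts × ℓ t ≡ 1)) → All Marked (s ∷ ss) →
            Unique (s ∷ ss ++ Ts) → (∀ i → i ∈ s ∷ ss ++ Ts) → Decomposition Exceptional (lines (s ∷ ss ++ Ts))
          with-pair [] (t , t∈ , ℓt≡1) (ms ∷ []) uniq every = one-marked s Ts t ms ¬Ts uniq every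
            (All.tabulate λ t∈ → ℕₚ.≤-pred (ℕₚ.≰⇒> (λ le → none (lose t∈ le)))) t∈ ℓt≡1
          with-pair (s′ ∷ ss) (t , t∈ , ℓt≡1) mSs uniq _ = decomposition-map {Φ = Never} ⊥-elim
            (two-marked s s′ ss Ts t mSs ¬Ts uniq t∈ ℓt≡1)

-- From position vectors to subsets.

nth : ∀ {n} → Chain n → ℕ → Subset n
nth [] _ = ∅
nth (x ∷ C) zero = x
nth (x ∷ C) (suc k) = nth C k

nth∈ : ∀ {n} (C : Chain n) {k} → k < length C → nth C k ∈ C
nth∈ (x ∷ C) {zero} lt = here refl
nth∈ (x ∷ C) {suc k} (s≤s lt) = there (nth∈ C lt)

∈⇒nth : ∀ {n} {C : Chain n} {x} → x ∈ C → Σ[ k ∈ ℕ ] (k < length C × x ≡ nth C k)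
∈⇒nth (here refl) = 0 , s≤s z≤n , refl
∈⇒nth (there x∈) = let k , lt , eq = ∈⇒nth x∈ in suc k , s≤s lt , eq

map-nth : ∀ {n} {B : Set} (f : Subset n → B) (C : Chain n) →
  applyUpTo (f ∘ nth C) (length C) ≡ map f C
map-nth f [] = refl
map-nth f (x ∷ C) = cong (f x ∷_) (map-nth f C)

nth-map : ∀ {n} (f : Subset n → ℕ) (C : Chain n) (g : ℕ → ℕ) m → map f C ≡ applyUpTo g m →
  ∀ {k} → k < m → f (nth C k) ≡ g k
nth-map f [] g (suc m) () _
nth-map f (x ∷ C) g (suc m) eq {zero} lt = Listₚ.∷-injectiveˡ eq
nth-map f (x ∷ C) g (suc m) eq {suc k} (s≤s lt) = nth-map f C (g ∘ suc) m (Listₚ.∷-injectiveʳ eq) lt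

chain-sorted : ∀ {n} {C : Chain n} → Linked _⊆_ C → AllPairs _⊆_ C
chain-sorted = Linkedₚ.Linked⇒AllPairs Subsetₚ.⊆-trans

nth-mono : ∀ {n} {C : Chain n} → AllPairs _⊆_ C → ∀ {k k′} → k ≤ k′ → k′ < length C → nth C k ⊆ nth C k′
nth-mono (_ ∷ _) {zero} {zero} _ _ = id
nth-mono {C = _ ∷ C} (x⊆ ∷ _) {zero} {suc k′} _ (s≤s lt) = All.lookup x⊆ (nth∈ C lt)
nth-mono (_ ∷ sorted) {suc k} {suc k′} (s≤s le) (s≤s lt) = nth-mono sorted le lt

comparable : ∀ {n} {C : Chain n} → AllPairs _⊆_ C → ∀ {x y} → x ∈ C → y ∈ C → x ⊆ y ⊎ y ⊆ x
comparable (x⊆ ∷ _) (here refl) (here refl) = inj₁ id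
comparable (x⊆ ∷ _) (here refl) (there y∈) = inj₁ (All.lookup x⊆ y∈)
comparable (x⊆ ∷ _) (there x∈) (here refl) = inj₂ (All.lookup x⊆ x∈)
comparable (_ ∷ sorted) (there x∈) (there y∈) = comparable sorted x∈ y∈

map-upTo : ∀ {B : Set} (f : ℕ → B) n → map f (upTo n) ≡ applyUpTo f n
map-upTo f n = Listₚ.map-applyUpTo id f n

∣⧺∣ : ∀ {m n} (x : Subset m) (y : Subset n) → ∣ x ⧺ y ∣ ≡ ∣ x ∣ + ∣ y ∣
∣⧺∣ [] y = refl
∣⧺∣ (true ∷ x) y = cong suc (∣⧺∣ x y)
∣⧺∣ (false ∷ x) y = ∣⧺∣ x y

⧺-⊆ : ∀ {m n} {x x′ : Subset m} {y y′ : Subset n} → x ⊆ x′ → y ⊆ y′ → x ⧺ y ⊆ x′ ⧺ y′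
⧺-⊆ {x = []} {[]} x⊆ y⊆ i∈ = y⊆ i∈
⧺-⊆ {x = s ∷ x} {t ∷ x′} x⊆ y⊆ here with x⊆ here
... | here = here
⧺-⊆ {x = s ∷ x} {t ∷ x′} x⊆ y⊆ (there i∈) = there (⧺-⊆ (Subsetₚ.drop-∷-⊆ x⊆) y⊆ i∈)

take-⧺ : ∀ {m n} (x : Subset m) (y : Subset n) → take m (x ⧺ y) ≡ x
take-⧺ [] y = refl
take-⧺ (s ∷ x) y = cong (s ∷_) (take-⧺ x y)

drop-⧺ : ∀ {m n} (x : Subset m) (y : Subset n) → drop m (x ⧺ y) ≡ y
drop-⧺ [] y = refl
drop-⧺ (s ∷ x) y = drop-⧺ x y

take-⊆ : ∀ m {n} {x y : Subset (m + n)} → x ⊆ y → take m x ⊆ take m y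
take-⊆ (suc m) {x = s ∷ x} {t ∷ y} x⊆y here with x⊆y here
... | here = here
take-⊆ (suc m) {x = s ∷ x} {t ∷ y} x⊆y (there i∈) = there (take-⊆ m (Subsetₚ.drop-∷-⊆ x⊆y) i∈)

drop-⊆ : ∀ m {n} {x y : Subset (m + n)} → x ⊆ y → drop m x ⊆ drop m y
drop-⊆ zero x⊆y i∈ = x⊆y i∈
drop-⊆ (suc m) {x = s ∷ x} {t ∷ y} x⊆y i∈ = drop-⊆ m (Subsetₚ.drop-∷-⊆ x⊆y) i∈

take-replicate : ∀ m n (b : Subset.Side) → take m (replicate (m + n) b) ≡ replicate m b
take-replicate zero n b = refl
take-replicate (suc m) n b = cong (b ∷_) (take-replicate m n b)

drop-replicate : ∀ m n (b : Subset.Side) → drop m (replicate (m + n) b) ≡ replicate n b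
drop-replicate zero n b = refl
drop-replicate (suc m) n b = drop-replicate m n b

block-⊆ : ∀ {r} (ns : Vec ℕ r) {x y} → x ⊆ y → ∀ i → block ns x i ⊆ block ns y i
block-⊆ (n ∷ ns) x⊆y zero = take-⊆ n x⊆y
block-⊆ (n ∷ ns) x⊆y (suc i) = block-⊆ ns (drop-⊆ n x⊆y) i

block-replicate : ∀ {r} (ns : Vec ℕ r) b i → block ns (replicate (total ns) b) i ≡ replicate (lookup ns i) b
block-replicate (n ∷ ns) b zero = take-replicate n (total ns) b
block-replicate (n ∷ ns) b (suc i) =
  trans (cong (λ x → block ns x i) (drop-replicate n (total ns) b)) (block-replicate ns b i)

block-ext : ∀ {r} (ns : Vec ℕ r) {x y} → (∀ i → block ns x i ≡ block ns y i) → x ≡ y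
block-ext [] {[]} {[]} _ = refl
block-ext (n ∷ ns) {x} {y} eq = trans (sym (Vecₚ.take++drop≡id n x))
  (trans (cong₂ _⧺_ (eq zero) (block-ext ns (eq ∘ suc))) (Vecₚ.take++drop≡id n y))

embed : ∀ {r} (ns : Vec ℕ r) → ((i : Fin r) → Chain (lookup ns i)) → Vec ℕ r → Subset (total ns)
embed [] A [] = []
embed (n ∷ ns) A (k ∷ v) = nth (A zero) k ⧺ embed ns (A ∘ suc) v

block-embed : ∀ {r} (ns : Vec ℕ r) A v i → block ns (embed ns A v) i ≡ nth (A i) (lookup v i)
block-embed (n ∷ ns) A (k ∷ v) zero = take-⧺ (nth (A zero) k) _
block-embed (n ∷ ns) A (k ∷ v) (suc i) =
  trans (cong (λ x → block ns x i) (drop-⧺ (nth (A zero) k) _)) (block-embed ns (A ∘ suc) v i)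

prod : ∀ {r} (ns : Vec ℕ r) → ((i : Fin r) → Chain (lookup ns i)) → Chain (total ns)
prod [] A = [ [] ]
prod (n ∷ ns) A = cartesianProductWith _⧺_ (A zero) (prod ns (A ∘ suc))

box : ∀ {r} → (Fin r → ℕ) → List (Vec ℕ r)
box {zero} ℓ = [ [] ]
box {suc r} ℓ = cartesianProductWith _∷_ (upTo (suc (ℓ zero))) (box (ℓ ∘ suc))

box-bounded : ∀ {r} (ℓ : Fin r → ℕ) {v} → v ∈ box ℓ → ∀ i → lookup v i ≤ ℓ i
box-bounded {suc r} ℓ v∈ i with ∈-cartesianProductWith⁻ _∷_ (upTo (suc (ℓ zero))) (box (ℓ ∘ suc)) v∈
box-bounded {suc r} ℓ v∈ zero | k , v , k∈ , _ , refl = ℕₚ.≤-pred (∈-upTo⁻ k∈)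
box-bounded {suc r} ℓ v∈ (suc i) | k , v , _ , v∈′ , refl = box-bounded (ℓ ∘ suc) v∈′ i

⊗-map : {A A′ B B′ C : Set} (f : A′ → B′ → C) (g : A → A′) (h : B → B′) → ∀ xs ys →
  cartesianProductWith f (map g xs) (map h ys) ≡ cartesianProductWith (λ x y → f (g x) (h y)) xs ys
⊗-map f g h [] ys = refl
⊗-map f g h (x ∷ xs) ys = cong₂ _++_ (sym (Listₚ.map-∘ ys)) (⊗-map f g h xs ys)

map-⊗ : {A B C D : Set} (k : C → D) (f : A → B → C) → ∀ xs ys →
  map k (cartesianProductWith f xs ys) ≡ cartesianProductWith (λ x y → k (f x y)) xs ys
map-⊗ k f [] ys = refl
map-⊗ k f (x ∷ xs) ys = trans (Listₚ.map-++ k (map (f x) ys) _)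
  (cong₂ _++_ (sym (Listₚ.map-∘ ys)) (map-⊗ k f xs ys))

embed-box : ∀ {r} (ns : Vec ℕ r) A (ℓ : Fin r → ℕ) → (∀ i → length (A i) ≡ suc (ℓ i)) →
  map (embed ns A) (box ℓ) ≡ prod ns A
embed-box [] A ℓ _ = refl
embed-box (n ∷ ns) A ℓ len = trans (map-⊗ (embed (n ∷ ns) A) _∷_ (upTo (suc (ℓ zero))) (box (ℓ ∘ suc)))
  (trans (sym (⊗-map _⧺_ (nth (A zero)) (embed ns (A ∘ suc)) (upTo (suc (ℓ zero))) (box (ℓ ∘ suc))))
    (cong₂ (cartesianProductWith _⧺_)
      (trans (cong (λ m → map (nth (A zero)) (upTo m)) (sym (len zero)))
        (trans (map-upTo (nth (A zero)) _) (trans (map-nth id (A zero)) (Listₚ.map-id (A zero)))))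
      (embed-box ns (A ∘ suc) (ℓ ∘ suc) (len ∘ suc))))

total-sum : ∀ {r} → (Fin r → ℕ) → ℕ
total-sum {r} f = ∑ (map f (allFin r))

allFin-suc : ∀ r → allFin (suc r) ≡ zero ∷ map suc (allFin r)
allFin-suc r = cong (zero ∷_) (sym (Listₚ.map-tabulate id suc))

total-sum-suc : ∀ {r} (f : Fin (suc r) → ℕ) → total-sum f ≡ f zero + total-sum (f ∘ suc)
total-sum-suc {r} f = trans (cong (∑ ∘ map f) (allFin-suc r)) (cong (λ l → f zero + ∑ l) (sym (Listₚ.map-∘ (allFin r))))

-- `box` recurses on the dimension, while `Π` folds over axes in one fixed space. Prefixing a zero
-- coordinate, in `shift-Π`, connects the two.
lines-box : ∀ r (ℓ : Fin r → ℕ) (Marked : Fin r → Set) →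
  Levels.Cuboid.Π r ℓ Marked (Levels.Cuboid.lines r ℓ Marked (allFin r)) ≡ box ℓ
lines-box zero ℓ Marked = refl
lines-box (suc r) ℓ Marked = trans (cong (L.Π ∘ L.lines) (allFin-suc r))
  (trans (cong (L._⊛_ (points₀ (ℓ zero))) (trans (shift-Π (allFin r)) (cong (map (0 ∷_)) (lines-box r (ℓ ∘ suc) (Marked ∘ suc)))))
    (trans (trans (cong (λ l → cartesianProductWith (zipWith _+_) l (map (0 ∷_) (box (ℓ ∘ suc))))
             (sym (map-upTo (λ y → y ∷ replicate r 0) (suc (ℓ zero)))))
             (⊗-map (zipWith _+_) (_∷ replicate r 0) (0 ∷_) (upTo (suc (ℓ zero))) (box (ℓ ∘ suc))))
      (cartesianProductWith-cong (λ y v → cong₂ _∷_ (+-identityʳ y) (L′.⊕-identityˡ v))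
        (upTo (suc (ℓ zero))) (box (ℓ ∘ suc)))))
  where
  module L where
    open Levels (suc r) public
    open Cuboid ℓ Marked public
  module L′ where
    open Levels r public
    open Cuboid (ℓ ∘ suc) (Marked ∘ suc) public
  points₀ : ℕ → List (Vec ℕ (suc r))
  points₀ n = applyUpTo (λ y → y ∷ replicate r 0) (suc n)
  shift-Π : ∀ is → L.Π (L.lines (map suc is)) ≡ map (0 ∷_) (L′.Π (L′.lines is))
  shift-Π [] = refl
  shift-Π (i ∷ is) = trans (cong₂ L._⊛_ (sym (Listₚ.map-applyUpTo (L′.single i) (0 ∷_) (suc (ℓ (suc i))))) (shift-Π is))
    (trans (⊗-map (zipWith _+_) (0 ∷_) (0 ∷_) (L′.points (L′.line i)) (L′.Π (L′.lines is)))
      (sym (map-⊗ (0 ∷_) (zipWith _+_) (L′.points (L′.line i)) (L′.Π (L′.lines is)))))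

-- Size and rank differ by a constant of the cuboid, so saturated paths become chains of consecutive
-- sizes.
∣embed∣ : ∀ {r} (ns : Vec ℕ r) A (j ℓ : Fin r → ℕ) → (∀ i {k} → k ≤ ℓ i → ∣ nth (A i) k ∣ ≡ j i + k) →
  ∀ v → (∀ i → lookup v i ≤ ℓ i) → ∣ embed ns A v ∣ ≡ total-sum j + rank v
∣embed∣ [] A j ℓ card [] _ = refl
∣embed∣ (n ∷ ns) A j ℓ card (k ∷ v) v≤ = trans (∣⧺∣ (nth (A zero) k) _)
  (trans (cong₂ _+_ (card zero (v≤ zero)) (∣embed∣ ns (A ∘ suc) (j ∘ suc) (ℓ ∘ suc) (card ∘ suc) v (v≤ ∘ suc)))
  (trans (interchange (j zero) k (total-sum (j ∘ suc)) (rank v)) (cong (_+ (k + rank v)) (sym (total-sum-suc j)))))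

embed-⊆ : ∀ {r} (ns : Vec ℕ r) A u v → (∀ i → nth (A i) (lookup u i) ⊆ nth (A i) (lookup v i)) →
  embed ns A u ⊆ embed ns A v
embed-⊆ [] A [] [] _ i∈ = i∈
embed-⊆ (n ∷ ns) A (k ∷ u) (k′ ∷ v) sub = ⧺-⊆ (sub zero) (embed-⊆ ns (A ∘ suc) u v (λ i → sub (suc i)))

total≡ : ∀ {r} (ns : Vec ℕ r) (j ℓ : Fin r → ℕ) → (∀ i → lookup ns i ≡ ℓ i + (j i + j i)) →
  total ns ≡ total-sum ℓ + (total-sum j + total-sum j)
total≡ [] j ℓ _ = refl
total≡ (n ∷ ns) j ℓ eq rewrite total-sum-suc j | total-sum-suc ℓ =
  trans (cong₂ _+_ (eq zero) (total≡ ns (j ∘ suc) (ℓ ∘ suc) (eq ∘ suc)))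
    (lem (ℓ zero) (j zero) (total-sum (ℓ ∘ suc)) (total-sum (j ∘ suc)))
  where
  lem : ∀ a b c d → a + (b + b) + (c + (d + d)) ≡ a + c + (b + d + (b + d))
  lem = solve-∀

-- Intersections of chains, and why every factor has `n ≥ 4`.

pluck : {A : Set} {x : A} {l : List A} → x ∈ l →
  Σ[ l′ ∈ List A ] (length l ≡ suc (length l′) × (∀ {z} → z ∈ l → z ≢ x → z ∈ l′))
pluck {l = x ∷ l} (here refl) = l , refl , λ { (here z≡x) z≢x → ⊥-elim (z≢x z≡x) ; (there z∈) _ → z∈ }
pluck {l = y ∷ l} (there x∈) with pluck x∈
... | l′ , len , sub = y ∷ l′ , cong suc len
  , λ { (here z≡y) _ → here z≡y ; (there z∈) z≢x → there (sub z∈ z≢x) }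

two-∈ : {A : Set} {x y : A} {l : List A} → x ∈ l → y ∈ l → y ≢ x → 2 ≤ length l
two-∈ x∈ y∈ y≢x with pluck x∈
... | l′ , len , sub with pluck (sub y∈ y≢x)
...   | _ , len′ , _ = subst (2 ≤_) (sym (trans len (cong suc len′))) (s≤s (s≤s z≤n))

three-∈ : {A : Set} {x y z : A} {l : List A} → x ∈ l → y ∈ l → z ∈ l → y ≢ x → z ≢ x → z ≢ y → 3 ≤ length l
three-∈ x∈ y∈ z∈ y≢x z≢x z≢y with pluck x∈
... | l′ , len , sub = subst (3 ≤_) (sym len) (s≤s (two-∈ (sub y∈ y≢x) (sub z∈ z≢x) z≢y))

∅≢𝟏 : ∀ {n} → 1 ≤ n → 𝟏 {n} ≢ ∅
∅≢𝟏 {n} 1≤n eq = <⇒≢ 1≤n (trans (sym (Subsetₚ.∣⊥∣≡0 n)) (trans (cong ∣_∣ (sym eq)) (Subsetₚ.∣⊤∣≡n n)))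

module _ {n : ℕ} where

  open import Data.List.Membership.DecPropositional (_≟ˢ_ {n}) using (_∈?_)

  Full? : (C : Chain n) → Dec (Full C)
  Full? C with ∅ ∈? C | 𝟏 ∈? C
  ... | yes b | yes t = yes (b , t)
  ... | no ¬b | _ = no (¬b ∘ proj₁)
  ... | yes _ | no ¬t = no (¬t ∘ proj₂)

  ∈-inter⁺ : ∀ {A B : Chain n} {x} → x ∈ A → x ∈ B → x ∈ inter A B
  ∈-inter⁺ {A} {B} = ∈-filter⁺ (_∈? B)

  ∈-inter⁻ : ∀ {A B : Chain n} {x} → x ∈ inter A B → x ∈ A × x ∈ B
  ∈-inter⁻ {A} {B} = ∈-filter⁻ (_∈? B)

  inter-unique : ∀ {A} B → Unique A → Unique (inter A B)
  inter-unique B = Uniqueₚ.filter⁺ (_∈? B)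

  AlmostOrthogonalChains : Chain n → Chain n → Set
  AlmostOrthogonalChains A B =
    ((Full A × Full B) → length (inter A B) ≡ 2) × (¬ (Full A × Full B) → length (inter A B) ≤ 1)

  -- Two common points force both chains to be full. The intersection then has exactly two members,
  -- and `∅` and `𝟏` already fill it.
  common-pair : ∀ {A B x y} → 1 ≤ n → AlmostOrthogonalChains A B → x ∈ A → x ∈ B → y ∈ A → y ∈ B →
    x ⊆ y → x ≡ y ⊎ (Full A × Full B × x ≡ ∅ × y ≡ 𝟏)
  common-pair {A} {B} {x} {y} 1≤n (two , one) x∈A x∈B y∈A y∈B x⊆y with x ≟ˢ y
  ... | yes x≡y = inj₁ x≡y
  ... | no x≢y with Full? A | Full? B
  ...   | no ¬f | _ = ⊥-elim (<-irrefl refl (≤-trans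
          (two-∈ (∈-inter⁺ x∈A x∈B) (∈-inter⁺ y∈A y∈B) (x≢y ∘ sym)) (one (¬f ∘ proj₁))))
  ...   | yes _ | no ¬f = ⊥-elim (<-irrefl refl (≤-trans
          (two-∈ (∈-inter⁺ x∈A x∈B) (∈-inter⁺ y∈A y∈B) (x≢y ∘ sym)) (one (¬f ∘ proj₂))))
  ...   | yes fA | yes fB = inj₂ (fA , fB , extremes (x ≟ˢ ∅) (x ≟ˢ 𝟏) (y ≟ˢ 𝟏))
    where
    third : ∀ {z} → z ∈ A → z ∈ B → z ≢ ∅ → z ≢ 𝟏 → ⊥
    third z∈A z∈B z≢∅ z≢𝟏 = <-irrefl refl (subst (3 ≤_) (two (fA , fB))
      (three-∈ (∈-inter⁺ (proj₁ fA) (proj₁ fB)) (∈-inter⁺ (proj₂ fA) (proj₂ fB)) (∈-inter⁺ z∈A z∈B)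
        (∅≢𝟏 1≤n) z≢∅ z≢𝟏))
    extremes : Dec (x ≡ ∅) → Dec (x ≡ 𝟏) → Dec (y ≡ 𝟏) → x ≡ ∅ × y ≡ 𝟏
    extremes (yes x≡∅) _ (yes y≡𝟏) = x≡∅ , y≡𝟏
    extremes (yes refl) _ (no y≢𝟏) = ⊥-elim (third y∈A y∈B (x≢y ∘ sym) y≢𝟏)
    extremes (no x≢∅) (no x≢𝟏) _ = ⊥-elim (third x∈A x∈B x≢∅ x≢𝟏)
    extremes (no _) (yes refl) _ = ⊥-elim (x≢y (Subsetₚ.⊆-antisym x⊆y Subsetₚ.⊆⊤))

  symmetric⇒unique : ∀ {C} → IsSymmetricChain n C → Unique C
  symmetric⇒unique {C} (j , _ , cards , _) = AllPairs.map (λ neq eq → neq (cong ∣_∣ eq))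
    (AllPairsₚ.map⁻ (subst Unique (sym cards) (Uniqueₚ.map⁺ (+-cancelˡ-≡ j _ _) (Uniqueₚ.upTo⁺ _))))

  -- Members of a chain are comparable, so common pairs `x ⊆ y` determine the size of the whole
  -- intersection.
  almost-orthogonal : ∀ {G G′} → 1 ≤ n → IsSymmetricChain n G →
    (∀ x y → x ∈ G → x ∈ G′ → y ∈ G → y ∈ G′ → x ⊆ y → x ≡ y ⊎ (x ≡ ∅ × y ≡ 𝟏)) →
    AlmostOrthogonalChains G G′
  almost-orthogonal {G} {G′} 1≤n sc@(_ , _ , _ , linked) key =
    (λ (fG , fG′) → exactly-two fG fG′ (inter G G′) (symmetric⇒inter) ∈-inter⁻ ∈-inter⁺)
    , λ ¬full → at-most-one ¬full (inter G G′) symmetric⇒inter ∈-inter⁻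
    where
    symmetric⇒inter : Unique (inter G G′)
    symmetric⇒inter = inter-unique G′ (symmetric⇒unique sc)
    sorted = chain-sorted linked

    at-most-one : ¬ (Full G × Full G′) → ∀ l → Unique l → (∀ {x} → x ∈ l → x ∈ G × x ∈ G′) → length l ≤ 1
    at-most-one ¬full [] _ _ = z≤n
    at-most-one ¬full (x ∷ []) _ _ = s≤s z≤n
    at-most-one ¬full (x ∷ y ∷ l) ((x≢y ∷ _) ∷ _) sub
      with sub (here refl) | sub (there (here refl))
    ... | x∈G , x∈G′ | y∈G , y∈G′ with comparable sorted x∈G y∈G
    ...   | inj₁ x⊆y with key x y x∈G x∈G′ y∈G y∈G′ x⊆y
    ...     | inj₁ x≡y = ⊥-elim (x≢y x≡y)
    ...     | inj₂ (refl , refl) = ⊥-elim (¬full ((x∈G , y∈G) , (x∈G′ , y∈G′)))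
    at-most-one ¬full (x ∷ y ∷ l) ((x≢y ∷ _) ∷ _) sub | x∈G , x∈G′ | y∈G , y∈G′ | inj₂ y⊆x
      with key y x y∈G y∈G′ x∈G x∈G′ y⊆x
    ...     | inj₁ y≡x = ⊥-elim (x≢y (sym y≡x))
    ...     | inj₂ (refl , refl) = ⊥-elim (¬full ((y∈G , x∈G) , (y∈G′ , x∈G′)))

    exactly-two : Full G → Full G′ → ∀ l → Unique l → (∀ {x} → x ∈ l → x ∈ G × x ∈ G′) →
      (∀ {x} → x ∈ G → x ∈ G′ → x ∈ l) → length l ≡ 2
    exactly-two (b , t) (b′ , t′) l uniq sub sup = ℕₚ.≤-antisym (at-most-two l uniq extreme)
      (two-∈ (sup b b′) (sup t t′) (∅≢𝟏 1≤n))
      where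
      extreme : ∀ {x} → x ∈ l → x ≡ ∅ ⊎ x ≡ 𝟏
      extreme {x} x∈ with key ∅ x b b′ (proj₁ (sub x∈)) (proj₂ (sub x∈)) Subsetₚ.⊥⊆
      ... | inj₁ ∅≡x = inj₁ (sym ∅≡x)
      ... | inj₂ (_ , x≡𝟏) = inj₂ x≡𝟏
      at-most-two : ∀ l → Unique l → (∀ {x} → x ∈ l → x ≡ ∅ ⊎ x ≡ 𝟏) → length l ≤ 2
      at-most-two [] _ _ = z≤n
      at-most-two (x ∷ []) _ _ = s≤s z≤n
      at-most-two (x ∷ y ∷ []) _ _ = s≤s (s≤s z≤n)
      at-most-two (x ∷ y ∷ z ∷ l) ((x≢y ∷ x≢z ∷ _) ∷ (y≢z ∷ _) ∷ _) ext
        with ext (here refl) | ext (there (here refl)) | ext (there (there (here refl)))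
      ... | inj₁ refl | inj₁ refl | _ = ⊥-elim (x≢y refl)
      ... | inj₂ refl | inj₂ refl | _ = ⊥-elim (x≢y refl)
      ... | inj₁ refl | inj₂ refl | inj₁ refl = ⊥-elim (x≢z refl)
      ... | inj₁ refl | inj₂ refl | inj₂ refl = ⊥-elim (y≢z refl)
      ... | inj₂ refl | inj₁ refl | inj₁ refl = ⊥-elim (y≢z refl)
      ... | inj₂ refl | inj₁ refl | inj₂ refl = ⊥-elim (x≢z refl)

  symmetric-card : ∀ {C} (sc : IsSymmetricChain n C) {x} → x ∈ C →
    proj₁ sc ≤ ∣ x ∣ × ∣ x ∣ + proj₁ sc ≤ n
  symmetric-card {C} (j , le , cards , _) {x} x∈ with ∈-map⁻ (j +_) (subst (∣ x ∣ ∈_) cards (∈-map⁺ ∣_∣ x∈))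
  ... | k , k∈ , eq = subst (j ≤_) (sym eq) (m≤m+n j k)
    , subst (λ m → m + j ≤ n) (sym eq) (≤-trans (≤-reflexive (lem j k))
        (≤-trans (+-monoˡ-≤ (j + j) (ℕₚ.≤-pred (∈-upTo⁻ k∈))) (≤-reflexive (ℕₚ.m∸n+n≡m le))))
    where
    lem : ∀ j k → j + k + j ≡ k + (j + j)
    lem = solve-∀

  of-card : ∀ {C} (sc : IsSymmetricChain n C) m → proj₁ sc ≤ m → m + proj₁ sc ≤ n →
    Σ[ y ∈ Subset n ] (y ∈ C × ∣ y ∣ ≡ m)
  of-card {C} (j , le , cards , _) m j≤m m+j≤n
    with ∈-map⁻ ∣_∣ (subst (m ∈_) (sym cards) (subst (_∈ map (j +_) (upTo (suc (n ∸ (j + j))))) (ℕₚ.m+[n∸m]≡n j≤m)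
           (∈-map⁺ (j +_) (∈-upTo⁺ (s≤s (ℕₚ.+-cancelʳ-≤ (j + j) _ _ bound))))))
    where
    lem : ∀ j k → k + (j + j) ≡ j + k + j
    lem = solve-∀
    bound : m ∸ j + (j + j) ≤ n ∸ (j + j) + (j + j)
    bound = subst₂ _≤_ (sym (trans (lem j (m ∸ j)) (cong (_+ j) (ℕₚ.m+[n∸m]≡n j≤m)))) (sym (ℕₚ.m∸n+n≡m le)) m+j≤n
  ... | y , y∈ , eq = y , y∈ , sym eq

  -- The chain through `x` starts at a size `j ≤ ∣ x ∣` and so reaches size `n ∸ j`, which lies
  -- above `∣ x ∣` by the bound.
  up-neighbour : ∀ {F} → IsSCD n F → ∀ x → ∣ x ∣ + suc ∣ x ∣ ≤ n →
    Σ[ C ∈ Chain n ] Σ[ y ∈ Subset n ] (C ∈ F × x ∈ C × y ∈ C × x ⊆ y × ∣ y ∣ ≡ suc ∣ x ∣)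
  up-neighbour {F} (sym-F , _ , covers) x small with ∈-concat⁻′ F (covers x)
  ... | C , x∈C , C∈F with symmetric-card (sym-F C C∈F) x∈C
  ...   | j≤x , _ with of-card (sym-F C C∈F) (suc ∣ x ∣) (≤-trans j≤x (n≤1+n _))
            (≤-trans (≤-reflexive (+-comm (suc ∣ x ∣) _)) (≤-trans (+-monoˡ-≤ (suc ∣ x ∣) j≤x) small))
  ...     | y , y∈C , ∣y∣≡ with comparable (chain-sorted (proj₂ (proj₂ (proj₂ (sym-F C C∈F))))) x∈C y∈C
  ...       | inj₁ x⊆y = C , y , C∈F , x∈C , y∈C , (λ {i} → x⊆y {i}) , ∣y∣≡
  ...       | inj₂ y⊆x = ⊥-elim (<-irrefl refl (≤-trans (≤-reflexive (sym ∣y∣≡)) (Subsetₚ.p⊆q⇒∣p∣≤∣q∣ y⊆x)))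

  -- Three families continue from `x` to upper covers, of which there are only two. Two families
  -- that agree share `x` and a cover of it, against almost orthogonality.
  no-three : ∀ {k} → 3 ≤ k → 2 ≤ n → (F : Fin k → List (Chain n)) → (∀ j → IsSCD n (F j)) →
    PairwiseAlmostOrthogonal n k F → (x y₁ y₂ : Subset n) → ∣ x ∣ + suc ∣ x ∣ ≤ n →
    (∀ y → x ⊆ y → ∣ y ∣ ≡ suc ∣ x ∣ → y ≡ y₁ ⊎ y ≡ y₂) → ⊥
  no-three {suc (suc (suc k))} (s≤s (s≤s (s≤s _))) 2≤n F scd ao x y₁ y₂ small options = pigeonhole
    (which zero) (which (suc zero)) (which (suc (suc zero)))
    where
    clash : ∀ {i j y y′} → i ≢ j → y ≡ y′ →
      Σ[ C ∈ Chain n ] (C ∈ F i × x ∈ C × y ∈ C × x ⊆ y × ∣ y ∣ ≡ suc ∣ x ∣) →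
      Σ[ C ∈ Chain n ] (C ∈ F j × x ∈ C × y′ ∈ C × x ⊆ y′ × ∣ y′ ∣ ≡ suc ∣ x ∣) → ⊥
    clash {i} {j} i≢j refl (C , C∈ , x∈C , y∈C , x⊆y , ∣y∣≡) (D , D∈ , x∈D , y∈D , _ , _)
      with common-pair (≤-trans (n≤1+n 1) 2≤n) (ao i j i≢j C D C∈ D∈) x∈C x∈D y∈C y∈D (λ {e} → x⊆y {e})
    ... | inj₁ refl = ℕₚ.1+n≢n (sym ∣y∣≡)
    ... | inj₂ (_ , _ , refl , refl) = <⇒≢ 2≤n (sym (trans (sym (Subsetₚ.∣⊤∣≡n n)) (trans ∣y∣≡ (cong suc (Subsetₚ.∣⊥∣≡0 n)))))
    Neighbour : Fin (3 + k) → Subset n → Set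
    Neighbour j y = Σ[ C ∈ Chain n ] (C ∈ F j × x ∈ C × y ∈ C × x ⊆ y × ∣ y ∣ ≡ suc ∣ x ∣)
    classify : ∀ {j y} → Neighbour j y → y ≡ y₁ ⊎ y ≡ y₂ → Neighbour j y₁ ⊎ Neighbour j y₂
    classify nb (inj₁ refl) = inj₁ nb
    classify nb (inj₂ refl) = inj₂ nb
    which : ∀ j → Neighbour j y₁ ⊎ Neighbour j y₂
    which j =
      let C , y , C∈ , x∈ , y∈ , x⊆y , ∣y∣≡ = up-neighbour (scd j) x small
      in classify (C , C∈ , x∈ , y∈ , x⊆y , ∣y∣≡) (options y x⊆y ∣y∣≡)
    pigeonhole : Neighbour zero y₁ ⊎ Neighbour zero y₂ → Neighbour (suc zero) y₁ ⊎ Neighbour (suc zero) y₂ →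
      Neighbour (suc (suc zero)) y₁ ⊎ Neighbour (suc (suc zero)) y₂ → ⊥
    pigeonhole (inj₁ a) (inj₁ b) _ = clash (λ ()) refl a b
    pigeonhole (inj₂ a) (inj₂ b) _ = clash (λ ()) refl a b
    pigeonhole (inj₁ a) (inj₂ b) (inj₁ c) = clash (λ ()) refl a c
    pigeonhole (inj₁ a) (inj₂ b) (inj₂ c) = clash (λ ()) refl b c
    pigeonhole (inj₂ a) (inj₁ b) (inj₁ c) = clash (λ ()) refl b c
    pigeonhole (inj₂ a) (inj₁ b) (inj₂ c) = clash (λ ()) refl a c

at-least-four : ∀ {n k} → 3 ≤ k → 2 ≤ n → (F : Fin k → List (Chain n)) → (∀ j → IsSCD n (F j)) →
  PairwiseAlmostOrthogonal n k F → 4 ≤ n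
at-least-four {suc (suc (suc (suc n)))} _ _ _ _ _ = s≤s (s≤s (s≤s (s≤s z≤n)))
at-least-four {2} 3≤k 2≤n F scd ao = ⊥-elim (no-three 3≤k 2≤n F scd ao ∅
  (true ∷ false ∷ []) (false ∷ true ∷ []) (s≤s z≤n)
  λ { (true ∷ false ∷ []) _ _ → inj₁ refl ; (false ∷ true ∷ []) _ _ → inj₂ refl
    ; (true ∷ true ∷ []) _ () ; (false ∷ false ∷ []) _ () })
-- In dimension three `∅` has three covers, but a singleton has only two.
at-least-four {3} 3≤k 2≤n F scd ao = ⊥-elim (no-three 3≤k 2≤n F scd ao (true ∷ false ∷ false ∷ [])
  (true ∷ true ∷ false ∷ []) (true ∷ false ∷ true ∷ []) ≤-refl
  λ { (true ∷ true ∷ false ∷ []) _ _ → inj₁ refl ; (true ∷ false ∷ true ∷ []) _ _ → inj₂ refl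
    ; (true ∷ true ∷ true ∷ []) _ () ; (true ∷ false ∷ false ∷ []) _ ()
    ; (false ∷ _) x⊆y _ → ⊥-elim (¬here (x⊆y here)) })
  where
  ¬here : ∀ {m} {p : Subset m} → ¬ (zero Subset.∈ false ∷ p)
  ¬here ()
at-least-four {0} _ () _ _ _
at-least-four {1} _ (s≤s ()) _ _ _

even-double : ∀ j → Even (j + j)
even-double j = trans (cong (_% 2) (lem j)) ([m+kn]%n≡m%n 0 j 2)
  where
  lem : ∀ j → j + j ≡ j * 2
  lem = solve-∀

odd-double : ∀ j → Odd (1 + (j + j))
odd-double j = trans (cong (λ m → (1 + m) % 2) (lem j)) ([m+kn]%n≡m%n 1 j 2)
  where
  lem : ∀ j → j + j ≡ j * 2
  lem = solve-∀

even⇒¬odd : ∀ {n} → Even n → ¬ Odd n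
even⇒¬odd even odd with trans (sym even) odd
... | ()

-- Transporting a decomposition of position vectors to a cuboid.

module Transport {r : ℕ} (ns : Vec ℕ r) (A : (i : Fin r) → Chain (lookup ns i))
                 (symm : ∀ i → IsSymmetricChain (lookup ns i) (A i)) where

  j ℓ : Fin r → ℕ
  j i = proj₁ (symm i)
  ℓ i = lookup ns i ∸ (j i + j i)

  -- A decidable form of fullness: a symmetric chain that starts at size zero also ends at the top.
  Marked : Fin r → Set
  Marked i = j i ≡ 0

  open Levels r public
  open Cuboid ℓ Marked public

  n≡ : ∀ i → lookup ns i ≡ ℓ i + (j i + j i)
  n≡ i = sym (ℕₚ.m∸n+n≡m (proj₁ (proj₂ (symm i))))

  cards : ∀ i → map ∣_∣ (A i) ≡ applyUpTo (j i +_) (suc (ℓ i))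
  cards i = trans (proj₁ (proj₂ (proj₂ (symm i)))) (map-upTo (j i +_) (suc (ℓ i)))

  len : ∀ i → length (A i) ≡ suc (ℓ i)
  len i = trans (sym (Listₚ.length-map ∣_∣ (A i)))
    (trans (cong length (cards i)) (Listₚ.length-applyUpTo (j i +_) (suc (ℓ i))))

  card : ∀ i {k} → k ≤ ℓ i → ∣ nth (A i) k ∣ ≡ j i + k
  card i k≤ℓ = nth-map ∣_∣ (A i) (j i +_) (suc (ℓ i)) (cards i) (s≤s k≤ℓ)

  in-chain : ∀ i {k} → k ≤ ℓ i → nth (A i) k ∈ A i
  in-chain i k≤ℓ = nth∈ (A i) (subst (_ <_) (sym (len i)) (s≤s k≤ℓ))

  mono : ∀ i {k k′} → k ≤ k′ → k′ ≤ ℓ i → nth (A i) k ⊆ nth (A i) k′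
  mono i k≤ k′≤ = nth-mono (chain-sorted (proj₂ (proj₂ (proj₂ (symm i))))) k≤
    (subst (_ <_) (sym (len i)) (s≤s k′≤))

  full⇒marked : ∀ {i} → Full (A i) → Marked i
  full⇒marked {i} (∅∈ , _) = ℕₚ.n≤0⇒n≡0 (subst (j i ≤_) (Subsetₚ.∣⊥∣≡0 (lookup ns i)) (proj₁ (symmetric-card (symm i) ∅∈)))

  marked⇒ℓ≡n : ∀ {i} → Marked i → ℓ i ≡ lookup ns i
  marked⇒ℓ≡n {i} m = cong (λ z → lookup ns i ∸ (z + z)) m

  ℓ≡0⇒even : ∀ {i} → ℓ i ≡ 0 → Even (lookup ns i)
  ℓ≡0⇒even {i} ℓ≡0 = subst Even (sym (trans (n≡ i) (cong (_+ (j i + j i)) ℓ≡0))) (even-double (j i))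

  ℓ≡1⇒odd : ∀ {i} → ℓ i ≡ 1 → Odd (lookup ns i)
  ℓ≡1⇒odd {i} ℓ≡1 = subst Odd (sym (trans (n≡ i) (cong (_+ (j i + j i)) ℓ≡1))) (odd-double (j i))

  odd⇒ℓ≡1 : ∀ {i} → Odd (lookup ns i) → ℓ i ≤ 1 → ℓ i ≡ 1
  odd⇒ℓ≡1 {i} odd ℓ≤1 = at-most-one (ℓ i) refl ℓ≤1
    where
    at-most-one : ∀ m → ℓ i ≡ m → m ≤ 1 → ℓ i ≡ 1
    at-most-one zero eq _ = ⊥-elim (even⇒¬odd {lookup ns i} (ℓ≡0⇒even eq) odd)
    at-most-one (suc zero) eq _ = eq
    at-most-one (suc (suc _)) _ (s≤s ())

  Bounded : V → Set
  Bounded v = ∀ i → lookup v i ≤ ℓ i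

  mids-lines : mids (lines (allFin r)) ≡ total-sum ℓ
  mids-lines = cong ∑ (trans (sym (Listₚ.map-∘ (allFin r))) (Listₚ.map-cong mid-line (allFin r)))
    where
    mid-line : ∀ i → mid (line i) ≡ ℓ i
    mid-line i = cong₂ _+_ (rank-single i 0) (rank-single i (ℓ i))

  place : V → Subset (total ns)
  place = embed ns A

  block-place : ∀ v i → block ns (place v) i ≡ nth (A i) (lookup v i)
  block-place = block-embed ns A

  place-linked : ∀ {u w l} → Path u w l → (∀ {v} → v ∈ l → Bounded v) → Linked _⊆_ (map place l)
  place-linked (end v) _ = [-]
  place-linked (s ∷ p) bounded = prepend s p (bounded (there (bot∈ p))) (place-linked p (bounded ∘ there))
    where
    prepend : ∀ {u v w l} → u ⋖ v → Path v w l → Bounded v → Linked _⊆_ (map place l) →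
      Linked _⊆_ (place u ∷ map place l)
    prepend {u} {v} s (end _) bnd linked =
      embed-⊆ ns A u v (λ i → mono i (⋖⇒≼ s i) (bnd i)) ∷ linked
    prepend {u} {v} s (_ ∷ _) bnd linked =
      embed-⊆ ns A u v (λ i → mono i (⋖⇒≼ s i) (bnd i)) ∷ linked

  -- Saturation gives consecutive sizes from `b` on, and the value of `mid` makes them stop at
  -- `total ns ∸ b`.
  place-symmetric : ∀ C → mid C ≡ mids (lines (allFin r)) → (∀ {v} → v ∈ points C → Bounded v) →
    IsSymmetricChain (total ns) (map place (points C))
  place-symmetric C mid≡ bounded =
    b , subst (b + b ≤_) (sym total≡d+b+b) (m≤n+m (b + b) d)
    , trans ranks (cong (λ m → map (b +_) (upTo (suc m)))
        (sym (trans (cong (_∸ (b + b)) total≡d+b+b) (ℕₚ.m+n∸n≡m d (b + b)))))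
    , place-linked (path C) bounded
    where
    J = total-sum j
    d = proj₁ (path-ranks (path C))
    top≡ = proj₁ (proj₂ (path-ranks (path C)))
    b = J + rank (bot C)
    lem : ∀ x d J → x + (x + d) + (J + J) ≡ d + (J + x + (J + x))
    lem = solve-∀
    total≡d+b+b : total ns ≡ d + (b + b)
    total≡d+b+b = trans (total≡ ns j ℓ n≡) (trans (cong (_+ (J + J)) (trans (sym mids-lines)
      (trans (sym mid≡) (cong (rank (bot C) +_) top≡)))) (lem (rank (bot C)) d J))
    ranks : map ∣_∣ (map place (points C)) ≡ map (b +_) (upTo (suc d))
    ranks = begin
      map ∣_∣ (map place (points C))             ≡⟨ Listₚ.map-∘ (points C) ⟨
      map (∣_∣ ∘ place) (points C)               ≡⟨ Listₚ.map-cong-local (All.tabulate λ {v} v∈ → ∣embed∣ ns A j ℓ card v (bounded v∈)) ⟩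
      map (λ v → J + rank v) (points C)          ≡⟨ Listₚ.map-∘ (points C) ⟩
      map (J +_) (map rank (points C))           ≡⟨ cong (map (J +_)) (proj₂ (proj₂ (path-ranks (path C)))) ⟩
      map (J +_) (applyUpTo (rank (bot C) +_) (suc d)) ≡⟨ Listₚ.map-applyUpTo (rank (bot C) +_) (J +_) (suc d) ⟩
      applyUpTo (λ k → J + (rank (bot C) + k)) (suc d) ≡⟨ applyUpTo-cong (λ k → sym (+-assoc J (rank (bot C)) k)) (suc d) ⟩
      applyUpTo (b +_) (suc d)                   ≡⟨ map-upTo (b +_) (suc d) ⟨
      map (b +_) (upTo (suc d))                  ∎
      where open ≡-Reasoning

  module _ {Φ} (d : Decomposition Φ (lines (allFin r))) where
    open Decomposition d

    chain-bounded : ∀ {C} → C ∈ chains → ∀ {v} → v ∈ points C → Bounded v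
    chain-bounded C∈ v∈ = box-bounded ℓ (subst (_ ∈_) (lines-box r ℓ Marked) (∈-resp-↭ partition (∈-bag C∈ v∈)))

    placed : List (Chain (total ns))
    placed = map (map place ∘ points) chains

    placed-prod : concat placed ↭ prod ns A
    placed-prod = ↭-trans (↭-reflexive (trans (cong concat (Listₚ.map-∘ chains)) (Listₚ.concat-map (map points chains))))
      (↭-trans (map⁺ place partition)
        (↭-reflexive (trans (cong (map place) (lines-box r ℓ Marked)) (embed-box ns A ℓ len))))

    placed-symmetric : ∀ G → G ∈ placed → IsSymmetricChain (total ns) G
    placed-symmetric G G∈ = unpack (∈-map⁻ (map place ∘ points) G∈)
      where
      unpack : (Σ[ C ∈ Saturated ] (C ∈ chains × G ≡ map place (points C))) → IsSymmetricChain (total ns) G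
      unpack (C , C∈ , refl) = place-symmetric C (All.lookup symmetric C∈) (chain-bounded C∈)

  placed-block : ∀ {v} → Bounded v → ∀ i → block ns (place v) i ∈ A i
  placed-block {v} bounded i = subst (_∈ A i) (sym (block-place v i)) (in-chain i (bounded i))

-- Enumerating the cuboids of a family.

cons : ∀ {r} {X : Fin (suc r) → Set} → X zero → (∀ i → X (suc i)) → ∀ i → X i
cons x f zero = x
cons x f (suc i) = f i

choices : ∀ {r} {X : Fin r → Set} → (∀ i → List (X i)) → List (∀ i → X i)
choices {zero} L = [ (λ ()) ]
choices {suc r} {X} L = cartesianProductWith (cons {X = X}) (L zero) (choices (L ∘ suc))

concat-⊗ : {A B C D : Set} (f : A → B → C) (xs : List A) (p : D → List B) (ds : List D) →
  concat (map (λ d → cartesianProductWith f xs (p d)) ds) ↭ cartesianProductWith f xs (concat (map p ds))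
concat-⊗ f xs p [] = ↭-reflexive (sym (Listₚ.cartesianProductWith-zeroʳ f xs))
concat-⊗ f xs p (d ∷ ds) = ↭-trans (++⁺ˡ _ (concat-⊗ f xs p ds)) (↭-sym (⊗-++ʳ f xs (p d) (concat (map p ds))))

-- Distributivity of products over unions. The evidence `Q` travels along so that a cuboid remembers
-- which families its factors belong to.
prod-choices : ∀ {r} (ns : Vec ℕ r) {Q : ∀ i → Chain (lookup ns i) → Set} →
  (L : ∀ i → List (Σ (Chain (lookup ns i)) (Q i))) →
  concat (map (λ a → prod ns (λ i → proj₁ (a i))) (choices L)) ↭ prod ns (λ i → concat (map proj₁ (L i)))
prod-choices [] L = ↭-refl
prod-choices (n ∷ ns) {Q} L = go (L zero)
  where
  rest = choices (L ∘ suc)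
  P = concat (map (λ a → prod ns (λ i → proj₁ (a i))) rest)
  R = prod ns (λ i → concat (map proj₁ (L (suc i))))
  go : ∀ xs → concat (map (λ a → prod (n ∷ ns) (λ i → proj₁ (a i))) (cartesianProductWith (cons {X = λ i → Σ _ (Q i)}) xs rest))
    ↭ cartesianProductWith _⧺_ (concat (map proj₁ xs)) R
  go [] = ↭-refl
  go (x ∷ xs) = ↭-trans (↭-reflexive (trans (cong concat (Listₚ.map-++ g (map (cons x) rest) _))
      (sym (Listₚ.concat-++ (map g (map (cons x) rest)) _))))
    (↭-trans (++⁺ (↭-trans (↭-reflexive (cong concat (sym (Listₚ.map-∘ rest))))
        (↭-trans (concat-⊗ _⧺_ (proj₁ x) (λ a → prod ns (λ i → proj₁ (a i))) rest)
          (⊗-congʳ _⧺_ (proj₁ x) (prod-choices ns (L ∘ suc))))) (go xs))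
      (↭-reflexive (sym (Listₚ.cartesianProductWith-distribʳ-++ _⧺_ (proj₁ x) (concat (map proj₁ xs)) R))))
    where
    g : (∀ i → Σ (Chain (lookup (n ∷ ns) i)) (Q i)) → Chain (total (n ∷ ns))
    g a = prod (n ∷ ns) (λ i → proj₁ (a i))

prod-unique : ∀ {r} (ns : Vec ℕ r) A → (∀ i → Unique (A i)) → Unique (prod ns A)
prod-unique [] A uniq = [] ∷ []
prod-unique (n ∷ ns) A uniq = Uniqueₚ.cartesianProductWith⁺ _⧺_ (λ {w} {x} → Vecₚ.++-injective w x)
  (uniq zero) (prod-unique ns (A ∘ suc) (uniq ∘ suc))

prod-∈ : ∀ {r} (ns : Vec ℕ r) A x → (∀ i → block ns x i ∈ A i) → x ∈ prod ns A
prod-∈ [] A [] _ = here refl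
prod-∈ (n ∷ ns) A x blocks = subst (_∈ prod (n ∷ ns) A) (Vecₚ.take++drop≡id n x)
  (∈-cartesianProductWith⁺ _⧺_ (blocks zero) (prod-∈ ns (A ∘ suc) (drop n x) (blocks ∘ suc)))

concatMap-∈⁻ : {A B : Set} {f : A → List B} {xs : List A} {y : B} → y ∈ concatMap f xs → Σ[ x ∈ A ] y ∈ f x
concatMap-∈⁻ {f = f} {xs} y∈ with ∈-concat⁻′ (map f xs) y∈
... | _ , y∈ys , ys∈ with ∈-map⁻ f ys∈
...   | x , _ , refl = x , y∈ys

tagged : {A : Set} (xs : List A) → List (Σ A (_∈ xs))
tagged xs = mapWith∈ xs (λ {x} x∈ → x , x∈)

map-proj₁-tagged : {A : Set} (xs : List A) → map proj₁ (tagged xs) ≡ xs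
map-proj₁-tagged xs = trans (map-mapWith∈ xs _ proj₁) (mapWith∈-id xs)

-- Assembling the decompositions and comparing two cuboids.

module Product {k r : ℕ} (ns : Vec ℕ r) (4≤ns : ∀ i → 4 ≤ lookup ns i)
  (F : (i : Fin r) → Fin k → List (Chain (lookup ns i)))
  (scd : ∀ i j → IsSCD (lookup ns i) (F i j))
  (ao : ∀ i → PairwiseAlmostOrthogonal (lookup ns i) k (F i))
  (good-even : ∀ i → Even (lookup ns i) → GoodEven (lookup ns i) k (F i))
  -- The choice depends on `s` alone, so cuboids of different families consult the same factor. In
  -- the first alternative no factor other than `s` can contain a 2-element chain.
  (σ : ∀ s → Σ[ c ∈ Fin r ] ((c ≡ s × (∀ t → t ≢ s → ¬ Odd (lookup ns t)))
                            ⊎ (c ≢ s × Odd (lookup ns c) × GoodOdd (lookup ns c) k (F c)))) where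

  partner : Fin r → Fin r
  partner s = proj₁ (σ s)

  tail : ∀ s → Chain (lookup ns (partner s)) → Subset (lookup ns (partner s))
  tail s with proj₂ (σ s)
  -- A dummy: here the partner is `s` itself, and properties of `tail` are claimed only for partners
  -- other than `s`.
  ... | inj₁ _ = λ _ → ∅
  ... | inj₂ (_ , _ , o , _) = o

  partner-odd : ∀ s t → t ≢ s → Odd (lookup ns t) → partner s ≢ s × Odd (lookup ns (partner s))
  partner-odd s t t≢s odd with proj₂ (σ s)
  ... | inj₁ (_ , none) = ⊥-elim (none t t≢s odd)
  ... | inj₂ (c≢s , odd-c , _) = c≢s , odd-c

  tail-∈ : ∀ s → partner s ≢ s → ∀ j C → C ∈ F (partner s) j → length C ≡ 2 → tail s C ∈ C
  tail-∈ s c≢s with proj₂ (σ s)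
  ... | inj₁ (c≡s , _) = ⊥-elim (c≢s c≡s)
  ... | inj₂ (_ , _ , _ , o∈ , _) = o∈

  tail-injective : ∀ s → partner s ≢ s → ∀ j j′ C C′ → C ∈ F (partner s) j → C′ ∈ F (partner s) j′ →
    length C ≡ 2 → length C′ ≡ 2 → tail s C ≡ tail s C′ → C ≡ C′
  tail-injective s c≢s with proj₂ (σ s)
  ... | inj₁ (c≡s , _) = ⊥-elim (c≢s c≡s)
  ... | inj₂ (_ , _ , _ , _ , o-inj) = o-inj

  Cube : Fin k → Set
  Cube j = ∀ i → Σ (Chain (lookup ns i)) (_∈ F i j)

  index-of : ∀ {P : Set} → Dec P → ℕ
  index-of (yes _) = 0
  index-of (no _) = 1

  module At {j : Fin k} (a : Cube j) where

    A : ∀ i → Chain (lookup ns i)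
    A i = proj₁ (a i)

    open Transport ns A (λ i → proj₁ (scd i j) (A i) (proj₂ (a i))) public renaming (j to offset)

    value : Fin r → ℕ
    value s = index-of (tail s (A (partner s)) ≟ˢ nth (A (partner s)) 0)

    value≤1 : ∀ s → value s ≤ 1
    value≤1 s with tail s (A (partner s)) ≟ˢ nth (A (partner s)) 0
    ... | yes _ = z≤n
    ... | no _ = s≤s z≤n

    -- A 2-element chain at `t` makes its dimension odd, so a genuine partner exists. In odd
    -- dimension symmetric chains have an even number of points, so at most two means exactly two.
    partner-ok : ∀ s t → t ≢ s → ℓ t ≡ 1 → (∀ i → i ≢ s → ℓ i ≤ 1) → partner s ≢ s × ℓ (partner s) ≡ 1
    partner-ok s t t≢s ℓt≡1 short =
      let c≢s , odd = partner-odd s t t≢s (ℓ≡1⇒odd ℓt≡1) in c≢s , odd⇒ℓ≡1 odd (short _ c≢s)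

    Marked? : ∀ i → Dec (Marked i)
    Marked? i = offset i ℕₚ.≟ 0

    long-marked : ∀ i → Marked i → 4 ≤ ℓ i
    long-marked i m = subst (4 ≤_) (sym (marked⇒ℓ≡n m)) (4≤ns i)

    open Decompose Marked? long-marked partner value value≤1 partner-ok public

    chains : List (Chain (total ns))
    chains = placed cuboid

    tail-at : ∀ s → partner s ≢ s → ℓ (partner s) ≡ 1 → nth (A (partner s)) (value s) ≡ tail s (A (partner s))
    tail-at s c≢s ℓ≡1 = locate (tail s C ≟ˢ nth C 0)
        (∈⇒nth (tail-∈ s c≢s j C (proj₂ (a (partner s))) (trans (len _) (cong suc ℓ≡1))))
      where
      C = A (partner s)
      locate : (eq? : Dec (tail s C ≡ nth C 0)) → (Σ[ m ∈ ℕ ] (m < length C × tail s C ≡ nth C m)) →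
        nth C (index-of eq?) ≡ tail s C
      locate (yes eq) _ = sym eq
      locate (no neq) (zero , _ , eq) = ⊥-elim (neq eq)
      locate (no neq) (suc zero , _ , eq) = sym eq
      locate (no neq) (suc (suc m) , lt , _) with subst (3 + m ≤_) (trans (len (partner s)) (cong suc ℓ≡1)) lt
      ... | s≤s (s≤s ())

    Blockwise : Subset (total ns) → Subset (total ns) → Set
    Blockwise x y = ∀ i → block ns x i ≡ block ns y i
      ⊎ (Full (A i) × block ns x i ≡ ∅ × block ns y i ≡ 𝟏)

    -- `Exceptional` restated in blocks: positions depend on the cuboid but blocks do not, so the
    -- outcomes of two cuboids become comparable.
    data Outcome (x y : Subset (total ns)) : Set where
      full : (∀ i → ¬ Marked i → ℓ i ≡ 0) → (∀ i → Marked i → block ns x i ≢ block ns y i) → Outcome x y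
      lone : ∀ s → Marked s → (∀ i → Marked i → i ≡ s) → block ns x s ≢ block ns y s →
        partner s ≢ s → ℓ (partner s) ≡ 1 → block ns x (partner s) ≡ tail s (A (partner s)) → Outcome x y

    ∣block∣ : ∀ {v} → Bounded v → ∀ i → ∣ block ns (place v) i ∣ ≡ offset i + lookup v i
    ∣block∣ {v} bounded i = trans (cong ∣_∣ (block-place v i)) (card i (bounded i))

    module _ {p q : V} (p≤ : Bounded p) (q≤ : Bounded q) (blockwise : Blockwise (place p) (place q)) where

      block-≡ : ∀ i → block ns (place p) i ≡ block ns (place q) i → lookup p i ≡ lookup q i
      block-≡ i eq = +-cancelˡ-≡ (offset i) _ _ (trans (sym (∣block∣ p≤ i)) (trans (cong ∣_∣ eq) (∣block∣ q≤ i)))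

      switch : Switch p q
      switch i with blockwise i
      ... | inj₁ eq = inj₁ (block-≡ i eq)
      ... | inj₂ (fullA , x≡∅ , y≡𝟏) = inj₂ (m
          , ℕₚ.m+n≡0⇒n≡0 (offset i) (trans (sym (∣block∣ p≤ i)) (trans (cong ∣_∣ x≡∅) (Subsetₚ.∣⊥∣≡0 (lookup ns i))))
          , trans (cong (_+ lookup q i) (sym m)) (trans (sym (∣block∣ q≤ i)) (trans (cong ∣_∣ y≡𝟏)
              (trans (Subsetₚ.∣⊤∣≡n (lookup ns i)) (sym (marked⇒ℓ≡n m))))))
        where
        m : Marked i
        m = full⇒marked fullA

      outcome : place p ≢ place q → Exceptional p q → Outcome (place p) (place q)
      outcome x≢y (full unmarked ends) = full unmarked λ i m eq →
        let p≡0 , q≡ℓ = ends i m in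
        <⇒≢ (≤-trans (s≤s z≤n) (long-marked i m)) (trans (sym p≡0) (trans (block-≡ i eq) q≡ℓ))
      outcome x≢y (lone s m only c≢s ℓ≡1 p≡) = lone s m only
        (λ eq → x≢y (block-ext ns (same eq))) c≢s ℓ≡1
        (trans (block-place p (partner s)) (trans (cong (nth (A (partner s))) p≡) (tail-at s c≢s ℓ≡1)))
        where
        same : block ns (place p) s ≡ block ns (place q) s → ∀ i → block ns (place p) i ≡ block ns (place q) i
        same eq i with blockwise i
        ... | inj₁ eq′ = eq′
        ... | inj₂ (fullA , _) with only i (full⇒marked fullA)
        ...   | refl = eq

    chain-outcome : ∀ {G x y} → G ∈ chains → x ∈ G → y ∈ G → Blockwise x y → x ≢ y → Outcome x y
    chain-outcome {G} {x} {y} G∈ x∈ y∈ blockwise x≢y = unpack (∈-map⁻ (map place ∘ points) G∈) x∈ y∈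
      where
      unpack : (Σ[ C ∈ Saturated ] (C ∈ Decomposition.chains cuboid × G ≡ map place (points C))) →
        x ∈ G → y ∈ G → Outcome x y
      unpack (C , C∈ , refl) x∈ y∈ = pair (∈-map⁻ place x∈) (∈-map⁻ place y∈) blockwise x≢y
        where
        pair : (Σ[ p ∈ V ] (p ∈ points C × x ≡ place p)) → (Σ[ q ∈ V ] (q ∈ points C × y ≡ place q)) →
          Blockwise x y → x ≢ y → Outcome x y
        pair (p , p∈ , refl) (q , q∈ , refl) bw x≢y
          with All.lookup (Decomposition.only cuboid) C∈ p q p∈ q∈
                 (switch (chain-bounded cuboid C∈ p∈) (chain-bounded cuboid C∈ q∈) bw)
        ... | inj₁ refl = ⊥-elim (x≢y refl)
        ... | inj₂ exc = outcome (chain-bounded cuboid C∈ p∈) (chain-bounded cuboid C∈ q∈) bw x≢y exc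

    chain-blocks : ∀ {G x} → G ∈ chains → x ∈ G → ∀ i → block ns x i ∈ A i
    chain-blocks {G} {x} G∈ x∈ = unpack (∈-map⁻ (map place ∘ points) G∈) x∈
      where
      unpack : (Σ[ C ∈ Saturated ] (C ∈ Decomposition.chains cuboid × G ≡ map place (points C))) →
        x ∈ G → ∀ i → block ns x i ∈ A i
      unpack (C , C∈ , refl) x∈ with ∈-map⁻ place x∈
      ... | p , p∈ , refl = placed-block (chain-bounded cuboid C∈ p∈)

  H : Fin k → List (Chain (total ns))
  H j = concatMap (λ a → At.chains {j} a) (choices (λ i → tagged (F i j)))

  H-prod : ∀ j → concat (H j) ↭ prod ns (λ i → concat (F i j))
  H-prod j = ↭-trans (merge cubes) (↭-trans (prod-choices ns (λ i → tagged (F i j)))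
      (↭-reflexive (prod-cong ns (λ i → cong concat (map-proj₁-tagged (F i j))))))
    where
    cubes = choices (λ i → tagged (F i j))
    merge : ∀ as → concat (concatMap (λ a → At.chains {j} a) as) ↭ concat (map (λ a → prod ns (λ i → proj₁ (a i))) as)
    merge [] = ↭-refl
    merge (a ∷ as) = ↭-trans (↭-reflexive (sym (Listₚ.concat-++ (At.chains {j} a) (concatMap (λ a → At.chains {j} a) as))))
      (++⁺ (At.placed-prod {j} a (At.cuboid {j} a)) (merge as))
    prod-cong : ∀ {r} (ns : Vec ℕ r) {A B : ∀ i → Chain (lookup ns i)} → (∀ i → A i ≡ B i) → prod ns A ≡ prod ns B
    prod-cong [] _ = refl
    prod-cong (n ∷ ns) eq = cong₂ (cartesianProductWith _⧺_) (eq zero) (prod-cong ns (eq ∘ suc))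

  H-symmetric : ∀ j G → G ∈ H j → IsSymmetricChain (total ns) G
  H-symmetric j G G∈ = let a , G∈a = concatMap-∈⁻ {xs = choices (λ i → tagged (F i j))} G∈ in At.placed-symmetric a (At.cuboid a) G G∈a

  H-SCD : ∀ j → IsSCD (total ns) (H j)
  H-SCD j = H-symmetric j
    , AllPairs-resp-↭ (λ x≢y → x≢y ∘ sym) (↭-sym (H-prod j)) (prod-unique ns _ (λ i → proj₁ (proj₂ (scd i j))))
    , λ X → ∈-resp-↭ (↭-sym (H-prod j)) (prod-∈ ns _ X (λ i → proj₂ (proj₂ (scd i j)) (block ns X i)))

  module _ {j j′ : Fin k} (j≢j′ : j ≢ j′) (a : Cube j) (b : Cube j′) {x y : Subset (total ns)}
           (x∈A : ∀ i → block ns x i ∈ proj₁ (a i)) (x∈B : ∀ i → block ns x i ∈ proj₁ (b i))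
           (related : ∀ i → block ns x i ≡ block ns y i
              ⊎ (Full (proj₁ (a i)) × Full (proj₁ (b i)) × block ns x i ≡ ∅ × block ns y i ≡ 𝟏)) where
    private
      module A = At a
      module B = At b

    relatedᴬ : A.Blockwise x y
    relatedᴬ i with related i
    ... | inj₁ eq = inj₁ eq
    ... | inj₂ (fullA , _ , ends) = inj₂ (fullA , ends)

    relatedᴮ : B.Blockwise x y
    relatedᴮ i with related i
    ... | inj₁ eq = inj₁ eq
    ... | inj₂ (_ , fullB , ends) = inj₂ (fullB , ends)

    differ⇒A : ∀ i → block ns x i ≢ block ns y i → A.Marked i
    differ⇒A i neq with related i
    ... | inj₁ eq = ⊥-elim (neq eq)
    ... | inj₂ (fullA , _) = A.full⇒marked fullA

    differ⇒B : ∀ i → block ns x i ≢ block ns y i → B.Marked i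
    differ⇒B i neq with related i
    ... | inj₁ eq = ⊥-elim (neq eq)
    ... | inj₂ (_ , fullB , _) = B.full⇒marked fullB

    differ⇒ends : ∀ i → block ns x i ≢ block ns y i → block ns x i ≡ ∅ × block ns y i ≡ 𝟏
    differ⇒ends i neq with related i
    ... | inj₁ eq = ⊥-elim (neq eq)
    ... | inj₂ (_ , _ , ends) = ends

    singleton : ∀ {n} {C : Chain n} {z} → length C ≡ 1 → z ∈ C → C ≡ [ z ]
    singleton {C = _ ∷ []} _ (here refl) = refl

    -- Both cuboids are full exactly in the blocks where `x` and `y` differ. Any other factor is a
    -- single point in both, namely the block of `x`, which goodness in even dimension forbids.
    full-full : (∀ i → ¬ A.Marked i → A.ℓ i ≡ 0) → (∀ i → A.Marked i → block ns x i ≢ block ns y i) →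
      (∀ i → ¬ B.Marked i → B.ℓ i ≡ 0) → (∀ i → B.Marked i → block ns x i ≢ block ns y i) → x ≡ ∅ × y ≡ 𝟏
    full-full unmarkedA differA unmarkedB differB with Finₚ.all? A.Marked?
    ... | yes all =
      block-ext ns (λ i → trans (proj₁ (differ⇒ends i (differA i (all i)))) (sym (block-replicate ns outside i)))
      , block-ext ns (λ i → trans (proj₂ (differ⇒ends i (differA i (all i)))) (sym (block-replicate ns inside i)))
    ... | no ¬all with Finₚ.¬∀⟶∃¬ r A.Marked A.Marked? ¬all
    ...   | i , ¬m = ⊥-elim (good-even i (A.ℓ≡0⇒even ℓA≡0) j j′ j≢j′ (A.A i) (proj₂ (a i))
        (subst (_∈ F i j′) (trans (singleton lenB (x∈B i)) (sym (singleton lenA (x∈A i)))) (proj₂ (b i))) lenA)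
      where
      ℓA≡0 = unmarkedA i ¬m
      lenA : length (A.A i) ≡ 1
      lenA = trans (A.len i) (cong suc ℓA≡0)
      lenB : length (B.A i) ≡ 1
      lenB = trans (B.len i) (cong suc (unmarkedB i (λ m → ¬m (differ⇒A i (differB i m)))))

    -- Equal tails make the two 2-element chains equal, so chains of different families share two
    -- points. They are not full, `s` being the only full factor, and almost orthogonality is
    -- violated.
    lone-lone : ∀ s → A.Marked s → partner s ≢ s → (∀ i → A.Marked i → i ≡ s) →
      A.ℓ (partner s) ≡ 1 → block ns x (partner s) ≡ tail s (A.A (partner s)) →
      B.ℓ (partner s) ≡ 1 → block ns x (partner s) ≡ tail s (B.A (partner s)) → ⊥
    lone-lone s m c≢s only ℓA≡1 tailA ℓB≡1 tailB = contradict
        (common-pair (≤-trans (s≤s z≤n) (4≤ns c)) (ao c j j′ j≢j′ _ _ (proj₂ (a c)) (proj₂ (b c)))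
          first∈ (subst (nth (A.A c) 0 ∈_) same first∈) second∈ (subst (nth (A.A c) 1 ∈_) same second∈)
          (A.mono c z≤n (≤-reflexive (sym ℓA≡1))))
      where
      c = partner s
      lenA : length (A.A c) ≡ 2
      lenA = trans (A.len c) (cong suc ℓA≡1)
      lenB : length (B.A c) ≡ 2
      lenB = trans (B.len c) (cong suc ℓB≡1)
      same : A.A c ≡ B.A c
      same = tail-injective s c≢s j j′ (A.A c) (B.A c) (proj₂ (a c)) (proj₂ (b c)) lenA lenB
        (trans (sym tailA) tailB)
      first∈ : nth (A.A c) 0 ∈ A.A c
      first∈ = A.in-chain c z≤n
      second∈ : nth (A.A c) 1 ∈ A.A c
      second∈ = A.in-chain c (≤-reflexive (sym ℓA≡1))
      contradict : nth (A.A c) 0 ≡ nth (A.A c) 1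
        ⊎ (Full (A.A c) × Full (B.A c) × nth (A.A c) 0 ≡ ∅ × nth (A.A c) 1 ≡ 𝟏) → ⊥
      contradict (inj₁ eq) = ℕₚ.0≢1+n (+-cancelˡ-≡ (A.offset c) 0 1 (trans (sym (A.card c z≤n))
        (trans (cong ∣_∣ eq) (A.card c (≤-reflexive (sym ℓA≡1))))))
      contradict (inj₂ (fullA , _)) = c≢s (only c (A.full⇒marked fullA))

    compare : A.Outcome x y → B.Outcome x y → x ≡ ∅ × y ≡ 𝟏
    compare (At.full uA dA) (At.full uB dB) = full-full uA dA uB dB
    -- The mixed cases fail by parity: the partner factor is a single point in one cuboid and has
    -- two points in the other.
    compare (At.full uA dA) (At.lone s m only neq c≢s ℓ≡1 _) = ⊥-elim (even⇒¬odd {lookup ns (partner s)}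
      (A.ℓ≡0⇒even (uA (partner s) (λ m′ → c≢s (only (partner s) (differ⇒B _ (dA _ m′)))))) (B.ℓ≡1⇒odd ℓ≡1))
    compare (At.lone s m only neq c≢s ℓ≡1 _) (At.full uB dB) = ⊥-elim (even⇒¬odd {lookup ns (partner s)}
      (B.ℓ≡0⇒even (uB (partner s) (λ m′ → c≢s (only (partner s) (differ⇒A _ (dB _ m′)))))) (A.ℓ≡1⇒odd ℓ≡1))
    compare (At.lone s m only neq c≢s ℓA≡1 tailA) (At.lone s′ m′ only′ neq′ c≢s′ ℓB≡1 tailB)
      -- The blocks differ at `s′`, so both cuboids are full there: the two lone factors, and hence
      -- their partners, coincide.
      with only s′ (differ⇒A s′ neq′)
    ... | refl = ⊥-elim (lone-lone s m c≢s only ℓA≡1 tailA ℓB≡1 tailB)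

  -- Almost orthogonality in each factor turns a common pair into a switch of both cuboids at once,
  -- so both outcomes hold for the same pair.
  H-orthogonal : ∀ j j′ → j ≢ j′ → 1 ≤ total ns → AlmostOrthogonal (total ns) (H j) (H j′)
  H-orthogonal j j′ j≢j′ 1≤N G G′ G∈ G′∈ =
    let a , G∈a = concatMap-∈⁻ {xs = choices (λ i → tagged (F i j))} G∈
        b , G′∈b = concatMap-∈⁻ {xs = choices (λ i → tagged (F i j′))} G′∈
    in almost-orthogonal 1≤N (H-symmetric j G G∈) (key a b G∈a G′∈b)
    where
    key : ∀ (a : Cube j) (b : Cube j′) → G ∈ At.chains a → G′ ∈ At.chains b →
      ∀ x y → x ∈ G → x ∈ G′ → y ∈ G → y ∈ G′ → x ⊆ y → x ≡ y ⊎ (x ≡ ∅ × y ≡ 𝟏)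
    key a b G∈a G′∈b x y x∈G x∈G′ y∈G y∈G′ x⊆y = decide (x ≟ˢ y)
      where
      xA = At.chain-blocks a G∈a x∈G
      xB = At.chain-blocks b G′∈b x∈G′
      related : ∀ i → block ns x i ≡ block ns y i
        ⊎ (Full (proj₁ (a i)) × Full (proj₁ (b i)) × block ns x i ≡ ∅ × block ns y i ≡ 𝟏)
      related i = common-pair (≤-trans (s≤s z≤n) (4≤ns i)) (ao i j j′ j≢j′ _ _ (proj₂ (a i)) (proj₂ (b i)))
        (xA i) (xB i) (At.chain-blocks a G∈a y∈G i) (At.chain-blocks b G′∈b y∈G′ i) (block-⊆ ns x⊆y i)
      decide : Dec (x ≡ y) → x ≡ y ⊎ (x ≡ ∅ × y ≡ 𝟏)
      decide (yes x≡y) = inj₁ x≡y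
      decide (no x≢y) = inj₂ (compare j≢j′ a b xA xB related
        (At.chain-outcome a G∈a x∈G y∈G (relatedᴬ j≢j′ a b xA xB related) x≢y)
        (At.chain-outcome b G′∈b x∈G′ y∈G′ (relatedᴮ j≢j′ a b xA xB related) x≢y))

-- Of two good odd factors at least one differs from `s`; a single one might itself be the lone full
-- factor.
choose-partner : ∀ {k r} (ns : Vec ℕ r) (F : (i : Fin r) → Fin k → List (Chain (lookup ns i))) →
  ((∀ i → Odd (lookup ns i) → Good (lookup ns i) k (F i))
    ⊎ (Σ (Fin r) λ i₁ → Σ (Fin r) λ i₂ → i₁ ≢ i₂
        × Odd (lookup ns i₁) × Odd (lookup ns i₂)
        × Good (lookup ns i₁) k (F i₁) × Good (lookup ns i₂) k (F i₂))) →
  ∀ s → Σ[ c ∈ Fin r ] ((c ≡ s × (∀ t → t ≢ s → ¬ Odd (lookup ns t)))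
                       ⊎ (c ≢ s × Odd (lookup ns c) × GoodOdd (lookup ns c) k (F c)))
choose-partner ns F (inj₁ good) s with Finₚ.any? (λ t → candidate t)
  where
  candidate : ∀ t → Dec (t ≢ s × Odd (lookup ns t))
  candidate t with t Finₚ.≟ s | lookup ns t % 2 ℕₚ.≟ 1
  ... | yes t≡s | _ = no (λ (t≢s , _) → t≢s t≡s)
  ... | no t≢s | yes odd = yes (t≢s , odd)
  ... | no _ | no ¬odd = no (¬odd ∘ proj₂)
... | yes (c , c≢s , odd) = c , inj₂ (c≢s , odd , proj₂ (good c odd) odd)
... | no none = s , inj₁ (refl , λ t t≢s odd → none (t , t≢s , odd))
choose-partner ns F (inj₂ (i₁ , i₂ , i₁≢i₂ , odd₁ , odd₂ , good₁ , good₂)) s with i₁ Finₚ.≟ s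
... | no i₁≢s = i₁ , inj₂ (i₁≢s , odd₁ , proj₂ good₁ odd₁)
... | yes refl = i₂ , inj₂ (i₁≢i₂ ∘ sym , odd₂ , proj₂ good₂ odd₂)

theorem3p3 : (k r : ℕ) → 3 ≤ k → 1 ≤ r →
    (ns : Vec ℕ r) → (∀ i → 2 ≤ lookup ns i) →
    (F : (i : Fin r) → Fin k → List (Chain (lookup ns i))) →
    (∀ i j → IsSCD (lookup ns i) (F i j)) →
    (∀ i → PairwiseAlmostOrthogonal (lookup ns i) k (F i)) →
    (∀ i → Even (lookup ns i) → Good (lookup ns i) k (F i)) →
    ((∀ i → Odd (lookup ns i) → Good (lookup ns i) k (F i))
    ⊎ (Σ (Fin r) λ i₁ → Σ (Fin r) λ i₂ → i₁ ≢ i₂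
    × Odd (lookup ns i₁) × Odd (lookup ns i₂)
    × Good (lookup ns i₁) k (F i₁) × Good (lookup ns i₂) k (F i₂))) →
    Σ (Fin k → List (Chain (total ns))) λ H →
    (∀ j → IsSCD (total ns) (H j))
    × PairwiseAlmostOrthogonal (total ns) k H
    × (∀ j C → C ∈ H j →
    Σ ((i : Fin r) → Chain (lookup ns i)) λ A →
    (∀ i → A i ∈ F i j)
    × (∀ (x : Subset (total ns)) → x ∈ C → ∀ i → block ns x i ∈ A i))
theorem3p3 k r 3≤k 1≤r ns 2≤ns F scd ao good-even good-odd =
  P.H , P.H-SCD , (λ j j′ j≢j′ → P.H-orthogonal j j′ j≢j′ (total-positive 1≤r ns 2≤ns))
  , λ j C C∈ → let a , C∈a = concatMap-∈⁻ {xs = choices (λ i → tagged (F i j))} C∈ in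
      (λ i → proj₁ (a i)) , (λ i → proj₂ (a i)) , λ x x∈ → P.At.chain-blocks a C∈a x∈
  where
  module P = Product ns (λ i → at-least-four 3≤k (2≤ns i) (F i) (scd i) (ao i)) F scd ao
    (λ i even → proj₁ (good-even i even) even) (choose-partner ns F good-odd)
  total-positive : ∀ {r} → 1 ≤ r → (ns : Vec ℕ r) → (∀ i → 2 ≤ lookup ns i) → 1 ≤ total ns
  total-positive _ (n ∷ ns) 2≤ = ≤-trans (≤-trans (n≤1+n 1) (2≤ zero)) (m≤m+n n (total ns))
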